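{- Let $\lambda$ be a partition. Then $\Phi:\mathrm{Tab}_\lambda\to\mathrm{RPP}_\lambda$ and $\xi_\lambda:\mathrm{RPP}_\lambda\to\mathrm{Tab}_\lambda$ are mutually inverse bijections.
   Context: Cells are pairs $(i,j)\in\mathbb Z^2$; $\mathrm n(i,j)=(i-1,j)$, $\mathrm e(i,j)=(i,j+1)$, $\mathrm s(i,j)=(i+1,j)$, $\mathrm w(i,j)=(i,j-1)$. A partition $\nu$ is identified with its Young diagram; $\nu'$ is its conjugate. A reverse plane partition of shape $\nu$ is $\pi:\nu\to\mathbb N$ with $\pi(u)\le\pi(\mathrm e u),\pi(\mathrm s u)$, with conventions $\pi(i,j)=0$ if $i\le0$ or $j\le0$, $\pi(i,j)=\infty$ if $i,j\ge1$, $(i,j)\notin\nu$; $\mathrm{RPP}_\nu$ is the set of them, $0$ the zero one. $\mathrm{Tab}_\nu$ is the set of all maps $t:\nu\to\mathbb N$. Content $c(i,j)=j-i$. Outer corner of $\nu$: $u\in\nu$ with $\mathrm e u,\mathrm s u\notin\nu$; inner corner: $\mathrm e u,\mathrm s u\in\nu$, $\mathrm e\mathrm s u\notin\nu$. With inner corner contents $i_1<\dots<i_r$ and outer corner contents $o_1<\dots<o_{r+1}$ (interlacing), $\mathcal I=\{u\in\nu:c(u)=i_k\}$, $\mathcal O=\{u\in\nu:c(u)=o_k\}$, $\mathcal A=\{u\in\nu:c(u)<o_1\text{ or }i_k<c(u)<o_{k+1}\text{ for some }k\in[r]\}$, $\mathcal B=\{u\in\nu:o_k<c(u)<i_k\text{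 for some }k\in[r]\text{ or }c(u)>o_{r+1}\}$. North-east path: $(u_0,\dots,u_s)$ in $\nu$, $u_k\in\{\mathrm n u_{k-1},\mathrm e u_{k-1}\}$, length $s$, head $\alpha=u_0$, tail $\omega=u_s$; south-west path $(v_0,\dots,v_s)$, $v_k\in\{\mathrm s v_{k-1},\mathrm w v_{k-1}\}$, $\alpha=v_s$, $\omega=v_0$. Rim-hook: north-east path $h$ with $\mathrm s\alpha(h)\notin\nu$, $\mathrm e\omega(h)\notin\nu$, $\mathrm e\mathrm s u\notin\nu$ for $u\in h$; for $u=(i,j)\in\nu$, $h^u$ is the rim-hook from $(\nu'_j,j)$ to $(i,\nu_i)$. Reverse lexicographic order: $(i,j)\le(k,l)$ iff $j>l$, or $j=l$ and $i\ge k$; $h^u\le h^v$ iff $u\le v$. Insertion: $(\pi+P)(u)=\pi(u)+1$ for $u\in P$, else $\pi(u)$; $(P,\pi)$ compatible if $u\in P\cap(\mathcal I\cup\mathcal A)$ implies $\mathrm e u\in P$ and $\pi(u)=\pi(\mathrm e u)$, and $u,\mathrm s u\in P$ implies $\pi(u)=\pi(\mathrm s u)$. $h$ inserts into $\pi$ if some path $P$ has $\omega(P)=\omega(h)$, $\ell(P)=\ell(h)$, $(P,\pi)$ compatible and $\pi+P$ a reverse plane partition; then $h*\pi=\pi+P(h,\pi)$, where $P(h,\pi)$ is the south-west path from $\omega(h)$ which, while its length is less than $\ell(h)$, moves from current $u$ to $\mathrm s u$ if $u\in\mathcal B\cup\mathcal I$ and $\pi(u)=\pi(\mathrm s u)$,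 else to $\mathrm w u$. $\Phi:\mathrm{Tab}_\lambda\to\mathrm{RPP}_\lambda$: for $t$, take the multiset containing $t(u)$ copies of $h^u$ for each $u\in\lambda$, list it as $h_1\le\dots\le h_s$, and set $\Phi(t)=h_1*(h_2*(\cdots(h_s*0)))$ (these insertions are always defined). For an outer corner $x$ of $\lambda$ and $\mu=\lambda\setminus\{x\}$, $\zeta_{\lambda,x}:\mathrm{RPP}_\lambda\to\mathrm{RPP}_\mu$ is $\zeta_{\lambda,x}(\pi)(u)=\max\{\pi(\mathrm n u),\pi(\mathrm w u)\}+\min\{\pi(\mathrm e u),\pi(\mathrm s u)\}-\pi(u)$ if $c(u)=c(x)$, and $\pi(u)$ otherwise ($u\in\mu$). $\xi_\lambda:\mathrm{RPP}_\lambda\to\mathrm{Tab}_\lambda$ is defined recursively (with $\xi_\emptyset$ trivial): for any outer corner $x$, $\xi_\lambda(\pi)(x)=\pi(x)-\max\{\pi(\mathrm n x),\pi(\mathrm w x)\}$ and $\xi_\lambda(\pi)(u)=\xi_\mu(\zeta_{\lambda,x}(\pi))(u)$ for $u\in\mu$; this is known (Pak) to be independent of the choice of $x$. -}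

module Defs where

open import Data.Nat as ℕ using (ℕ; zero; suc; _+_; _∸_; _≤_; _⊔_; _⊓_)
import Data.Nat.Properties as ℕP
open import Data.Integer as ℤ using (ℤ; +_)
import Data.Integer.Properties as ℤP
open import Data.Bool.ListAction using (any)
open import Data.Nat.ListAction using (sum)
open import Data.List using (List; []; _∷_; length; filter; map; concatMap;
  replicate; foldr; upTo; downFrom; zip; last)
open import Data.List.Relation.Unary.All using (All)
open import Data.List.Relation.Unary.Linked using (Linked)
open import Data.Maybe using (Maybe; just; nothing)
open import Data.Product using (_×_; _,_)
open import Data.Bool using (Bool; true; false; _∧_; _∨_; not; if_then_else_)
open import Data.Unit using (⊤)
open import Data.Empty using (⊥)
open import Relation.Nullary.Decidable using (⌊_⌋)
open import Data.List.Sort.MergeSort ℤP.≤-decTotalOrder using (sort)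

IsPartition : List ℕ → Set
IsPartition lam = All (1 ≤_) lam × Linked (λ a b → b ≤ a) lam

-- Cells (i , j); rows and columns are 1-indexed; index 0 is the boundary.
Cell : Set
Cell = ℕ × ℕ

row : List ℕ → ℕ → ℕ
row _        zero          = 0
row []       (suc _)       = 0
row (a ∷ _)  (suc zero)    = a
row (_ ∷ as) (suc (suc i)) = row as (suc i)

conj : List ℕ → ℕ → ℕ
conj lam j = length (filter (λ a → j ℕ.≤? a) lam)

_∈Y_ : Cell → List ℕ → Set
(i , j) ∈Y lam = (1 ≤ i) × (1 ≤ j) × (j ≤ row lam i)

inb : List ℕ → Cell → Bool
inb lam (i , j) = (1 ℕ.≤ᵇ i) ∧ (1 ℕ.≤ᵇ j) ∧ (j ℕ.≤ᵇ row lam i)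

nC eC sC wC : Cell → Cell
nC (i , j) = (i ∸ 1 , j)
eC (i , j) = (i , suc j)
sC (i , j) = (suc i , j)
wC (i , j) = (i , j ∸ 1)

cellEq : Cell → Cell → Bool
cellEq (i , j) (k , l) = (i ℕ.≡ᵇ k) ∧ (j ℕ.≡ᵇ l)

content : Cell → ℤ
content (i , j) = (+ j) ℤ.- (+ i)

data ℕ∞ : Set where
  fin : ℕ → ℕ∞
  ∞   : ℕ∞

_≤∞_ : ℕ∞ → ℕ∞ → Set
fin m ≤∞ fin n = m ≤ n
fin _ ≤∞ ∞     = ⊤
∞     ≤∞ fin _ = ⊥
∞     ≤∞ ∞     = ⊤

_≡∞ᵇ_ : ℕ∞ → ℕ∞ → Bool
fin m ≡∞ᵇ fin n = m ℕ.≡ᵇ n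
∞     ≡∞ᵇ ∞     = true
_     ≡∞ᵇ _     = false

_⊔∞_ : ℕ∞ → ℕ∞ → ℕ∞
fin m ⊔∞ fin n = fin (m ⊔ n)
_     ⊔∞ _     = ∞

_⊓∞_ : ℕ∞ → ℕ∞ → ℕ∞
fin m ⊓∞ fin n = fin (m ⊓ n)
fin m ⊓∞ ∞     = fin m
∞     ⊓∞ y     = y

-- only ever applied to finite values in this file
toℕ : ℕ∞ → ℕ
toℕ (fin n) = n
toℕ ∞       = 0

-- A filling of a shape: a map cells → ℕ (only its values on the diagram
-- matter).  Tab_λ is the set of all such maps.
Filling : Set
Filling = Cell → ℕ

val : List ℕ → Filling → Cell → ℕ∞
val lam π (zero , _)    = fin 0
val lam π (suc _ , zero) = fin 0
val lam π u@(suc _ , suc _) = if inb lam u then fin (π u) else ∞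

IsRPP : List ℕ → Filling → Set
IsRPP lam π = ∀ u → u ∈Y lam →
  (val lam π u ≤∞ val lam π (eC u)) × (val lam π u ≤∞ val lam π (sC u))

cells : List ℕ → List Cell
cells lam = concatMap (λ i → map (λ j → (i , j)) (map suc (upTo (row lam i))))
                      (map suc (upTo (length lam)))

isOuterCorner : List ℕ → Cell → Bool
isOuterCorner lam u = inb lam u ∧ not (inb lam (eC u)) ∧ not (inb lam (sC u))

isInnerCorner : List ℕ → Cell → Bool
isInnerCorner lam u =
  inb lam u ∧ inb lam (eC u) ∧ inb lam (sC u) ∧ not (inb lam (eC (sC u)))

innerContents : List ℕ → List ℤ
innerContents lam = sort (map content (filter (λ u → Data.Bool._≟_ (isInnerCorner lam u) true) (cells lam)))

outerContents : List ℕ → List ℤ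
outerContents lam = sort (map content (filter (λ u → Data.Bool._≟_ (isOuterCorner lam u) true) (cells lam)))

_<ℤᵇ_ : ℤ → ℤ → Bool
a <ℤᵇ b = ⌊ a ℤ.<? b ⌋

_≡ℤᵇ_ : ℤ → ℤ → Bool
a ≡ℤᵇ b = ⌊ a ℤ.≟ b ⌋

inI : List ℕ → Cell → Bool
inI lam u = any (λ i → content u ≡ℤᵇ i) (innerContents lam)

inB : List ℕ → Cell → Bool
inB lam u =
  any (λ { (o , i) → (o <ℤᵇ content u) ∧ (content u <ℤᵇ i) })
      (zip (outerContents lam) (innerContents lam))
  ∨ (case-last (last (outerContents lam)))
  where
  case-last : Maybe ℤ → Bool
  case-last (just o) = o <ℤᵇ content u
  case-last nothing  = false

hookTail : List ℕ → Cell → Cell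
hookTail lam (i , j) = (i , row lam i)

-- length ℓ(h^u): number of steps of a north-east path from (λ'_j , j) to (i , λ_i)
hookLen : List ℕ → Cell → ℕ
hookLen lam (i , j) = (conj lam j ∸ i) + (row lam i ∸ j)

pathSW : List ℕ → Filling → Cell → ℕ → List Cell
pathSW lam π u zero    = u ∷ []
pathSW lam π u (suc k) = u ∷ pathSW lam π next k
  where
  next : Cell
  next = if (inB lam u ∨ inI lam u) ∧ (val lam π u ≡∞ᵇ val lam π (sC u))
         then sC u else wC u

addPath : List Cell → Filling → Filling
addPath P π u = if any (cellEq u) P then suc (π u) else π u

insertHook : List ℕ → Cell → Filling → Filling
insertHook lam u π = addPath (pathSW lam π (hookTail lam u) (hookLen lam u)) π

-- cells of λ listed increasingly in reverse lexicographic order: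
-- (i,j) ≤ (k,l) iff j > l, or j = l and i ≥ k
cellsRevLexAsc : List ℕ → List Cell
cellsRevLexAsc lam =
  concatMap (λ j → map (λ i → (i , j)) (map suc (downFrom (conj lam j))))
            (map suc (downFrom (row lam 1)))

-- the multiset {t(u) copies of h^u}, sorted h₁ ≤ … ≤ h_s (indexed by u)
hookMultiset : List ℕ → Filling → List Cell
hookMultiset lam t = concatMap (λ u → replicate (t u) u) (cellsRevLexAsc lam)

zeroFilling : Filling
zeroFilling _ = 0

Φ : List ℕ → Filling → Filling
Φ lam t = foldr (insertHook lam) zeroFilling (hookMultiset lam t)

ζ : List ℕ → Cell → Filling → Filling
ζ lam x π u =
  if content u ≡ℤᵇ content x
  then toℕ ((val lam π (nC u) ⊔∞ val lam π (wC u))) +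
       toℕ ((val lam π (eC u) ⊓∞ val lam π (sC u))) ∸ π u
  else π u

lastPart : List ℕ → ℕ
lastPart []           = 0
lastPart (a ∷ [])     = a
lastPart (_ ∷ b ∷ bs) = lastPart (b ∷ bs)

-- the outer corner chosen in the recursion: the last cell of the last row
corner : List ℕ → Cell
corner lam = (length lam , lastPart lam)

shrink : List ℕ → List ℕ
shrink []                   = []
shrink (zero ∷ [])          = []
shrink (suc zero ∷ [])      = []
shrink (suc (suc a) ∷ [])   = suc a ∷ []
shrink (a ∷ b ∷ bs)         = a ∷ shrink (b ∷ bs)

-- ξ with fuel (the fuel is |λ|, one cell removed per step)
ξ' : ℕ → List ℕ → Filling → Filling
ξ' zero    lam π u = 0
ξ' (suc k) lam π u =
  if cellEq u x
  then π x ∸ toℕ (val lam π (nC x) ⊔∞ val lam π (wC x))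
  else ξ' k (shrink lam) (ζ lam x π) u
  where
  x : Cell
  x = corner lam

ξ : List ℕ → Filling → Filling
ξ lam = ξ' (sum lam) lam

{-# OPTIONS --safe #-}
module Submission where

-- Let x be the last cell of the last row of λ, with content c, and μ = λ ∖ {x}. Along each diagonal
-- the entries form a partition, consecutive diagonals interlace, and a hook adds one box to each
-- diagonal of a content interval. Passing from λ to μ only exchanges the types (south/west) of the two
-- rim steps around the diagonal of x, and ζ toggles that diagonal. Hence it suffices that inserting a
-- hook commutes with the toggle: ζ (h * π) = h * ζ π, where h^x only raises the entry of x.
--   * Hooks of columns left of x: the diagonal c of λ agrees with c − 1, and the diagonal c + 1 of μ
--     with c, so both insertions make the same choice.
--   * Hooks of the column of x end in λ on the diagonal c and in μ on c + 1. By the bumping lemma their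
--     ends move weakly south, so the relevant entries of c and c + 1 still agree and the
--     extra step in λ is exactly the change of the toggle.
--   * Hooks of columns right of x do not reach the diagonals c − 1, c, c + 1.
-- Induction on λ gives that Φ t is a reverse plane partition and ξ (Φ t) = t; the other composite
-- follows because ξ is injective, the toggle being an involution.

-- That insertion preserves reverse plane partitions is never argued on λ itself. A filling of λ is
-- monotone because it is the toggle of a monotone filling of μ, and a path stays inside λ because
-- off the diagonal of x it follows a path of μ. The induction therefore carries this information
-- for every single hook, not only for the final filling. The toggle is kept as the relation π v + ρ
-- v = nw + es. It is symmetric in π and ρ, because both share the neighbours of the diagonal: it
-- reads as ζ in one direction and as the inverse of ζ in the other, free of truncated subtraction.
-- The order of insertion is essential. Columns come from left to right and each column from the top
-- down, so the copies of h^x come last among the hooks that meet the diagonal of x; until then the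
-- entry of x is exactly the maximum of its north and west neighbours. One obstacle is independent
-- of all this: 𝓑 and 𝓘 are given by sorted lists of corner contents, which is useless for comparing
-- λ with μ. They are first replaced by a condition on a single row, `Vertical`.

open import Defs
open import Data.Nat
open import Data.Nat.Properties
open import Data.Nat.ListAction using (sum)
open import Data.Integer as ℤ using (ℤ)
import Data.Integer.Properties as ℤP
open import Data.Nat.Tactic.RingSolver using (solve-∀)
import Data.Integer.Tactic.RingSolver as ℤSolver
open import Data.Bool as Bool using (Bool; true; false; _∧_; _∨_; T; if_then_else_)
open import Data.Bool.ListAction using (any; or)
open import Data.Bool.Properties using (T-≡; T-∧; T-∨; ¬-not)
open import Data.List using (List; []; _∷_; [_]; _++_; length; filter; map; concatMap; foldr; replicate; upTo; downFrom; zip; last)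
open import Data.List.Properties using (filter-accept; filter-reject; filter-++; map-++; map-cong; concatMap-++; upTo-∷ʳ; ++-assoc; ++-identityʳ)
open import Data.List.Relation.Unary.All using (All; []; _∷_)
open import Data.List.Relation.Unary.Linked using (Linked; []; [-]; _∷_)
open import Data.List.Relation.Binary.Pointwise using (Pointwise-≡⇒≡)
open import Data.List.Relation.Binary.Permutation.Propositional using (_↭_; ↭-refl; ↭-trans; ↭-reflexive; prep; ↭⇒↭ₛ)
open import Data.List.Relation.Binary.Permutation.Propositional.Properties using (++-comm)
open import Data.List.Relation.Unary.Sorted.TotalOrder ℤP.≤-totalOrder using (Sorted)
open import Data.List.Relation.Unary.Sorted.TotalOrder.Properties using (↗↭↗⇒≋)
open import Data.List.Sort.MergeSort ℤP.≤-decTotalOrder using (sort)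
open import Data.List.Sort.MergeSort.Properties ℤP.≤-decTotalOrder using (sort-↭; sort-↗)
open import Data.Maybe using (Maybe; just; nothing)
open import Data.Product using (_×_; _,_; proj₁; proj₂; ∃)
open import Data.Product.Properties using (≡-dec)
open import Data.Sum using (_⊎_; inj₁; inj₂)
open import Data.Unit using (⊤; tt)
open import Data.Empty using (⊥; ⊥-elim)
open import Function using (_∘_)
open import Function.Bundles using (Equivalence)
open import Relation.Nullary using (¬_; Dec; yes; no)
open import Relation.Nullary.Decidable using (toWitness; fromWitness)
open import Relation.Binary.Definitions using (tri<; tri≈; tri>)
open import Relation.Binary.PropositionalEquality hiding ([_])

-- Linear arithmetic by reflection. In `linear ρ hs g ps` the variable # i denotes the i-th
-- entry of ρ; the goal g is sought as a sum of hypotheses from hs, each used at most once.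

infix  9 #_ κ_
infixr 8 1+_
infixr 7 _⊕_
infix  6 _≼_ _≃_

data Exp : Set where
  #_  : ℕ → Exp
  κ_  : ℕ → Exp
  1+_ : Exp → Exp
  _⊕_ : Exp → Exp → Exp

⟦_⟧ : Exp → List ℕ → ℕ
⟦ # i ⟧           []      = 0
⟦ # zero ⟧        (n ∷ _) = n
⟦ # suc i ⟧       (_ ∷ ρ) = ⟦ # i ⟧ ρ
⟦ κ n ⟧           ρ       = n
⟦ 1+ e ⟧          ρ       = suc (⟦ e ⟧ ρ)
⟦ e ⊕ f ⟧         ρ       = ⟦ e ⟧ ρ + ⟦ f ⟧ ρ

data Fact : Set where
  _≼_ _≃_ : Exp → Exp → Fact

Holds : List ℕ → Fact → Set
Holds ρ (a ≼ b) = ⟦ a ⟧ ρ ≤ ⟦ b ⟧ ρ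
Holds ρ (a ≃ b) = ⟦ a ⟧ ρ ≡ ⟦ b ⟧ ρ

-- The separate singleton case keeps a trailing `tt` out of the tuples handed to `linear`.
AllHold : List ℕ → List Fact → Set
AllHold ρ []           = ⊤
AllHold ρ (h ∷ [])     = Holds ρ h
AllHold ρ (h ∷ k ∷ hs) = Holds ρ h × AllHold ρ (k ∷ hs)

-- Linear forms as coefficient lists, the constant term first.
Form : Set
Form = List ℕ

eval : Form → List ℕ → ℕ
eval []       _        = 0
eval (_ ∷ _)  []       = 0
eval (a ∷ as) (x ∷ xs) = a * x + eval as xs

_⊞_ : Form → Form → Form
[]       ⊞ bs       = bs
(a ∷ as) ⊞ []       = a ∷ as
(a ∷ as) ⊞ (b ∷ bs) = a + b ∷ as ⊞ bs

basis : ℕ → Form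
basis zero    = 1 ∷ []
basis (suc i) = 0 ∷ basis i

form : Exp → Form
form (# i)   = 0 ∷ basis i
form (κ n)   = n ∷ []
form (1+ e)  = (1 ∷ []) ⊞ form e
form (e ⊕ f) = form e ⊞ form f

-- Comparing coefficients is sound because the variables stand for natural numbers, so nonnegativity
-- is built in.
_≤ᶠ_ : Form → Form → Bool
[]       ≤ᶠ _        = true
(a ∷ as) ≤ᶠ []       = (a ≤ᵇ 0) ∧ (as ≤ᶠ [])
(a ∷ as) ≤ᶠ (b ∷ bs) = (a ≤ᵇ b) ∧ (as ≤ᶠ bs)

-- A hypothesis l ≤ r is spent by passing from the goal a ≤ b to a + r ≤ b + l.
derivable : List Fact → Form → Form → Bool
derivable []             a b = a ≤ᶠ b
derivable (l ≼ r ∷ hs) a b = derivable hs a b ∨ derivable hs (a ⊞ form r) (b ⊞ form l)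
derivable (l ≃ r ∷ hs) a b = derivable hs a b ∨ derivable hs (a ⊞ form r) (b ⊞ form l)
                               ∨ derivable hs (a ⊞ form l) (b ⊞ form r)

provable : List Fact → Fact → Bool
provable hs (a ≼ b) = derivable hs (form a) (form b)
provable hs (a ≃ b) = derivable hs (form a) (form b) ∧ derivable hs (form b) (form a)

private
  interchange : ∀ a b x s t → (a + b) * x + (s + t) ≡ a * x + s + (b * x + t)
  interchange = solve-∀

eval-⊞ : ∀ as bs ρ → eval (as ⊞ bs) ρ ≡ eval as ρ + eval bs ρ
eval-⊞ []       bs       ρ       = refl
eval-⊞ (a ∷ as) []       ρ       = sym (+-identityʳ _)
eval-⊞ (a ∷ as) (b ∷ bs) []      = refl
eval-⊞ (a ∷ as) (b ∷ bs) (x ∷ ρ) =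
  trans (cong ((a + b) * x +_) (eval-⊞ as bs ρ)) (interchange a b x (eval as ρ) (eval bs ρ))

eval-basis : ∀ i ρ → eval (basis i) ρ ≡ ⟦ # i ⟧ ρ
eval-basis zero    []      = refl
eval-basis (suc i) []      = refl
eval-basis zero    (x ∷ ρ) = trans (+-identityʳ _) (+-identityʳ _)
eval-basis (suc i) (x ∷ ρ) = eval-basis i ρ

eval-form : ∀ e ρ → eval (form e) (1 ∷ ρ) ≡ ⟦ e ⟧ ρ
eval-form (# i)   ρ = eval-basis i ρ
eval-form (κ n)   ρ = trans (+-identityʳ _) (*-identityʳ n)
eval-form (1+ e)  ρ = trans (eval-⊞ (1 ∷ []) (form e) (1 ∷ ρ)) (cong suc (eval-form e ρ))
eval-form (e ⊕ f) ρ = trans (eval-⊞ (form e) (form f) (1 ∷ ρ)) (cong₂ _+_ (eval-form e ρ) (eval-form f ρ))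

≤ᶠ-sound : ∀ as bs ρ → T (as ≤ᶠ bs) → eval as ρ ≤ eval bs ρ
≤ᶠ-sound []       bs ρ       t = z≤n
≤ᶠ-sound (a ∷ as) bs []      t = z≤n
≤ᶠ-sound (a ∷ as) [] (x ∷ ρ) t with Equivalence.to (T-∧ {a ≤ᵇ 0}) t
... | p , q with a | ≤ᵇ⇒≤ a 0 p
...   | .0 | z≤n = ≤ᶠ-sound as [] ρ q
≤ᶠ-sound (a ∷ as) (b ∷ bs) (x ∷ ρ) t with Equivalence.to (T-∧ {a ≤ᵇ b}) t
... | p , q = +-mono-≤ (*-monoˡ-≤ x (≤ᵇ⇒≤ a b p)) (≤ᶠ-sound as bs ρ q)

AllHold-tail : ∀ {ρ h} hs → AllHold ρ (h ∷ hs) → Holds ρ h × AllHold ρ hs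
AllHold-tail []      p = p , tt
AllHold-tail (_ ∷ _) p = p

derivable-sound : ∀ ρ hs a b → AllHold ρ hs → T (derivable hs a b) → eval a (1 ∷ ρ) ≤ eval b (1 ∷ ρ)

spend : ∀ ρ l r hs a b → ⟦ l ⟧ ρ ≤ ⟦ r ⟧ ρ → AllHold ρ hs → T (derivable hs (a ⊞ form r) (b ⊞ form l)) →
  eval a (1 ∷ ρ) ≤ eval b (1 ∷ ρ)
spend ρ l r hs a b l≤r ps t = +-cancelʳ-≤ (⟦ l ⟧ ρ) _ _ (≤-trans (+-monoʳ-≤ (eval a (1 ∷ ρ)) l≤r)
  (subst₂ _≤_ (trans (eval-⊞ a (form r) (1 ∷ ρ)) (cong (eval a (1 ∷ ρ) +_) (eval-form r ρ)))
              (trans (eval-⊞ b (form l) (1 ∷ ρ)) (cong (eval b (1 ∷ ρ) +_) (eval-form l ρ)))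
    (derivable-sound ρ hs (a ⊞ form r) (b ⊞ form l) ps t)))

derivable-sound ρ []           a b ps t = ≤ᶠ-sound a b (1 ∷ ρ) t
derivable-sound ρ (l ≼ r ∷ hs) a b ps t with AllHold-tail hs ps | Equivalence.to (T-∨ {derivable hs a b}) t
... | _   , qs | inj₁ t′ = derivable-sound ρ hs a b qs t′
... | l≤r , qs | inj₂ t′ = spend ρ l r hs a b l≤r qs t′
derivable-sound ρ (l ≃ r ∷ hs) a b ps t with AllHold-tail hs ps | Equivalence.to (T-∨ {derivable hs a b}) t
... | _   , qs | inj₁ t′ = derivable-sound ρ hs a b qs t′
... | l≡r , qs | inj₂ t′ with Equivalence.to (T-∨ {derivable hs (a ⊞ form r) (b ⊞ form l)}) t′
...   | inj₁ t″ = spend ρ l r hs a b (≤-reflexive l≡r) qs t″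
...   | inj₂ t″ = spend ρ r l hs a b (≤-reflexive (sym l≡r)) qs t″

-- The implicit argument is solved by running the search during type checking: its type reduces to
-- `⊤` exactly when the search succeeds.
linear : ∀ ρ hs g {_ : T (provable hs g)} → AllHold ρ hs → Holds ρ g
linear ρ hs (a ≼ b) {t} ps =
  subst₂ _≤_ (eval-form a ρ) (eval-form b ρ) (derivable-sound ρ hs (form a) (form b) ps t)
linear ρ hs (a ≃ b) {t} ps with Equivalence.to (T-∧ {derivable hs (form a) (form b)}) t
... | t₁ , t₂ = ≤-antisym (linear ρ hs (a ≼ b) {t₁} ps) (linear ρ hs (b ≼ a) {t₂} ps)

inconsistent : ∀ {A : Set} ρ hs {_ : T (provable hs (κ 1 ≼ κ 0))} → AllHold ρ hs → A
inconsistent ρ hs {t} ps with linear ρ hs (κ 1 ≼ κ 0) {t} ps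
... | ()

private
  true≢false : true ≢ false
  true≢false ()

-- Partitions and their conjugates

tailPartition : ∀ {a as} → IsPartition (a ∷ as) → IsPartition as
tailPartition (_ ∷ ps , [-])    = ps , []
tailPartition (_ ∷ ps , _ ∷ ls) = ps , ls

row-step : ∀ lam → IsPartition lam → ∀ i → row lam (suc (suc i)) ≤ row lam (suc i)
row-step []           _               i       = z≤n
row-step (a ∷ [])     _               i       = z≤n
row-step (a ∷ b ∷ bs) (_ , b≤a ∷ _)   zero    = b≤a
row-step (a ∷ b ∷ bs) h               (suc i) = row-step (b ∷ bs) (tailPartition h) i

row-antitone : ∀ {lam} → IsPartition lam → ∀ {i k} → 1 ≤ i → i ≤ k → row lam k ≤ row lam i
row-antitone {lam} h {suc i} {suc k} _ (s≤s i≤k) = go (≤⇒≤′ i≤k)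
  where
  go : ∀ {k} → i ≤′ k → row lam (suc k) ≤ row lam (suc i)
  go ≤′-refl         = ≤-refl
  go (≤′-step i≤′k) = ≤-trans (row-step lam h _) (go i≤′k)

row-beyond : ∀ lam {i} → length lam < i → row lam i ≡ 0
row-beyond []       {suc i}       _         = refl
row-beyond (a ∷ as) {suc (suc i)} (s≤s l<i) = row-beyond as l<i
row-beyond (a ∷ as) {suc zero} (s≤s ())

row-length : ∀ a as → row (a ∷ as) (length (a ∷ as)) ≡ lastPart (a ∷ as)
row-length a []       = refl
row-length a (b ∷ bs) = row-length b bs

lastPart-positive : ∀ a as → IsPartition (a ∷ as) → 1 ≤ lastPart (a ∷ as)
lastPart-positive a []       (p ∷ _ , _) = p
lastPart-positive a (b ∷ bs) h           = lastPart-positive b bs (tailPartition h)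

shrink-∷ : ∀ a b bs → shrink (a ∷ b ∷ bs) ≡ a ∷ shrink (b ∷ bs)
shrink-∷ zero          b bs = refl
shrink-∷ (suc zero)    b bs = refl
shrink-∷ (suc (suc a)) b bs = refl

row-positive : ∀ lam → IsPartition lam → ∀ {i} → 1 ≤ i → i ≤ length lam → 1 ≤ row lam i
row-positive []       _           {suc i}       _ ()
row-positive (a ∷ as) (p ∷ _ , _) {suc zero}    _ _         = p
row-positive (a ∷ as) h           {suc (suc i)} _ (s≤s i≤l) = row-positive as (tailPartition h) (s≤s z≤n) i≤l

row-shrink : ∀ a as i → i ≢ length (a ∷ as) → row (shrink (a ∷ as)) i ≡ row (a ∷ as) i
row-shrink a             as       zero          _  = refl
row-shrink a             []       (suc zero)    i≢ = ⊥-elim (i≢ refl)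
row-shrink zero          []       (suc (suc i)) _  = refl
row-shrink (suc zero)    []       (suc (suc i)) _  = refl
row-shrink (suc (suc a)) []       (suc (suc i)) _  = refl
row-shrink a             (b ∷ bs) (suc zero)    _  rewrite shrink-∷ a b bs = refl
row-shrink a             (b ∷ bs) (suc (suc i)) i≢ rewrite shrink-∷ a b bs =
  row-shrink b bs (suc i) λ e → i≢ (cong suc e)

row-shrink-length : ∀ a as → row (shrink (a ∷ as)) (length (a ∷ as)) ≡ pred (lastPart (a ∷ as))
row-shrink-length zero          []       = refl
row-shrink-length (suc zero)    []       = refl
row-shrink-length (suc (suc a)) []       = refl
row-shrink-length a             (b ∷ bs) rewrite shrink-∷ a b bs = row-shrink-length b bs

sum-shrink : ∀ a as → IsPartition (a ∷ as) → sum (a ∷ as) ≡ suc (sum (shrink (a ∷ as)))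
sum-shrink (suc zero)    []       _ = refl
sum-shrink (suc (suc a)) []       _ = refl
sum-shrink zero          []       (() ∷ _ , _)
sum-shrink a             (b ∷ bs) h rewrite shrink-∷ a b bs | sum-shrink b bs (tailPartition h) = +-suc a _

row-shrink≤ : ∀ a as i → row (shrink (a ∷ as)) i ≤ row (a ∷ as) i
row-shrink≤ a as i with i ≟ length (a ∷ as)
... | no  i≢ = ≤-reflexive (row-shrink a as i i≢)
... | yes refl = ≤-trans (≤-reflexive (row-shrink-length a as))
  (≤-trans pred[n]≤n (≤-reflexive (sym (row-length a as))))

Linked-∷ : ∀ {a} bs → row bs 1 ≤ a → Linked (λ a b → b ≤ a) bs → Linked (λ a b → b ≤ a) (a ∷ bs)
Linked-∷ []      _   _  = [-]
Linked-∷ (_ ∷ _) b≤a ls = b≤a ∷ ls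

shrink-isPartition : ∀ a as → IsPartition (a ∷ as) → IsPartition (shrink (a ∷ as))
shrink-isPartition zero          []       _ = [] , []
shrink-isPartition (suc zero)    []       _ = [] , []
shrink-isPartition (suc (suc a)) []       _ = s≤s z≤n ∷ [] , [-]
shrink-isPartition a (b ∷ bs) h@(p ∷ _ , b≤a ∷ _)
  rewrite shrink-∷ a b bs
  with shrink-isPartition b bs (tailPartition h)
... | ps , ls = p ∷ ps , Linked-∷ _ (≤-trans (row-shrink≤ b bs 1) b≤a) ls

-- `conj` counts the rows of length at least `j`. As the rows decrease, these form an initial
-- segment, which turns the count into a bound on the row index.
i≤conj⇒j≤row : ∀ {lam} → IsPartition lam → ∀ {i j} → 1 ≤ i → i ≤ conj lam j → j ≤ row lam i
j≤row⇒i≤conj : ∀ {lam} → IsPartition lam → ∀ {i j} → 1 ≤ i → 1 ≤ j → j ≤ row lam i → i ≤ conj lam j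

i≤conj⇒j≤row {[]}     h 1≤i i≤c = ⊥-elim (<⇒≱ 1≤i i≤c)
i≤conj⇒j≤row {a ∷ as} h {suc i} {j} 1≤i i≤c with j ≤? a
... | yes j≤a rewrite filter-accept (j ≤?_) {xs = as} j≤a = below i i≤c
  where
  below : ∀ i → suc i ≤ suc (conj as j) → j ≤ row (a ∷ as) (suc i)
  below zero    _         = j≤a
  below (suc i) (s≤s i≤c) = i≤conj⇒j≤row (tailPartition h) (s≤s z≤n) i≤c
... | no  j≰a rewrite filter-reject (j ≤?_) {xs = as} j≰a =
  ⊥-elim (j≰a (≤-trans (i≤conj⇒j≤row (tailPartition h) (s≤s z≤n) i≤c)
    (row-antitone h {1} {suc (suc i)} (s≤s z≤n) (s≤s z≤n))))

j≤row⇒i≤conj {[]}     h {suc i} _ 1≤j j≤r = ⊥-elim (<⇒≱ 1≤j j≤r)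
j≤row⇒i≤conj {a ∷ as} h {suc i} {j} 1≤i 1≤j j≤r with j ≤? a
... | no  j≰a = ⊥-elim (j≰a (≤-trans j≤r (row-antitone h {1} {suc i} ≤-refl (s≤s z≤n))))
... | yes j≤a rewrite filter-accept (j ≤?_) {xs = as} j≤a = below i j≤r
  where
  below : ∀ i → j ≤ row (a ∷ as) (suc i) → suc i ≤ suc (conj as j)
  below zero    _   = s≤s z≤n
  below (suc i) j≤r = s≤s (j≤row⇒i≤conj (tailPartition h) (s≤s z≤n) 1≤j j≤r)

-- A cell of lam lies in 𝓑 ∪ 𝓘, i.e. the rim moves south from its diagonal, exactly when
-- its content is one more than that of the last cell of some row.
Vertical : List ℕ → Cell → Set
Vertical lam (p , q) = ∃ λ i → 1 ≤ i × suc (row lam i + p) ≡ q + i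

row-index≤length : ∀ lam {i j} → 1 ≤ j → j ≤ row lam i → i ≤ length lam
row-index≤length lam {i} {j} 1≤j j≤r with i ≤? length lam
... | yes i≤l = i≤l
... | no  i≰l rewrite row-beyond lam (≰⇒> i≰l) = ⊥-elim (inconsistent (j ∷ [])
      (κ 1 ≼ # 0 ∷ # 0 ≼ κ 0 ∷ [])
      (1≤j , j≤r))

-- A row `i ≤ p` reaches column `q`, so its last cell has content at least that of `u`, one more
-- than `Vertical` allows. Hence `i > p`, and then `q ≤ row lam i ≤ row lam (suc p)`. In particular
-- a path compares two finite entries wherever the rim is vertical.
south-inside : ∀ {lam} → IsPartition lam → ∀ {u} → u ∈Y lam → Vertical lam u → sC u ∈Y lam
south-inside {lam} h {p , q} (1≤p , 1≤q , q≤r) (i , 1≤i , e) with suc p ≤? i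
... | yes p<i = s≤s z≤n , 1≤q , linear (row lam i ∷ p ∷ q ∷ i ∷ row lam (suc p) ∷ [])
      (1+ (# 0 ⊕ # 1) ≃ # 2 ⊕ # 3 ∷ 1+ # 1 ≼ # 3 ∷ # 0 ≼ # 4 ∷ [])
      (# 2 ≼ # 4) (e , p<i , row-antitone h (s≤s z≤n) p<i)
... | no  p≮i = inconsistent (i ∷ p ∷ row lam i ∷ q ∷ row lam p ∷ [])
      (# 0 ≼ # 1 ∷ 1+ (# 2 ⊕ # 1) ≃ # 3 ⊕ # 0 ∷ # 3 ≼ # 4 ∷ # 4 ≼ # 2 ∷ [])
      (i≤p , e , q≤r , row-antitone h 1≤i i≤p)
  where
  i≤p : i ≤ p
  i≤p = ≤-pred (≰⇒> p≮i)

-- The vertical steps of the rim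

private
  cancel-content : ∀ (x y z : ℤ) → (x ℤ.- y) ℤ.+ (y ℤ.+ z) ≡ x ℤ.+ z
  cancel-content = ℤSolver.solve-∀

  cancel-content′ : ∀ (x y z : ℤ) → (x ℤ.- z) ℤ.+ (y ℤ.+ z) ≡ x ℤ.+ y
  cancel-content′ = ℤSolver.solve-∀

-- Adding `i + k` to both contents clears the subtractions and moves the comparison to ℕ, where
-- `linear` works.
content-<⇒ : ∀ {i j k l} → content (i , j) ℤ.< content (k , l) → j + k < l + i
content-<⇒ {i} {j} {k} {l} lt = ℤP.drop‿+<+
  (subst₂ ℤ._<_ (cancel-content (ℤ.+ j) (ℤ.+ i) (ℤ.+ k)) (cancel-content′ (ℤ.+ l) (ℤ.+ i) (ℤ.+ k))
    (ℤP.+-monoˡ-< (ℤ.+ i ℤ.+ ℤ.+ k) lt))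

content-≤⇒ : ∀ {i j k l} → content (i , j) ℤ.≤ content (k , l) → j + k ≤ l + i
content-≤⇒ {i} {j} {k} {l} le = ℤP.drop‿+≤+
  (subst₂ ℤ._≤_ (cancel-content (ℤ.+ j) (ℤ.+ i) (ℤ.+ k)) (cancel-content′ (ℤ.+ l) (ℤ.+ i) (ℤ.+ k))
    (ℤP.+-monoˡ-≤ (ℤ.+ i ℤ.+ ℤ.+ k) le))

⇒content-< : ∀ {i j k l} → j + k < l + i → content (i , j) ℤ.< content (k , l)
⇒content-< {i} {j} {k} {l} lt with content (i , j) ℤ.<? content (k , l)
... | yes p = p
... | no ¬p = ⊥-elim (<⇒≱ lt (content-≤⇒ {k} {l} {i} {j} (ℤP.≮⇒≥ ¬p)))

⇒content-≤ : ∀ {i j k l} → j + k ≤ l + i → content (i , j) ℤ.≤ content (k , l)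
⇒content-≤ {i} {j} {k} {l} le with content (i , j) ℤ.≤? content (k , l)
... | yes p = p
... | no ¬p = ⊥-elim (<⇒≱ (content-<⇒ {k} {l} {i} {j} (ℤP.≰⇒> ¬p)) le)

content-≡⇒ : ∀ {i j k l} → content (i , j) ≡ content (k , l) → j + k ≡ l + i
content-≡⇒ {i} {j} {k} {l} e = ≤-antisym (content-≤⇒ {i} {j} {k} {l} (ℤP.≤-reflexive e))
  (content-≤⇒ {k} {l} {i} {j} (ℤP.≤-reflexive (sym e)))

⇒content-≡ : ∀ {i j k l} → j + k ≡ l + i → content (i , j) ≡ content (k , l)
⇒content-≡ {i} {j} {k} {l} e = ℤP.≤-antisym (⇒content-≤ {i} {j} {k} {l} (≤-reflexive e))
  (⇒content-≤ {k} {l} {i} {j} (≤-reflexive (sym e)))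

inb⇒∈Y : ∀ lam u → inb lam u ≡ true → u ∈Y lam
inb⇒∈Y lam (suc i , suc j) e = s≤s z≤n , s≤s z≤n , ≤ᵇ⇒≤ (suc j) _ (subst T (sym e) tt)

∈Y⇒inb : ∀ lam u → u ∈Y lam → inb lam u ≡ true
∈Y⇒inb lam (suc i , suc j) (_ , _ , j≤r) with suc j ≤ᵇ row lam (suc i) | ≤⇒≤ᵇ j≤r
... | true | _ = refl

∉Y⇒inb : ∀ lam u → ¬ (u ∈Y lam) → inb lam u ≡ false
∉Y⇒inb lam u u∉ with inb lam u in e
... | false = refl
... | true  = ⊥-elim (u∉ (inb⇒∈Y lam u e))

-- Corner contents in terms of row lengths

module Corners (lam : List ℕ) (part : IsPartition lam) where

  anti : ∀ {i k} → 1 ≤ i → i ≤ k → row lam k ≤ row lam i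
  anti = row-antitone part

  -- The rows are read bottom up, so that both lists come out increasing.
  outers inners : ℕ → List ℤ
  outers zero    = []
  outers (suc n) with row lam (2 + n) <? row lam (suc n)
  ... | yes _ = content (suc n , row lam (suc n)) ∷ outers n
  ... | no  _ = outers n
  inners zero    = []
  inners (suc n) with 1 ≤? row lam (2 + n) | row lam (2 + n) <? row lam (suc n)
  ... | yes _ | yes _ = content (suc n , row lam (2 + n)) ∷ inners n
  ... | _     | _     = inners n

  rowCells : ℕ → ℕ → List Cell
  rowCells i r = map (λ j → (i , j)) (map suc (upTo r))

  select : (Cell → Bool) → List Cell → List Cell
  select p = filter (λ u → Bool._≟_ (p u) true)

  select-[]  : ∀ p u → p u ≡ false → select p [ u ] ≡ []
  select-[] p u e rewrite e = refl

  select-[u] : ∀ p u → p u ≡ true → select p [ u ] ≡ [ u ]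
  select-[u] p u e rewrite e = refl

  oneTo-suc : ∀ n → map suc (upTo (suc n)) ≡ map suc (upTo n) ++ [ suc n ]
  oneTo-suc n = trans (cong (map suc) (sym (upTo-∷ʳ n))) (map-++ suc (upTo n) [ n ])

  rowCells-suc : ∀ i r → rowCells i (suc r) ≡ rowCells i r ++ [ (i , suc r) ]
  rowCells-suc i r = trans (cong (map (λ j → (i , j))) (oneTo-suc r))
    (map-++ (λ j → (i , j)) (map suc (upTo r)) [ suc r ])

  select-rowCells-suc : ∀ p i r → select p (rowCells i (suc r)) ≡ select p (rowCells i r) ++ select p [ (i , suc r) ]
  select-rowCells-suc p i r = trans (cong (select p) (rowCells-suc i r)) (filter-++ _ (rowCells i r) _)

  select-none : ∀ p i r → (∀ j → 1 ≤ j → j ≤ r → p (i , j) ≡ false) → select p (rowCells i r) ≡ []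
  select-none p i zero    h = refl
  select-none p i (suc r) h
    rewrite select-rowCells-suc p i r | select-none p i r (λ j 1≤j j≤r → h j 1≤j (m≤n⇒m≤1+n j≤r)) =
    select-[] p _ (h (suc r) (s≤s z≤n) ≤-refl)

  -- Each row carries at most one corner of each kind, so filtering a row yields nothing or a
  -- singleton.
  select-one : ∀ p i r k → 1 ≤ k → k ≤ r → p (i , k) ≡ true →
    (∀ j → j ≢ k → p (i , j) ≡ false) → select p (rowCells i r) ≡ [ (i , k) ]
  select-one p i zero    zero () _ _ _
  select-one p i (suc r) k 1≤k k≤r pk h with k ≟ suc r
  ... | yes refl rewrite select-rowCells-suc p i r
        | select-none p i r (λ j _ j≤r → h j (<⇒≢ (s≤s j≤r))) = select-[u] p _ pk
  ... | no k≢ rewrite select-rowCells-suc p i r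
        | select-one p i r k 1≤k (≤-pred (≤∧≢⇒< k≤r k≢)) pk h
        | select-[] p (i , suc r) (h (suc r) (k≢ ∘ sym)) = refl

  firstRows : ℕ → List Cell
  firstRows n = concatMap (λ i → rowCells i (row lam i)) (map suc (upTo n))

  firstRows-suc : ∀ n → firstRows (suc n) ≡ firstRows n ++ rowCells (suc n) (row lam (suc n))
  firstRows-suc n = trans (cong (concatMap _) (oneTo-suc n))
    (trans (concatMap-++ _ (map suc (upTo n)) [ suc n ]) (cong (firstRows n ++_) (++-identityʳ _)))

  selected : (Cell → Bool) → ℕ → List ℤ
  selected p n = map content (select p (firstRows n))

  -- `cells` appends each new row whereas `outers` and `inners` put it in front. A permutation is
  -- enough, since the contents get sorted.
  selected-suc : ∀ p n → selected p (suc n) ↭ map content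
      (select p (rowCells (suc n) (row lam (suc n)))) ++ selected p n
  selected-suc p n = ↭-trans (↭-reflexive
      (trans (cong (map content) (trans (cong (select p) (firstRows-suc n)) (filter-++ _ (firstRows n) _)))
        (map-++ content (select p (firstRows n)) _)))
    (++-comm (selected p n) _)

  isOuter-true : ∀ i → 1 ≤ i → row lam (suc i) < row lam i → isOuterCorner lam (i , row lam i) ≡ true
  isOuter-true i 1≤i lt
    rewrite ∈Y⇒inb lam (i , row lam i) (1≤i , ≤-trans (s≤s z≤n) lt , ≤-refl)
    | ∉Y⇒inb lam (i , suc (row lam i)) (λ m → inconsistent (row lam i ∷ [])
          (1+ # 0 ≼ # 0 ∷ [])
          (proj₂ (proj₂ m)))
    | ∉Y⇒inb lam (suc i , row lam i) (λ m → inconsistent (row lam (suc i) ∷ row lam i ∷ [])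
          (1+ # 0 ≼ # 1 ∷ # 1 ≼ # 0 ∷ [])
          (lt , proj₂ (proj₂ m))) = refl

  isOuter⇒ : ∀ i j → isOuterCorner lam (i , j) ≡ true → j ≡ row lam i × row lam (suc i) < j
  isOuter⇒ i j e with inb lam (i , j) in e₁ | inb lam (i , suc j) in e₂ | inb lam (suc i , j) in e₃
  isOuter⇒ i j () | false | _ | _
  isOuter⇒ i j () | true | true | _
  isOuter⇒ i j () | true | false | true
  isOuter⇒ i j _  | true | false | false with inb⇒∈Y lam (i , j) e₁
  ... | 1≤i , 1≤j , j≤r = ≤-antisym j≤r (≮⇒≥ λ lt → true≢false
      (trans (sym (∈Y⇒inb lam (i , suc j) (1≤i , s≤s z≤n , lt))) e₂))
    , ≰⇒> (λ le → true≢false (trans (sym (∈Y⇒inb lam (suc i , j) (s≤s z≤n , 1≤j , le))) e₃))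

  isInner-true : ∀ i → 1 ≤ i → 1 ≤ row lam (suc i) → row lam (suc i) < row lam i →
    isInnerCorner lam (i , row lam (suc i)) ≡ true
  isInner-true i 1≤i 1≤r lt
    rewrite ∈Y⇒inb lam (i , row lam (suc i)) (1≤i , 1≤r , <⇒≤ lt)
    | ∈Y⇒inb lam (i , suc (row lam (suc i))) (1≤i , s≤s z≤n , lt)
    | ∈Y⇒inb lam (suc i , row lam (suc i)) (s≤s z≤n , 1≤r , ≤-refl)
    | ∉Y⇒inb lam (suc i , suc (row lam (suc i))) (λ m → inconsistent (row lam (suc i) ∷ [])
          (1+ # 0 ≼ # 0 ∷ [])
          (proj₂ (proj₂ m))) = refl

  isInner⇒ : ∀ i j → isInnerCorner lam (i , j) ≡ true → j ≡ row lam (suc i) × 1 ≤ j × j < row lam i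
  isInner⇒ i j e with inb lam (i , j) | inb lam (i , suc j) in e₂ | inb lam (suc i , j) in e₃ | inb lam
      (suc i , suc j) in e₄
  isInner⇒ i j () | false | _ | _ | _
  isInner⇒ i j () | true | false | _ | _
  isInner⇒ i j () | true | true | false | _
  isInner⇒ i j () | true | true | true | true
  isInner⇒ i j _  | true | true | true | false with inb⇒∈Y lam (i , suc j) e₂ | inb⇒∈Y lam (suc i , j) e₃
  ... | _ , _ , lt | _ , 1≤j , le = ≤-antisym le (≮⇒≥ λ lt′ → true≢false
      (trans (sym (∈Y⇒inb lam (suc i , suc j) (s≤s z≤n , s≤s z≤n , lt′))) e₄))
    , 1≤j , lt

  selected-outers : ∀ n → selected (isOuterCorner lam) n ↭ outers n
  selected-outers zero = ↭-refl
  selected-outers (suc n) with row lam (2 + n) <? row lam (suc n) | selected-suc (isOuterCorner lam) n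
  ... | yes lt | perm
      rewrite select-one (isOuterCorner lam) (suc n) (row lam (suc n)) (row lam (suc n)) (≤-trans (s≤s z≤n) lt) ≤-refl
        (isOuter-true (suc n) (s≤s z≤n) lt) (λ j j≢ → ¬-not (j≢ ∘ proj₁ ∘ isOuter⇒ (suc n) j))
      = ↭-trans perm (prep _ (selected-outers n))
  ... | no ≮ | perm
      rewrite select-none (isOuterCorner lam) (suc n) (row lam (suc n))
        (λ j _ _ → ¬-not λ e → ≮ (subst (row lam (2 + n) <_) (proj₁ (isOuter⇒ (suc n) j e))
            (proj₂ (isOuter⇒ (suc n) j e))))
      = ↭-trans perm (selected-outers n)

  selected-inners : ∀ n → selected (isInnerCorner lam) n ↭ inners n
  selected-inners zero = ↭-refl
  selected-inners (suc n) with 1 ≤? row lam (2 + n) | row lam (2 + n) <? row lam (suc n) | selected-suc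
      (isInnerCorner lam) n
  ... | yes 1≤r | yes lt | perm
      rewrite select-one (isInnerCorner lam) (suc n) (row lam (suc n)) (row lam (2 + n)) 1≤r (<⇒≤ lt)
        (isInner-true (suc n) (s≤s z≤n) 1≤r lt) (λ j j≢ → ¬-not (j≢ ∘ proj₁ ∘ isInner⇒ (suc n) j))
      = ↭-trans perm (prep _ (selected-inners n))
  ... | no ≰ | _ | perm
      rewrite select-none (isInnerCorner lam) (suc n) (row lam (suc n))
        (λ j _ _ → ¬-not λ e → ≰ (subst (1 ≤_) (proj₁ (isInner⇒ (suc n) j e)) (proj₁ (proj₂ (isInner⇒ (suc n) j e)))))
      = ↭-trans perm (selected-inners n)
  ... | yes _ | no ≮ | perm
      rewrite select-none (isInnerCorner lam) (suc n) (row lam (suc n))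
        (λ j _ _ → ¬-not λ e → ≮ (subst (_< row lam (suc n)) (proj₁ (isInner⇒ (suc n) j e))
            (proj₂ (proj₂ (isInner⇒ (suc n) j e)))))
      = ↭-trans perm (selected-inners n)

  Sorted-∷ : ∀ {z zs} → All (z ℤ.≤_) zs → Sorted zs → Sorted (z ∷ zs)
  Sorted-∷ []      _ = [-]
  Sorted-∷ (p ∷ _) s = p ∷ s

  -- Bounding by an arbitrary cell south-west of the remaining row ends, not by the previous corner,
  -- lets the induction pass over rows without a corner.
  outers-≥ : ∀ n k r → n ≤ k → (∀ i → 1 ≤ i → i ≤ n → r ≤ row lam i) → All (content (k , r) ℤ.≤_) (outers n)
  outers-≥ zero    k r n≤k h = []
  outers-≥ (suc n) k r n≤k h with row lam (2 + n) <? row lam (suc n) | outers-≥ n k r (<⇒≤ n≤k)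
      (λ i 1≤i i≤n → h i 1≤i (m≤n⇒m≤1+n i≤n))
  ... | no  _ | rest = rest
  ... | yes _ | rest = ⇒content-≤ {k} {r} {suc n} {row lam (suc n)} (linear (n ∷ k ∷ r ∷ row lam (suc n) ∷ [])
        (1+ # 0 ≼ # 1 ∷ # 2 ≼ # 3 ∷ [])
        (# 2 ⊕ 1+ # 0 ≼ # 3 ⊕ # 1) (n≤k , h (suc n) (s≤s z≤n) ≤-refl)) ∷ rest

  inners-≥ : ∀ n k r → n ≤ k → (∀ i → 1 ≤ i → i ≤ n → r ≤ row lam (suc i)) → All (content (k , r) ℤ.≤_) (inners n)
  inners-≥ zero    k r n≤k h = []
  inners-≥ (suc n) k r n≤k h with 1 ≤? row lam (2 + n) | row lam (2 + n) <? row lam (suc n) | inners-≥ n k r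
      (<⇒≤ n≤k) (λ i 1≤i i≤n → h i 1≤i (m≤n⇒m≤1+n i≤n))
  ... | no  _ | _     | rest = rest
  ... | yes _ | no  _ | rest = rest
  ... | yes _ | yes _ | rest = ⇒content-≤ {k} {r} {suc n} {row lam (2 + n)}
      (linear (n ∷ k ∷ r ∷ row lam (suc (suc n)) ∷ [])
        (1+ # 0 ≼ # 1 ∷ # 2 ≼ # 3 ∷ [])
        (# 2 ⊕ 1+ # 0 ≼ # 3 ⊕ # 1) (n≤k , h (suc n) (s≤s z≤n) ≤-refl)) ∷ rest

  outers-sorted : ∀ n → Sorted (outers n)
  outers-sorted zero = []
  outers-sorted (suc n) with row lam (2 + n) <? row lam (suc n)
  ... | no  _ = outers-sorted n
  ... | yes _ = Sorted-∷ (outers-≥ n (suc n) _ (n≤1+n n) (λ i 1≤i i≤n → anti 1≤i (m≤n⇒m≤1+n i≤n))) (outers-sorted n)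

  inners-sorted : ∀ n → Sorted (inners n)
  inners-sorted zero = []
  inners-sorted (suc n) with 1 ≤? row lam (2 + n) | row lam (2 + n) <? row lam (suc n)
  ... | no  _ | _     = inners-sorted n
  ... | yes _ | no  _ = inners-sorted n
  ... | yes _ | yes _ = Sorted-∷ (inners-≥ n (suc n) _ (n≤1+n n)
      (λ i 1≤i i≤n → anti (s≤s z≤n) (s≤s (m≤n⇒m≤1+n i≤n)))) (inners-sorted n)

  sort-unique : ∀ {xs ys} → Sorted ys → xs ↭ ys → sort xs ≡ ys
  sort-unique {xs} ys↗ xs↭ys = Pointwise-≡⇒≡
    (↗↭↗⇒≋ ℤP.≤-totalOrder (sort-↗ xs) ys↗ (↭⇒↭ₛ (↭-trans (sort-↭ xs) xs↭ys)))

  outerContents≡ : outerContents lam ≡ outers (length lam)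
  outerContents≡ = sort-unique (outers-sorted (length lam)) (selected-outers (length lam))

  innerContents≡ : innerContents lam ≡ inners (length lam)
  innerContents≡ = sort-unique (inners-sorted (length lam)) (selected-inners (length lam))

  lastBelow : ℤ → Maybe ℤ → Bool
  lastBelow c (just o) = o <ℤᵇ c
  lastBelow c nothing  = false

  -- The test for 𝓑 ∪ 𝓘 with both corner lists as arguments, so that it unfolds one pair at a time.
  -- It describes the half-open intervals from an outer content (excluded) to the next inner content
  -- (included), the last one unbounded.
  flag : ℤ → List ℤ → List ℤ → Bool
  flag c os is = (any (λ oi → (proj₁ oi <ℤᵇ c) ∧ (c <ℤᵇ proj₂ oi)) (zip os is) ∨ lastBelow c (last os))
                 ∨ any (λ i → c ≡ℤᵇ i) is

  inB∨inI≡flag : ∀ u → (inB lam u ∨ inI lam u) ≡ flag (content u) (outers (length lam)) (inners (length lam))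
  inB∨inI≡flag u rewrite outerContents≡ | innerContents≡
    with outers (length lam) | inners (length lam)
  ... | os | is with last os
  ...   | just _  = cong (λ b → (b ∨ _) ∨ _) (cong or (map-cong (λ { (o , i) → refl }) (zip os is)))
  ...   | nothing = cong (λ b → (b ∨ _) ∨ _) (cong or (map-cong (λ { (o , i) → refl }) (zip os is)))

  -- The second outer content `o′` guarantees that `last` does not change when `o` is removed.
  flag-∷ : ∀ c o o′ os i is → flag c (o ∷ o′ ∷ os) (i ∷ is) ≡
    (((o <ℤᵇ c) ∧ (c <ℤᵇ i)) ∨ (c ≡ℤᵇ i)) ∨ flag c (o′ ∷ os) is
  flag-∷ c o o′ os i is = shuffle ((o <ℤᵇ c) ∧ (c <ℤᵇ i)) _ _ (c ≡ℤᵇ i) _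
    where
    shuffle : ∀ x z l y j → ((x ∨ z) ∨ l) ∨ (y ∨ j) ≡ (x ∨ y) ∨ ((z ∨ l) ∨ j)
    shuffle true  _     _     _     _ = refl
    shuffle false true  _     false _ = refl
    shuffle false true  _     true  _ = refl
    shuffle false false true  false _ = refl
    shuffle false false true  true  _ = refl
    shuffle false false false _     _ = refl

  between⇒ : ∀ {o c i} → o ℤ.< i → T (((o <ℤᵇ c) ∧ (c <ℤᵇ i)) ∨ (c ≡ℤᵇ i)) → o ℤ.< c × c ℤ.≤ i
  between⇒ {o} {c} {i} o<i t with o ℤ.<? c | c ℤ.<? i | c ℤ.≟ i
  ... | yes p | yes q | _ = p , ℤP.<⇒≤ q
  ... | yes p | no  _ | yes refl = p , ℤP.≤-refl
  ... | no  p | _     | yes refl = ⊥-elim (p o<i)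
  ... | no  _ | _     | no _ = ⊥-elim t
  ... | yes _ | no  _ | no _ = ⊥-elim t

  ⇒between : ∀ {o c i} → o ℤ.< c → c ℤ.≤ i → T (((o <ℤᵇ c) ∧ (c <ℤᵇ i)) ∨ (c ≡ℤᵇ i))
  ⇒between {o} {c} {i} p q with o ℤ.<? c | c ℤ.<? i | c ℤ.≟ i
  ... | no ¬p | _     | _     = ⊥-elim (¬p p)
  ... | yes _ | yes _ | _     = _
  ... | yes _ | no  _ | yes _ = _
  ... | yes _ | no ≮  | no ≢  = ⊥-elim (≮ (ℤP.≤∧≢⇒< q ≢))

  module _ (p q : ℕ) (q≤ : q ≤ row lam 1 + p) where

    VerticalUpTo : ℕ → Set
    VerticalUpTo n = ∃ λ i → 1 ≤ i × i ≤ n × suc (row lam i + p) ≡ q + i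

    -- The rows n , … , 1 remain to be read, and (k , row lam (suc n)) is the last outer corner met below them.
    Remaining : ℕ → ℕ → Set
    Remaining k n = (row lam (suc n) + p < q + k × q + n ≤ row lam (suc n) + p) ⊎ VerticalUpTo n

    weaken : ∀ {n} → VerticalUpTo n → VerticalUpTo (suc n)
    weaken (i , 1≤i , i≤n , e) = i , 1≤i , m≤n⇒m≤1+n i≤n , e

    -- An interval between an outer content and the next inner one is the run of vertical steps
    -- along a maximal block of equal rows. While the rows `suc n` , ... , `k` have the same length,
    -- the first alternative of `Remaining` covers exactly their vertical steps; a strictly longer
    -- row closes the block and opens a new one.
    flag⇒ : ∀ n k → n < k → n < length lam → T (flag (content (p , q))
        (content (k , row lam (suc n)) ∷ outers n) (inners n)) → Remaining k n
    flag⇒ zero k n<k _ t with Equivalence.to (T-∨ {content (k , row lam 1) <ℤᵇ content (p , q)}) t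
    -- No inner corner ends the last interval. For cells of the diagram `q≤` supplies the upper end,
    -- the content of the top of the block.
    ... | inj₁ t′ = inj₁ (content-<⇒ {k} {row lam 1} {p} {q}
        (toWitness {a? = content (k , row lam 1) ℤ.<? content (p , q)} t′) , linear (q ∷ row lam 1 ∷ p ∷ [])
          (# 0 ≼ # 1 ⊕ # 2 ∷ [])
          (# 0 ⊕ κ 0 ≼ # 1 ⊕ # 2) q≤)
    ... | inj₂ ()
    flag⇒ (suc n) k n<k n<m t with 1 ≤? row lam (2 + n) | row lam (2 + n) <? row lam (suc n)
    ... | no ≰ | _ = ⊥-elim (≰ (row-positive lam part (s≤s z≤n) n<m))
    ... | yes _ | no ≮ = from (flag⇒ n k (<⇒≤ n<k) (<⇒≤ n<m)
        (subst (λ r → T (flag (content (p , q)) (content (k , r) ∷ outers n) (inners n))) r≡ t))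
      where
      r≡ : row lam (2 + n) ≡ row lam (suc n)
      r≡ = ≤-antisym (anti (s≤s z≤n) (n≤1+n _)) (≮⇒≥ ≮)
      from : Remaining k n → Remaining k (suc n)
      from (inj₂ v) = inj₂ (weaken v)
      from (inj₁ (l , h)) with q + suc n ≤? row lam (2 + n) + p
      ... | yes h′ = inj₁ (linear (row lam (suc n) ∷ p ∷ q ∷ k ∷ row lam (2 + n) ∷ [])
            (1+ (# 0 ⊕ # 1) ≼ # 2 ⊕ # 3 ∷ # 4 ≃ # 0 ∷ [])
            (1+ (# 4 ⊕ # 1) ≼ # 2 ⊕ # 3) (l , r≡) , h′)
      ... | no ¬h′ = inj₂ (suc n , s≤s z≤n , ≤-refl , linear (row lam (suc (suc n)) ∷ p ∷ q ∷ n ∷ row lam (suc n) ∷ [])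
            (1+ (# 0 ⊕ # 1) ≼ # 2 ⊕ 1+ # 3 ∷ # 2 ⊕ # 3 ≼ # 4 ⊕ # 1 ∷ # 0 ≃ # 4 ∷ [])
            (1+ (# 4 ⊕ # 1) ≃ # 2 ⊕ 1+ # 3) (≰⇒> ¬h′ , h , r≡))
    ... | yes _ | yes lt with Equivalence.to T-∨ (subst T
        (flag-∷ (content (p , q)) (content (k , row lam (2 + n))) (content (suc n , row lam (suc n))) (outers n)
            (content (suc n , row lam (2 + n))) (inners n)) t)
    ...   | inj₁ t′ with between⇒ (⇒content-< {k} {row lam (2 + n)} {suc n} {row lam (2 + n)}
        (linear (n ∷ k ∷ row lam (suc (suc n)) ∷ [])
          (1+ 1+ # 0 ≼ # 1 ∷ [])
          (1+ (# 2 ⊕ 1+ # 0) ≼ # 2 ⊕ # 1) n<k)) t′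
    ...     | l , h = inj₁ (content-<⇒ {k} {row lam (2 + n)} {p} {q} l , content-≤⇒ {p} {q} {suc n} {row lam (2 + n)} h)
    flag⇒ (suc n) k n<k n<m t | yes _ | yes lt | inj₂ t′ with flag⇒ n (suc n) ≤-refl (<⇒≤ n<m) t′
    ...     | inj₂ v = inj₂ (weaken v)
    ...     | inj₁ (l , h) = inj₂ (suc n , s≤s z≤n , ≤-refl , linear (row lam (suc n) ∷ p ∷ q ∷ n ∷ [])
          (1+ (# 0 ⊕ # 1) ≼ # 2 ⊕ 1+ # 3 ∷ # 2 ⊕ # 3 ≼ # 0 ⊕ # 1 ∷ [])
          (1+ (# 0 ⊕ # 1) ≃ # 2 ⊕ 1+ # 3) (l , h))

    ⇒flag : ∀ n k → n < k → n < length lam → Remaining k n → T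
        (flag (content (p , q)) (content (k , row lam (suc n)) ∷ outers n) (inners n))
    ⇒flag zero k n<k _ (inj₁ (l , _)) = Equivalence.from T-∨
        (inj₁ (fromWitness {a? = content (k , row lam 1) ℤ.<? content (p , q)} (⇒content-< {k} {row lam 1} {p} {q} l)))
    ⇒flag zero k n<k _ (inj₂ (suc i , _ , () , _))
    ⇒flag (suc n) k n<k n<m v with 1 ≤? row lam (2 + n) | row lam (2 + n) <? row lam (suc n)
    ... | no ≰ | _ = ⊥-elim (≰ (row-positive lam part (s≤s z≤n) n<m))
    ... | yes _ | no ≮ = subst (λ r → T (flag (content (p , q)) (content (k , r) ∷ outers n) (inners n)))
        (sym r≡) (⇒flag n k (<⇒≤ n<k) (<⇒≤ n<m) (to v))
      where
      r≡ : row lam (2 + n) ≡ row lam (suc n)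
      r≡ = ≤-antisym (anti (s≤s z≤n) (n≤1+n _)) (≮⇒≥ ≮)
      to : Remaining k (suc n) → Remaining k n
      to (inj₁ (l , h)) = inj₁ (linear (row lam (suc (suc n)) ∷ p ∷ q ∷ k ∷ row lam (suc n) ∷ [])
            (1+ (# 0 ⊕ # 1) ≼ # 2 ⊕ # 3 ∷ # 0 ≃ # 4 ∷ [])
            (1+ (# 4 ⊕ # 1) ≼ # 2 ⊕ # 3) (l , r≡) , linear (q ∷ n ∷ row lam (suc (suc n)) ∷ p ∷ row lam (suc n) ∷ [])
            (# 0 ⊕ 1+ # 1 ≼ # 2 ⊕ # 3 ∷ # 2 ≃ # 4 ∷ [])
            (# 0 ⊕ # 1 ≼ # 4 ⊕ # 3) (h , r≡))
      to (inj₂ (i , 1≤i , i≤n , e)) with i ≟ suc n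
      ... | yes refl = inj₁ (linear (row lam (suc n) ∷ p ∷ q ∷ n ∷ k ∷ [])
            (1+ (# 0 ⊕ # 1) ≃ # 2 ⊕ 1+ # 3 ∷ 1+ 1+ # 3 ≼ # 4 ∷ [])
            (1+ (# 0 ⊕ # 1) ≼ # 2 ⊕ # 4) (e , n<k) , linear (row lam (suc n) ∷ p ∷ q ∷ n ∷ [])
            (1+ (# 0 ⊕ # 1) ≃ # 2 ⊕ 1+ # 3 ∷ [])
            (# 2 ⊕ # 3 ≼ # 0 ⊕ # 1) e)
      ... | no  i≢   = inj₂ (i , 1≤i , ≤-pred (≤∧≢⇒< i≤n i≢) , e)
    ... | yes _ | yes lt = subst T (sym (flag-∷ (content (p , q)) (content (k , row lam (2 + n)))
        (content (suc n , row lam (suc n))) (outers n) (content (suc n , row lam (2 + n))) (inners n)))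
            (Equivalence.from T-∨ (to v))
      where
      to : Remaining k (suc n) →
        T (((content (k , row lam (2 + n)) <ℤᵇ content (p , q)) ∧
            (content (p , q) <ℤᵇ content (suc n , row lam (2 + n))))
             ∨ (content (p , q) ≡ℤᵇ content (suc n , row lam (2 + n))))
        ⊎ T (flag (content (p , q)) (content (suc n , row lam (suc n)) ∷ outers n) (inners n))
      to (inj₁ (l , h)) = inj₁ (⇒between (⇒content-< {k} {row lam (2 + n)} {p} {q} l)
          (⇒content-≤ {p} {q} {suc n} {row lam (2 + n)} h))
      to (inj₂ (i , 1≤i , i≤n , e)) with i ≟ suc n
      ... | yes refl = inj₂ (⇒flag n (suc n) ≤-refl (<⇒≤ n<m) (inj₁ (linear (row lam (suc n) ∷ p ∷ q ∷ n ∷ [])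
            (1+ (# 0 ⊕ # 1) ≃ # 2 ⊕ 1+ # 3 ∷ [])
            (1+ (# 0 ⊕ # 1) ≼ # 2 ⊕ 1+ # 3) e , linear (row lam (suc n) ∷ p ∷ q ∷ n ∷ [])
            (1+ (# 0 ⊕ # 1) ≃ # 2 ⊕ 1+ # 3 ∷ [])
            (# 2 ⊕ # 3 ≼ # 0 ⊕ # 1) e)))
      ... | no  i≢   = inj₂ (⇒flag n (suc n) ≤-refl (<⇒≤ n<m) (inj₂ (i , 1≤i , ≤-pred (≤∧≢⇒< i≤n i≢) , e)))

  outers-top : ∀ n → length lam ≡ suc n → outers (suc n) ≡ content (suc n , row lam (suc n)) ∷ outers n
  outers-top n e with row lam (2 + n) <? row lam (suc n)
  ... | yes _ = refl
  ... | no ≮  = ⊥-elim (≮ (≤-trans (s≤s (≤-reflexive (row-beyond lam (s≤s (≤-reflexive e)))))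
                                    (row-positive lam part (s≤s z≤n) (≤-reflexive (sym e)))))

  inners-top : ∀ n → length lam ≡ suc n → inners (suc n) ≡ inners n
  inners-top n e with 1 ≤? row lam (2 + n) | row lam (2 + n) <? row lam (suc n)
  ... | no _    | _ = refl
  ... | yes 1≤r | _ = ⊥-elim (inconsistent (row lam (suc (suc n)) ∷ [])
        (κ 1 ≼ # 0 ∷ # 0 ≃ κ 0 ∷ [])
        (1≤r , row-beyond lam {2 + n} (s≤s (≤-reflexive e))))

  -- The bottom row always ends in an outer corner and never carries an inner one, so the lists have
  -- the shape on which the induction of `flag⇒` starts.
  flag-top : ∀ n → length lam ≡ suc n → ∀ u → (inB lam u ∨ inI lam u) ≡
    flag (content u) (content (suc n , row lam (suc n)) ∷ outers n) (inners n)
  flag-top n e u = trans (inB∨inI≡flag u)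
    (cong₂ (flag (content u)) (trans (cong outers e) (outers-top n e)) (trans (cong inners e) (inners-top n e)))

  cell≤corner : ∀ {p q} → (p , q) ∈Y lam → q ≤ row lam 1 + p
  cell≤corner (1≤p , _ , q≤r) = ≤-trans q≤r (≤-trans (anti ≤-refl 1≤p) (m≤m+n _ _))

  length≡suc : ∀ {p} → 1 ≤ p → p ≤ length lam → ∃ λ n → length lam ≡ suc n
  length≡suc {suc p} 1≤p p≤m with length lam | p≤m
  ... | suc n | _ = n , refl

  inB∨inI⇒Vertical : ∀ u → u ∈Y lam → T (inB lam u ∨ inI lam u) → Vertical lam u
  inB∨inI⇒Vertical (p , q) u∈@(1≤p , 1≤q , q≤r) t with length≡suc 1≤p (row-index≤length lam {p} 1≤q q≤r)
  ... | n , eq with flag⇒ p q (cell≤corner u∈) n (suc n) ≤-refl (≤-reflexive (sym eq))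
      (subst T (flag-top n eq (p , q)) t)
  ...   | inj₁ (l , h) = suc n , s≤s z≤n , linear (row lam (suc n) ∷ p ∷ q ∷ n ∷ [])
        (1+ (# 0 ⊕ # 1) ≼ # 2 ⊕ 1+ # 3 ∷ # 2 ⊕ # 3 ≼ # 0 ⊕ # 1 ∷ [])
        (1+ (# 0 ⊕ # 1) ≃ # 2 ⊕ 1+ # 3) (l , h)
  ...   | inj₂ (i , 1≤i , _ , e) = i , 1≤i , e

  Vertical⇒inB∨inI : ∀ u → u ∈Y lam → Vertical lam u → T (inB lam u ∨ inI lam u)
  Vertical⇒inB∨inI (p , q) u∈@(1≤p , 1≤q , q≤r) (i , 1≤i , e) with length≡suc 1≤p (row-index≤length lam {p} 1≤q q≤r)
  ... | n , eq = subst T (sym (flag-top n eq (p , q)))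
    (⇒flag p q (cell≤corner u∈) n (suc n) ≤-refl (≤-reflexive (sym eq)) remaining)
    where
    remaining : Remaining p q (cell≤corner u∈) (suc n) n
    remaining with <-cmp i (suc n)
    ... | tri< i<m _ _  = inj₂ (i , 1≤i , ≤-pred i<m , e)
    ... | tri≈ _ refl _ = inj₁ (linear (row lam (suc n) ∷ p ∷ q ∷ n ∷ [])
          (1+ (# 0 ⊕ # 1) ≃ # 2 ⊕ 1+ # 3 ∷ [])
          (1+ (# 0 ⊕ # 1) ≼ # 2 ⊕ 1+ # 3) e , linear (row lam (suc n) ∷ p ∷ q ∷ n ∷ [])
          (1+ (# 0 ⊕ # 1) ≃ # 2 ⊕ 1+ # 3 ∷ [])
          (# 2 ⊕ # 3 ≼ # 0 ⊕ # 1) e)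
    ... | tri> _ _ i>m  = ⊥-elim (inconsistent (row lam i ∷ p ∷ q ∷ i ∷ n ∷ [])
          (1+ (# 0 ⊕ # 1) ≃ # 2 ⊕ # 3 ∷ κ 1 ≼ # 2 ∷ # 1 ≼ 1+ # 4 ∷ 1+ 1+ # 4 ≼ # 3 ∷ # 0 ≃ κ 0 ∷ [])
          (e , 1≤q , ≤-trans (row-index≤length lam {p} 1≤q q≤r) (≤-reflexive eq) , i>m , row-beyond lam {i}
            (≤-trans (s≤s (≤-reflexive eq)) i>m)))

-- Insertion paths

-- A named copy of the step hidden in the `where` clause of `pathSW`.
next : List ℕ → Filling → Cell → Cell
next lam π u = if (inB lam u ∨ inI lam u) ∧ (val lam π u ≡∞ᵇ val lam π (sC u)) then sC u else wC u

-- The path without a length bound, extended at its far end; `pathSW` recurses at the near end,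
-- which `position-shift` reconciles.
position : List ℕ → Filling → Cell → ℕ → Cell
position lam π u zero    = u
position lam π u (suc e) = next lam π (position lam π u e)

val-inside : ∀ lam π u → u ∈Y lam → val lam π u ≡ fin (π u)
val-inside lam π u@(suc i , suc j) u∈ rewrite ∈Y⇒inb lam u u∈ = refl

val-outside : ∀ lam π i j → ¬ ((suc i , suc j) ∈Y lam) → val lam π (suc i , suc j) ≡ ∞
val-outside lam π i j u∉ rewrite ∉Y⇒inb lam (suc i , suc j) u∉ = refl

_≟C_ : (u v : Cell) → Dec (u ≡ v)
_≟C_ = ≡-dec _≟_ _≟_

cellEq⇒≡ : ∀ u v → T (cellEq u v) → u ≡ v
cellEq⇒≡ (i , j) (k , l) t with i ≡ᵇ k in e₁ | j ≡ᵇ l in e₂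
... | true | true = cong₂ _,_ (≡ᵇ⇒≡ i k (subst T (sym e₁) tt)) (≡ᵇ⇒≡ j l (subst T (sym e₂) tt))

cellEq-refl : ∀ u → cellEq u u ≡ true
cellEq-refl (i , j) with i ≡ᵇ i | ≡⇒≡ᵇ i i refl | j ≡ᵇ j | ≡⇒≡ᵇ j j refl
... | true | _ | true | _ = refl

cellEq-≢ : ∀ {u v} → u ≢ v → cellEq u v ≡ false
cellEq-≢ {u} {v} u≢v with cellEq u v in e
... | false = refl
... | true  = ⊥-elim (u≢v (cellEq⇒≡ u v (subst T (sym e) tt)))

module Steps (lam : List ℕ) (part : IsPartition lam) where
  open Corners lam part using (inB∨inI⇒Vertical; Vertical⇒inB∨inI)

  vertical? : ∀ u → u ∈Y lam → Dec (Vertical lam u)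
  vertical? u u∈ with inB lam u ∨ inI lam u in e
  ... | true  = yes (inB∨inI⇒Vertical u u∈ (subst T (sym e) tt))
  ... | false = no λ v → subst T e (Vertical⇒inB∨inI u u∈ v)

  next-horizontal : ∀ π {u} → u ∈Y lam → ¬ Vertical lam u → next lam π u ≡ wC u
  next-horizontal π {u} u∈ ¬v with inB lam u ∨ inI lam u in e
  ... | false = refl
  ... | true  = ⊥-elim (¬v (inB∨inI⇒Vertical u u∈ (subst T (sym e) tt)))

  private
    next-vertical : ∀ π {u b} → u ∈Y lam → Vertical lam u → (π u ≡ᵇ π (sC u)) ≡ b →
      next lam π u ≡ (if b then sC u else wC u)
    next-vertical π {u} u∈ v e = cong₂ (λ b c → if b ∧ c then sC u else wC u)
      (Equivalence.to T-≡ (Vertical⇒inB∨inI u u∈ v))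
      (trans (cong₂ _≡∞ᵇ_ (val-inside lam π u u∈) (val-inside lam π (sC u) (south-inside part u∈ v))) e)

  next-south : ∀ π {u} → u ∈Y lam → Vertical lam u → π u ≡ π (sC u) → next lam π u ≡ sC u
  next-south π {u} u∈ v e = next-vertical π u∈ v (Equivalence.to T-≡ (≡⇒≡ᵇ (π u) (π (sC u)) e))

  next-west : ∀ π {u} → u ∈Y lam → Vertical lam u → π u ≢ π (sC u) → next lam π u ≡ wC u
  next-west π {u} u∈ v u≢ = next-vertical π u∈ v (¬-not (λ e → u≢ (≡ᵇ⇒≡ (π u) (π (sC u)) (subst T (sym e) tt))))

next-cases : ∀ lam π u → (next lam π u ≡ sC u) ⊎ (next lam π u ≡ wC u)
next-cases lam π u with (inB lam u ∨ inI lam u) ∧ (val lam π u ≡∞ᵇ val lam π (sC u))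
... | true  = inj₁ refl
... | false = inj₂ refl

position-shift : ∀ lam π u e → position lam π (next lam π u) e ≡ position lam π u (suc e)
position-shift lam π u zero    = refl
position-shift lam π u (suc e) = cong (next lam π) (position-shift lam π u e)

On : List ℕ → Filling → Cell → ℕ → Cell → Set
On lam π u k v = ∃ λ e → e ≤ k × v ≡ position lam π u e

any⇒On : ∀ lam π u k v → T (any (cellEq v) (pathSW lam π u k)) → On lam π u k v
any⇒On lam π u zero v t with Equivalence.to (T-∨ {cellEq v u}) t
... | inj₁ t′ = 0 , z≤n , cellEq⇒≡ v u t′
any⇒On lam π u (suc k) v t with Equivalence.to (T-∨ {cellEq v u}) t
... | inj₁ t′ = 0 , z≤n , cellEq⇒≡ v u t′
... | inj₂ t′ with any⇒On lam π (next lam π u) k v t′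
...   | e , e≤k , eq = suc e , s≤s e≤k , trans eq (position-shift lam π u e)

On⇒any : ∀ lam π u k v → On lam π u k v → any (cellEq v) (pathSW lam π u k) ≡ true
On⇒any lam π u zero    v (zero , _ , refl) rewrite cellEq-refl u = refl
On⇒any lam π u (suc k) v (zero , _ , refl) rewrite cellEq-refl u = refl
On⇒any lam π u (suc k) v (suc e , s≤s e≤k , refl) with cellEq v u
... | true  = refl
... | false = On⇒any lam π (next lam π u) k v (e , e≤k , sym (position-shift lam π u e))

HookPosition : List ℕ → Cell → Filling → ℕ → Cell
HookPosition lam u π e = position lam π (hookTail lam u) e

OnHook : List ℕ → Cell → Filling → Cell → Set
OnHook lam u π v = On lam π (hookTail lam u) (hookLen lam u) v

insert-on : ∀ lam u π v → OnHook lam u π v → insertHook lam u π v ≡ suc (π v)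
insert-on lam u π v on rewrite On⇒any lam π (hookTail lam u) (hookLen lam u) v on = refl

insert-off : ∀ lam u π v → ¬ OnHook lam u π v → insertHook lam u π v ≡ π v
insert-off lam u π v off with any (cellEq v) (pathSW lam π (hookTail lam u) (hookLen lam u)) in e
... | false = refl
... | true  = ⊥-elim (off (any⇒On lam π (hookTail lam u) (hookLen lam u) v (subst T (sym e) tt)))

onHook? : ∀ lam u π v → Dec (OnHook lam u π v)
onHook? lam u π v with any (cellEq v) (pathSW lam π (hookTail lam u) (hookLen lam u)) in e
... | true  = yes (any⇒On lam π (hookTail lam u) (hookLen lam u) v (subst T (sym e) tt))
... | false = no λ on → subst T (trans (sym (On⇒any lam π (hookTail lam u) (hookLen lam u) v on)) e) tt

insert-agree : ∀ {lam mu u u′ π ρ v} → π v ≡ ρ v →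
  (OnHook lam u π v → OnHook mu u′ ρ v) → (OnHook mu u′ ρ v → OnHook lam u π v) →
  insertHook lam u π v ≡ insertHook mu u′ ρ v
insert-agree {lam} {mu} {u} {u′} {π} {ρ} {v} eq f g with onHook? lam u π v
... | yes on  = trans (insert-on lam u π v on) (trans (cong suc eq) (sym (insert-on mu u′ ρ v (f on))))
... | no  off = trans (insert-off lam u π v off) (trans eq (sym (insert-off mu u′ ρ v (λ on → off (g on)))))

-- `wC` truncates at column 0, so outside the diagram a step may fail to lower the content. All
-- bookkeeping by diagonals relies on this condition.
PathInside : List ℕ → Cell → Filling → Set
PathInside lam u π = ∀ e → e ≤ hookLen lam u → HookPosition lam u π e ∈Y lam

-- Each step south or west lowers the content by one.
position-diagonal : ∀ lam π u m d → proj₂ u + m ≡ proj₁ u + d → ∀ e →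
  (∀ e′ → e′ < e → position lam π u e′ ∈Y lam) →
  proj₂ (position lam π u e) + m + e ≡ proj₁ (position lam π u e) + d
position-diagonal lam π u m d D zero    ins = trans (+-identityʳ _) D
position-diagonal lam π u m d D (suc e) ins
  with position lam π u e | position-diagonal lam π u m d D e (λ e′ lt → ins e′ (m≤n⇒m≤1+n lt)) | ins e ≤-refl
... | i , suc j | D′ | _ , _ , _ with next-cases lam π (i , suc j)
...   | inj₁ eq rewrite eq = linear (j ∷ m ∷ e ∷ i ∷ d ∷ [])
      (1+ ((# 0 ⊕ # 1) ⊕ # 2) ≃ # 3 ⊕ # 4 ∷ [])
      (1+ ((# 0 ⊕ # 1) ⊕ 1+ # 2) ≃ 1+ (# 3 ⊕ # 4)) D′
...   | inj₂ eq rewrite eq = linear (j ∷ m ∷ e ∷ i ∷ d ∷ [])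
      (1+ ((# 0 ⊕ # 1) ⊕ # 2) ≃ # 3 ⊕ # 4 ∷ [])
      ((# 0 ⊕ # 1) ⊕ 1+ # 2 ≃ # 3 ⊕ # 4) D′
position-diagonal lam π u m d D (suc e) ins | i , zero | D′ | _ , () , _

-- Removal of the corner x

Monotone : List ℕ → Filling → Set
Monotone lam π = ∀ u → u ∈Y lam → (eC u ∈Y lam → π u ≤ π (eC u)) × (sC u ∈Y lam → π u ≤ π (sC u))

IsRPP⇒Monotone : ∀ {lam π} → IsRPP lam π → Monotone lam π
IsRPP⇒Monotone {lam} {π} rpp u u∈ =
  (λ e∈ → subst₂ _≤∞_ (val-inside lam π u u∈) (val-inside lam π (eC u) e∈) (proj₁ (rpp u u∈))) ,
  (λ s∈ → subst₂ _≤∞_ (val-inside lam π u u∈) (val-inside lam π (sC u) s∈) (proj₂ (rpp u u∈)))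

_∈Y?_ : ∀ u lam → Dec (u ∈Y lam)
u ∈Y? lam with inb lam u in e
... | true  = yes (inb⇒∈Y lam u e)
... | false = no λ u∈ → true≢false (trans (sym (∈Y⇒inb lam u u∈)) e)

Monotone⇒IsRPP : ∀ {lam π} → Monotone lam π → IsRPP lam π
Monotone⇒IsRPP {lam} {π} mono u@(suc i , suc j) u∈ =
  bound (i) (suc j) (proj₁ (mono u u∈)) , bound (suc i) j (proj₂ (mono u u∈))
  where
  bound : ∀ k l → ((suc k , suc l) ∈Y lam → π u ≤ π (suc k , suc l)) → val lam π u ≤∞ val lam π (suc k , suc l)
  bound k l h with (suc k , suc l) ∈Y? lam
  ... | yes v∈ = subst₂ _≤∞_ (sym (val-inside lam π u u∈)) (sym (val-inside lam π _ v∈)) (h v∈)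
  ... | no  v∉ = subst₂ _≤∞_ (sym (val-inside lam π u u∈)) (sym (val-outside lam π k l v∉)) tt

-- The convention that fillings vanish on row 0 and column 0.
ext : Filling → Cell → ℕ
ext π (zero  , _)     = 0
ext π (suc i , zero)  = 0
ext π (suc i , suc j) = π (suc i , suc j)

ext-inside : ∀ π {lam u} → u ∈Y lam → ext π u ≡ π u
ext-inside π {u = suc i , suc j} _ = refl

-- The two truncated subtractions of `hookLen` are traded for an equation that can serve as a
-- hypothesis of `linear`.
hookLen-sum : ∀ {lam} → IsPartition lam → ∀ {i j} → (i , j) ∈Y lam → hookLen lam (i , j) +
    (i + j) ≡ conj lam j + row lam i
hookLen-sum {lam} h {i} {j} (1≤i , 1≤j , j≤r) =
  linear (conj lam j ∸ i ∷ i ∷ conj lam j ∷ row lam i ∸ j ∷ j ∷ row lam i ∷ [])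
        (# 0 ⊕ # 1 ≃ # 2 ∷ # 3 ⊕ # 4 ≃ # 5 ∷ [])
        ((# 0 ⊕ # 3) ⊕ (# 1 ⊕ # 4) ≃ # 2 ⊕ # 5) (m∸n+n≡m (j≤row⇒i≤conj h 1≤i 1≤j j≤r) , m∸n+n≡m j≤r)

conj-≤ : ∀ {lam} → IsPartition lam → ∀ {j k} → (∀ i → 1 ≤ i → j ≤ row lam i → i ≤ k) → conj lam j ≤ k
conj-≤ {lam} h {j} {k} f = go (conj lam j) ≤-refl
  where
  go : ∀ c → c ≤ conj lam j → c ≤ k
  go zero    _ = z≤n
  go (suc c) le = f (suc c) (s≤s z≤n) (i≤conj⇒j≤row h (s≤s z≤n) le)

-- Sequences of insertions

insertAll : List ℕ → List Cell → Filling
insertAll lam = foldr (insertHook lam) zeroFilling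

-- Every intermediate filling is recorded, because the comparison of λ and μ needs the path of each
-- single hook.
Good : List ℕ → List Cell → Set
Good lam []      = ⊤
Good lam (u ∷ l) = Good lam l × PathInside lam u (insertAll lam l) × Monotone lam (insertAll lam (u ∷ l))

Good⇒Monotone : ∀ {lam} l → Good lam l → Monotone lam (insertAll lam l)
Good⇒Monotone []      _               u _ = (λ _ → z≤n) , (λ _ → z≤n)
Good⇒Monotone (u ∷ l) (_ , _ , mono) = mono

columnOnto : Filling → ℕ → ℕ → List Cell → List Cell
columnOnto t j zero    l = l
columnOnto t j (suc n) l = replicate (t (suc n , j)) (suc n , j) ++ columnOnto t j n l

-- `foldr` inserts the end of the list first: columns go from left to right, and within a column
-- rows go from the top down. The heights are a parameter so that the lists of λ and μ can be built
-- in parallel.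
hooks : (ℕ → ℕ) → Filling → ℕ → List Cell
hooks heights t zero    = []
hooks heights t (suc n) = columnOnto t (suc n) (heights (suc n)) (hooks heights t n)

hookMultiset≡hooks : ∀ lam t → hookMultiset lam t ≡ hooks (conj lam) t (row lam 1)
hookMultiset≡hooks lam t = columns (row lam 1)
  where
  copies : List Cell → List Cell
  copies = concatMap (λ u → replicate (t u) u)
  column : ∀ j c l → copies (map (λ i → (i , j)) (map suc (downFrom c))) ++ l ≡ columnOnto t j c l
  column j zero    l = refl
  column j (suc c) l = trans (++-assoc (replicate (t (suc c , j)) (suc c , j)) _ l)
      (cong (replicate (t (suc c , j)) (suc c , j) ++_) (column j c l))
  columns : ∀ n → copies (concatMap (λ j → map (λ i → (i , j)) (map suc (downFrom (conj lam j))))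
      (map suc (downFrom n))) ≡ hooks (conj lam) t n
  columns zero    = refl
  columns (suc n) = trans (concatMap-++ (λ u → replicate (t u) u)
      (map (λ i → (i , suc n)) (map suc (downFrom (conj lam (suc n))))) _)
    (trans (column (suc n) (conj lam (suc n)) _) (cong (columnOnto t (suc n) (conj lam (suc n))) (columns n)))

module _ (S : List Cell → List Cell → Set) where

  lift-replicate : ∀ {u} → (∀ {k l} → S k l → S (u ∷ k) (u ∷ l)) → ∀ n {k l} → S k l → S (replicate n u ++ k)
      (replicate n u ++ l)
  lift-replicate step zero    s = s
  lift-replicate step (suc n) s = step (lift-replicate step n s)

  lift-column : ∀ t j c → (∀ i → 1 ≤ i → i ≤ c → ∀ {k l} → S k l → S ((i , j) ∷ k) ((i , j) ∷ l)) →
    ∀ {k l} → S k l → S (columnOnto t j c k) (columnOnto t j c l)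
  lift-column t j zero    step s = s
  lift-column t j (suc c) step s = lift-replicate (step (suc c) (s≤s z≤n) ≤-refl) (t (suc c , j))
    (lift-column t j c (λ i 1≤i i≤c → step i 1≤i (m≤n⇒m≤1+n i≤c)) s)

-- The two shapes are described by their row lengths alone, so a last row that shrinks to nothing
-- needs no separate case.
module Removal (lam mu : List ℕ) (m′ a′ : ℕ)
  (part : IsPartition lam) (partμ : IsPartition mu)
  (row-m : row lam (suc m′) ≡ suc a′) (rowμ-m : row mu (suc m′) ≡ a′)
  (rowμ : ∀ i → i ≢ suc m′ → row mu i ≡ row lam i)
  (beyond : ∀ i → suc m′ < i → row lam i ≡ 0) where

  m a : ℕ
  m = suc m′
  a = suc a′

  x : Cell
  x = (m , a)

  -- D u d says that u has content d − m; the diagonal of x is d = a.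
  D : Cell → ℕ → Set
  D u d = proj₂ u + m ≡ proj₁ u + d

  D? : ∀ u d → Dec (D u d)
  D? u d = proj₂ u + m ≟ proj₁ u + d

  D-unique : ∀ {u d d′} → D u d → D u d′ → d ≡ d′
  D-unique {p , q} e e′ = +-cancelˡ-≡ p _ _ (trans (sym e) e′)

  D-row : ∀ {u v d} → D u d → D v d → proj₁ u ≡ proj₁ v → u ≡ v
  D-row {p , q} {.p , q′} e e′ refl = cong (p ,_) (+-cancelʳ-≡ m q q′ (trans e (sym e′)))

  row≤m : ∀ {i j} → (i , j) ∈Y lam → i ≤ m
  row≤m {i} {j} (_ , 1≤j , j≤r) with i ≤? m
  ... | yes i≤m = i≤m
  ... | no  i≰m = ⊥-elim (inconsistent (j ∷ row lam i ∷ [])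
        (κ 1 ≼ # 0 ∷ # 0 ≼ # 1 ∷ # 1 ≃ κ 0 ∷ [])
        (1≤j , j≤r , beyond i (≰⇒> i≰m)))

  μ⊆λ : ∀ {u} → u ∈Y mu → u ∈Y lam
  μ⊆λ {i , j} (1≤i , 1≤j , j≤r) with i ≟ m
  ... | yes refl = 1≤i , 1≤j , linear (j ∷ row mu (suc m′) ∷ row lam (suc m′) ∷ a′ ∷ [])
        (# 0 ≼ # 1 ∷ # 2 ≃ 1+ # 3 ∷ # 1 ≃ # 3 ∷ [])
        (# 0 ≼ # 2) (j≤r , row-m , rowμ-m)
  ... | no  i≢m  = 1≤i , 1≤j , linear (j ∷ row mu i ∷ row lam i ∷ [])
        (# 0 ≼ # 1 ∷ # 1 ≃ # 2 ∷ [])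
        (# 0 ≼ # 2) (j≤r , rowμ i i≢m)

  x∈λ : x ∈Y lam
  x∈λ = s≤s z≤n , s≤s z≤n , ≤-reflexive (sym row-m)

  λ⇒μ : ∀ {u} → u ∈Y lam → (u ≡ x) ⊎ (u ∈Y mu)
  λ⇒μ {i , j} (1≤i , 1≤j , j≤r) with i ≟ m
  ... | no  i≢m  = inj₂ (1≤i , 1≤j , linear (j ∷ row lam i ∷ row mu i ∷ [])
        (# 0 ≼ # 1 ∷ # 2 ≃ # 1 ∷ [])
        (# 0 ≼ # 2) (j≤r , rowμ i i≢m))
  ... | yes refl with j ≟ a
  ...   | yes refl = inj₁ refl
  ...   | no  j≢a  = inj₂ (1≤i , 1≤j , ≤-trans (≤-pred (≤∧≢⇒< (≤-trans j≤r (≤-reflexive row-m)) j≢a))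
      (≤-reflexive (sym rowμ-m)))

  x∉μ : ¬ (x ∈Y mu)
  x∉μ (_ , _ , a≤r) = inconsistent (a′ ∷ row mu (proj₁ x) ∷ [])
        (1+ # 0 ≼ # 1 ∷ # 1 ≃ # 0 ∷ [])
        (a≤r , rowμ-m)

  D-x : D x a
  D-x = +-comm a m

  λ-off⇒μ : ∀ {u} → u ∈Y lam → ¬ D u a → u ∈Y mu
  λ-off⇒μ u∈ ¬D with λ⇒μ u∈
  ... | inj₁ refl = ⊥-elim (¬D D-x)
  ... | inj₂ u∈μ  = u∈μ

  a≤row : ∀ {i} → 1 ≤ i → i ≤ m → a ≤ row lam i
  a≤row 1≤i i≤m = ≤-trans (≤-reflexive (sym row-m)) (row-antitone part 1≤i i≤m)

  a≤rowμ : ∀ {i} → 1 ≤ i → i < m → a ≤ row mu i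
  a≤rowμ {i} 1≤i i<m = ≤-trans (a≤row 1≤i (<⇒≤ i<m)) (≤-reflexive (sym (rowμ i (<⇒≢ i<m))))

  a′≤rowμ : ∀ {i} → 1 ≤ i → i ≤ m → a′ ≤ row mu i
  a′≤rowμ {i} 1≤i i≤m = ≤-trans (≤-reflexive (sym rowμ-m)) (row-antitone partμ 1≤i i≤m)

  diag-row<m : ∀ {v} → v ∈Y mu → D v a → proj₁ v < m
  diag-row<m {p , q} v∈ Dv with m≤n⇒m<n∨m≡n (row≤m (μ⊆λ v∈))
  ... | inj₁ p<m  = p<m
  ... | inj₂ refl = ⊥-elim (inconsistent (q ∷ m′ ∷ a′ ∷ row mu (suc m′) ∷ [])
        (# 0 ⊕ 1+ # 1 ≃ 1+ (# 1 ⊕ 1+ # 2) ∷ # 0 ≼ # 3 ∷ # 3 ≃ # 2 ∷ [])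
        (Dv , proj₂ (proj₂ v∈) , rowμ-m))

  -- A cell of μ on the diagonal of x lies strictly above row `m`, hence strictly left of column
  -- `a`, while its row reaches column `a` and the next row reaches column `a′`. So the minimum in
  -- `ζ` never meets `∞`.
  diag-east : ∀ {v} → v ∈Y mu → D v a → eC v ∈Y mu
  diag-east {p , q} v∈@(1≤p , 1≤q , _) Dv =
    1≤p , s≤s z≤n , linear (a′ ∷ row mu p ∷ q ∷ m′ ∷ p ∷ [])
          (1+ # 0 ≼ # 1 ∷ # 2 ⊕ 1+ # 3 ≃ # 4 ⊕ 1+ # 0 ∷ 1+ # 4 ≼ 1+ # 3 ∷ [])
          (1+ # 2 ≼ # 1) (a≤rowμ 1≤p p<m , Dv , p<m)
    where p<m = diag-row<m v∈ Dv

  diag-south : ∀ {v} → v ∈Y mu → D v a → sC v ∈Y mu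
  diag-south {p , q} v∈@(1≤p , 1≤q , _) Dv =
    s≤s z≤n , 1≤q , linear (a′ ∷ row mu (suc p) ∷ q ∷ m′ ∷ p ∷ [])
          (# 0 ≼ # 1 ∷ # 2 ⊕ 1+ # 3 ≃ # 4 ⊕ 1+ # 0 ∷ 1+ # 4 ≼ 1+ # 3 ∷ [])
          (# 2 ≼ # 1) (a′≤rowμ {suc p} (s≤s z≤n) p<m , Dv , p<m)
    where p<m = diag-row<m v∈ Dv

  north-inside : ∀ {p q} → (suc (suc p) , q) ∈Y lam → (suc p , q) ∈Y lam
  north-inside (_ , 1≤q , q≤r) = s≤s z≤n , 1≤q , ≤-trans q≤r (row-antitone part (s≤s z≤n) (n≤1+n _))

  west-inside : ∀ {p q} → (p , suc (suc q)) ∈Y lam → (p , suc q) ∈Y lam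
  west-inside (1≤p , _ , q≤r) = 1≤p , s≤s z≤n , <⇒≤ q≤r

  diag-north-μ : ∀ {p q} → (suc (suc p) , q) ∈Y lam → D (suc (suc p) , q) a → (suc p , q) ∈Y mu
  diag-north-μ {p} {q} v∈ Dv = λ-off⇒μ (north-inside v∈) λ Dn → inconsistent (q ∷ m′ ∷ p ∷ a′ ∷ [])
        (# 0 ⊕ 1+ # 1 ≃ 1+ 1+ (# 2 ⊕ 1+ # 3) ∷ # 0 ⊕ 1+ # 1 ≃ 1+ (# 2 ⊕ 1+ # 3) ∷ [])
        (Dv , Dn)

  diag-west-μ : ∀ {p q} → (p , suc (suc q)) ∈Y lam → D (p , suc (suc q)) a → (p , suc q) ∈Y mu
  diag-west-μ {p} {q} v∈ Dv = λ-off⇒μ (west-inside v∈) λ Dw → inconsistent (q ∷ m′ ∷ p ∷ a′ ∷ [])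
        (1+ 1+ (# 0 ⊕ 1+ # 1) ≃ # 2 ⊕ 1+ # 3 ∷ 1+ (# 0 ⊕ 1+ # 1) ≃ # 2 ⊕ 1+ # 3 ∷ [])
        (Dv , Dw)

  -- The toggle of the diagonal of x

  Off : Filling → Filling → Set
  Off π ρ = ∀ u → u ∈Y mu → ¬ D u a → π u ≡ ρ u

  nw : Filling → Cell → ℕ
  nw ρ v = ext ρ (nC v) ⊔ ext ρ (wC v)

  es : Filling → Cell → ℕ
  es ρ v = ρ (eC v) ⊓ ρ (sC v)

  -- π arises from ρ by toggling the diagonal of x and putting n + nw in the cell x.
  record Toggle (π ρ : Filling) (n : ℕ) : Set where
    field
      off  : Off π ρ
      diag : ∀ v → v ∈Y mu → D v a → π v + ρ v ≡ nw ρ v + es ρ v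
      top  : π x ≡ n + nw ρ x

  ext-north≤ : ∀ {kap} → IsPartition kap → ∀ {ρ} → Monotone kap ρ → ∀ {v} → v ∈Y kap → ext ρ (nC v) ≤ ρ v
  ext-north≤ pk mono {suc zero , q} v∈ = z≤n
  ext-north≤ pk mono {suc (suc p) , suc q} v∈@(_ , 1≤q , q≤r) =
    proj₂ (mono (suc p , suc q) (s≤s z≤n , 1≤q , ≤-trans q≤r (row-antitone pk (s≤s z≤n) (n≤1+n _)))) v∈

  ext-west≤ : ∀ {kap ρ} → Monotone kap ρ → ∀ {v} → v ∈Y kap → ext ρ (wC v) ≤ ρ v
  ext-west≤ mono {suc p , suc zero} v∈ = z≤n
  ext-west≤ mono {suc p , suc (suc q)} v∈@(1≤p , _ , q≤r) =
    proj₁ (mono (suc p , suc q) (1≤p , s≤s z≤n , <⇒≤ q≤r)) v∈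

  nw≤ : ∀ {kap} → IsPartition kap → ∀ {ρ} → Monotone kap ρ → ∀ {v} → v ∈Y kap → nw ρ v ≤ ρ v
  nw≤ pk mono v∈ = ⊔-lub (ext-north≤ pk mono v∈) (ext-west≤ mono v∈)

  ≤es : ∀ {kap ρ} → Monotone kap ρ → ∀ {v} → v ∈Y kap → eC v ∈Y kap → sC v ∈Y kap → ρ v ≤ es ρ v
  ≤es mono v∈ e∈ s∈ = ⊓-glb (proj₁ (mono _ v∈) e∈) (proj₂ (mono _ v∈) s∈)

  -- The toggle reflects an entry in the interval from `nw` to `es`: the upper bound for ρ becomes
  -- the lower bound for π, and conversely in `Toggle-≤es`.
  Toggle-nw≤ : ∀ {π ρ n} → Monotone mu ρ → Toggle π ρ n → ∀ {v} → v ∈Y lam → D v a → nw ρ v ≤ π v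
  Toggle-nw≤ {π} {ρ} mono R {v} v∈ Dv with λ⇒μ v∈
  ... | inj₁ refl = ≤-trans (m≤n+m _ _) (≤-reflexive (sym (Toggle.top R)))
  ... | inj₂ v∈μ  = linear (π v ∷ ρ v ∷ nw ρ v ∷ es ρ v ∷ [])
        (# 0 ⊕ # 1 ≃ # 2 ⊕ # 3 ∷ # 1 ≼ # 3 ∷ [])
        (# 2 ≼ # 0) (Toggle.diag R v v∈μ Dv , ≤es {mu} mono v∈μ (diag-east v∈μ Dv) (diag-south v∈μ Dv))

  Toggle-≤es : ∀ {π ρ n} → Monotone mu ρ → Toggle π ρ n → ∀ {v} → v ∈Y mu → D v a → π v ≤ es ρ v
  Toggle-≤es {π} {ρ} mono R {v} v∈ Dv = linear (π v ∷ ρ v ∷ nw ρ v ∷ es ρ v ∷ [])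
        (# 0 ⊕ # 1 ≃ # 2 ⊕ # 3 ∷ # 2 ≼ # 1 ∷ [])
        (# 0 ≼ # 3) (Toggle.diag R v v∈ Dv , nw≤ partμ mono v∈)

  east-off : ∀ {v} → D v a → ¬ D (eC v) a
  east-off {p , q} Dv De = inconsistent (q ∷ m′ ∷ p ∷ a′ ∷ [])
        (# 0 ⊕ 1+ # 1 ≃ # 2 ⊕ 1+ # 3 ∷ 1+ (# 0 ⊕ 1+ # 1) ≃ # 2 ⊕ 1+ # 3 ∷ [])
        (Dv , De)

  south-off : ∀ {v} → D v a → ¬ D (sC v) a
  south-off {p , q} Dv De = inconsistent (q ∷ m′ ∷ p ∷ a′ ∷ [])
        (# 0 ⊕ 1+ # 1 ≃ # 2 ⊕ 1+ # 3 ∷ # 0 ⊕ 1+ # 1 ≃ 1+ (# 2 ⊕ 1+ # 3) ∷ [])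
        (Dv , De)

  east-x∉ : ¬ (eC x ∈Y lam)
  east-x∉ (_ , _ , le) = inconsistent (a′ ∷ row lam (suc m′) ∷ [])
        (1+ 1+ # 0 ≼ # 1 ∷ # 1 ≃ 1+ # 0 ∷ [])
        (le , row-m)

  south-x∉ : ¬ (sC x ∈Y lam)
  south-x∉ (_ , _ , le) = inconsistent (a′ ∷ row lam (suc (suc m′)) ∷ [])
        (1+ # 0 ≼ # 1 ∷ # 1 ≃ κ 0 ∷ [])
        (le , beyond (suc m) ≤-refl)

  -- Adjacent cells are never both on the diagonal of x, so each inequality is either inherited from
  -- ρ or one of the two toggle bounds. All monotonicity on λ in the simulation comes from here.
  Toggle⇒Monotone : ∀ {π ρ n} → Monotone mu ρ → Toggle π ρ n → Monotone lam π
  Toggle⇒Monotone {π} {ρ} mono R u@(suc p , suc q) u∈ = east , south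
    where
    open Toggle R
    u∈μ-diag : D u a → ∀ {v} → v ∈Y lam → (x ≡ u → ¬ (v ∈Y lam)) → u ∈Y mu
    u∈μ-diag Du v∈ h with λ⇒μ u∈
    ... | inj₁ refl = ⊥-elim (h refl v∈)
    ... | inj₂ u∈μ  = u∈μ
    east : eC u ∈Y lam → π u ≤ π (eC u)
    east e∈ with D? u a | D? (eC u) a
    ... | yes Du | yes De = ⊥-elim (east-off {u} Du De)
    ... | yes Du | no ¬De =
        ≤-trans (Toggle-≤es mono R u∈μ Du) (≤-trans (m⊓n≤m _ _) (≤-reflexive (sym (off _ (diag-east u∈μ Du) ¬De))))
      where u∈μ = u∈μ-diag Du e∈ (λ { refl → east-x∉ })
    ... | no ¬Du | yes De =
        ≤-trans (≤-reflexive (off u (λ-off⇒μ u∈ ¬Du) ¬Du)) (≤-trans (m≤n⊔m _ _) (Toggle-nw≤ mono R e∈ De))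
    ... | no ¬Du | no ¬De = subst₂ _≤_ (sym (off u (λ-off⇒μ u∈ ¬Du) ¬Du)) (sym (off _ (λ-off⇒μ e∈ ¬De) ¬De))
        (proj₁ (mono u (λ-off⇒μ u∈ ¬Du)) (λ-off⇒μ e∈ ¬De))
    south : sC u ∈Y lam → π u ≤ π (sC u)
    south s∈ with D? u a | D? (sC u) a
    ... | yes Du | yes Ds = ⊥-elim (south-off {u} Du Ds)
    ... | yes Du | no ¬Ds =
        ≤-trans (Toggle-≤es mono R u∈μ Du) (≤-trans (m⊓n≤n _ _) (≤-reflexive (sym (off _ (diag-south u∈μ Du) ¬Ds))))
      where u∈μ = u∈μ-diag Du s∈ (λ { refl → south-x∉ })
    ... | no ¬Du | yes Ds =
        ≤-trans (≤-reflexive (off u (λ-off⇒μ u∈ ¬Du) ¬Du)) (≤-trans (m≤m⊔n _ _) (Toggle-nw≤ mono R s∈ Ds))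
    ... | no ¬Du | no ¬Ds = subst₂ _≤_ (sym (off u (λ-off⇒μ u∈ ¬Du) ¬Du)) (sym (off _ (λ-off⇒μ s∈ ¬Ds) ¬Ds))
        (proj₂ (mono u (λ-off⇒μ u∈ ¬Du)) (λ-off⇒μ s∈ ¬Ds))

  nw-cong : ∀ {π ρ} → Off π ρ → ∀ {v} → v ∈Y lam → D v a → nw π v ≡ nw ρ v
  nw-cong {π} {ρ} off {v} v∈ Dv = cong₂ _⊔_ (north v∈ Dv) (west v∈ Dv)
    where
    north : ∀ {v} → v ∈Y lam → D v a → ext π (nC v) ≡ ext ρ (nC v)
    north {suc zero , q} v∈ Dv = refl
    north {suc (suc p) , suc q} v∈ Dv = off _ (diag-north-μ v∈ Dv) λ Dn → inconsistent (q ∷ m′ ∷ p ∷ a′ ∷ [])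
          (1+ (# 0 ⊕ 1+ # 1) ≃ 1+ 1+ (# 2 ⊕ 1+ # 3) ∷ 1+ (# 0 ⊕ 1+ # 1) ≃ 1+ (# 2 ⊕ 1+ # 3) ∷ [])
          (Dv , Dn)
    west : ∀ {v} → v ∈Y lam → D v a → ext π (wC v) ≡ ext ρ (wC v)
    west {suc p , suc zero} v∈ Dv = refl
    west {suc p , suc (suc q)} v∈ Dv = off _ (diag-west-μ v∈ Dv) λ Dw → inconsistent (q ∷ m′ ∷ p ∷ a′ ∷ [])
          (1+ 1+ (# 0 ⊕ 1+ # 1) ≃ 1+ (# 2 ⊕ 1+ # 3) ∷ 1+ (# 0 ⊕ 1+ # 1) ≃ 1+ (# 2 ⊕ 1+ # 3) ∷ [])
          (Dv , Dw)

  es-cong : ∀ {π ρ} → Off π ρ → ∀ {v} → v ∈Y mu → D v a → es π v ≡ es ρ v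
  es-cong off v∈ Dv = cong₂ _⊓_ (off _ (diag-east v∈ Dv) (east-off Dv)) (off _ (diag-south v∈ Dv) (south-off Dv))

  -- The filling ρ has no information on the cell x, which is what the common `n` provides;
  -- elsewhere on the diagonal ρ cancels from the additive equation.
  Toggle-injective : ∀ {π ρ π′ ρ′ n} → Toggle π ρ n → Toggle π′ ρ′ n → (∀ u → u ∈Y mu → ρ u ≡ ρ′ u) →
    ∀ u → u ∈Y lam → π u ≡ π′ u
  Toggle-injective {π} {ρ} {π′} {ρ′} {n} R R′ eq u u∈ with D? u a
  ... | no ¬D = trans (Toggle.off R u u∈μ ¬D) (trans (eq u u∈μ) (sym (Toggle.off R′ u u∈μ ¬D)))
    where u∈μ = λ-off⇒μ u∈ ¬D
  ... | yes Du with λ⇒μ u∈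
  ...   | inj₁ refl = trans (Toggle.top R) (trans (cong (n +_) (nw-cong (λ v v∈ _ → eq v v∈) u∈ Du))
      (sym (Toggle.top R′)))
  ...   | inj₂ u∈μ = +-cancelʳ-≡ (ρ u) _ _ (trans (Toggle.diag R u u∈μ Du)
            (trans (cong₂ _+_ (nw-cong (λ v v∈ _ → eq v v∈) u∈ Du) (es-cong (λ v v∈ _ → eq v v∈) u∈μ Du))
            (trans (sym (Toggle.diag R′ u u∈μ Du)) (cong (_+_ (π′ u)) (sym (eq u u∈μ))))))

  ζ-off : ∀ π v → ¬ D v a → ζ lam x π v ≡ π v
  ζ-off π (p , q) ¬D with content (p , q) ℤ.≟ content x
  ... | no  _ = refl
  ... | yes e = ⊥-elim (¬D (trans (content-≡⇒ {p} {q} {m} {a} e) (+-comm a p)))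

  nw-val : ∀ π {v} → v ∈Y lam → toℕ (val lam π (nC v) ⊔∞ val lam π (wC v)) ≡ nw π v
  nw-val π v∈ = cong toℕ (cong₂ _⊔∞_ (north v∈) (west v∈))
    where
    north : ∀ {v} → v ∈Y lam → val lam π (nC v) ≡ fin (ext π (nC v))
    north {suc zero , q} v∈ = refl
    north {suc (suc p) , suc q} v∈ = val-inside lam π _ (north-inside v∈)
    west : ∀ {v} → v ∈Y lam → val lam π (wC v) ≡ fin (ext π (wC v))
    west {suc p , suc zero} v∈ = refl
    west {suc p , suc (suc q)} v∈ = val-inside lam π _ (west-inside v∈)

  ζ-diag : ∀ π v → v ∈Y mu → D v a → ζ lam x π v ≡ nw π v + es π v ∸ π v
  ζ-diag π v@(p , q) v∈ Dv with content (p , q) ℤ.≟ content x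
  ... | no ≢ = ⊥-elim (≢ (⇒content-≡ {p} {q} {m} {a} (trans Dv (+-comm p a))))
  ... | yes _ = cong₂ (λ s t → s + t ∸ π v) (nw-val π (μ⊆λ v∈))
    (cong toℕ (cong₂ _⊓∞_ (val-inside lam π _ (μ⊆λ (diag-east v∈ Dv))) (val-inside lam π _ (μ⊆λ (diag-south v∈ Dv)))))

  -- The neighbours of the diagonal carry the same entries in π and ρ, so the symmetric equation can
  -- be solved for ρ.
  Toggle⇒ζ : ∀ {π ρ n} → Toggle π ρ n → ∀ v → v ∈Y mu → ζ lam x π v ≡ ρ v
  Toggle⇒ζ {π} {ρ} R v v∈ with D? v a
  ... | no ¬D = trans (ζ-off π v ¬D) (Toggle.off R v v∈ ¬D)
  ... | yes Dv = trans (ζ-diag π v v∈ Dv) (trans (cong (_∸ π v)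
          (trans (cong₂ _+_ (nw-cong (Toggle.off R) (μ⊆λ v∈) Dv) (es-cong (Toggle.off R) v∈ Dv))
            (sym (Toggle.diag R v v∈ Dv))))
          (m+n∸m≡n (π v) (ρ v)))

  -- No monus is truncated here: π v lies between nw π v and es π v.
  ζ-Toggle : ∀ {π} → Monotone lam π → Toggle π (ζ lam x π) (π x ∸ nw π x)
  ζ-Toggle {π} mono = record
    { off  = off
    ; diag = λ v v∈ Dv → trans (trans (cong (π v +_) (ζ-diag π v v∈ Dv))
        (m+[n∸m]≡n (≤-trans (≤es {lam} mono (μ⊆λ v∈) (μ⊆λ (diag-east v∈ Dv)) (μ⊆λ (diag-south v∈ Dv))) (m≤n+m _ _))))
        (cong₂ _+_ (nw-cong off (μ⊆λ v∈) Dv) (es-cong off v∈ Dv))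
    ; top  = trans (sym (m∸n+n≡m (nw≤ part mono x∈λ))) (cong (π x ∸ nw π x +_) (nw-cong off x∈λ D-x))
    }
    where
    off : Off π (ζ lam x π)
    off u _ ¬D = sym (ζ-off π u ¬D)

  ζ-Monotone : ∀ {π} → Monotone lam π → Monotone mu (ζ lam x π)
  ζ-Monotone {π} mono u u∈ = east , south
    where
    ρ = ζ lam x π
    R = ζ-Toggle mono
    open Toggle R
    ≤es′ : ∀ {v} → v ∈Y mu → D v a → ρ v ≤ es ρ v
    ≤es′ {v} v∈ Dv = linear (π v ∷ ζ lam x π v ∷ nw (ζ lam x π) v ∷ es (ζ lam x π) v ∷ nw π v ∷ [])
          (# 0 ⊕ # 1 ≃ # 2 ⊕ # 3 ∷ # 4 ≼ # 0 ∷ # 4 ≃ # 2 ∷ [])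
          (# 1 ≼ # 3) (diag v v∈ Dv , nw≤ part mono (μ⊆λ v∈) , nw-cong off (μ⊆λ v∈) Dv)
    nw≤′ : ∀ {v} → v ∈Y mu → D v a → nw ρ v ≤ ρ v
    nw≤′ {v} v∈ Dv = linear (π v ∷ ζ lam x π v ∷ nw (ζ lam x π) v ∷ es (ζ lam x π) v ∷ es π v ∷ [])
          (# 0 ⊕ # 1 ≃ # 2 ⊕ # 3 ∷ # 0 ≼ # 4 ∷ # 4 ≃ # 3 ∷ [])
          (# 2 ≼ # 1) (diag v v∈ Dv , ≤es {lam} mono (μ⊆λ v∈) (μ⊆λ (diag-east v∈ Dv)) (μ⊆λ (diag-south v∈ Dv)) ,
            es-cong off v∈ Dv)
    east : eC u ∈Y mu → ρ u ≤ ρ (eC u)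
    east e∈ with D? u a | D? (eC u) a
    ... | yes Du | _      = ≤-trans (≤es′ u∈ Du) (m⊓n≤m _ _)
    ... | no ¬Du | yes De = ≤-trans (≤-reflexive (sym (ext-inside ρ u∈))) (≤-trans (m≤n⊔m _ _) (nw≤′ e∈ De))
    ... | no ¬Du | no ¬De = subst₂ _≤_ (off u u∈ ¬Du) (off _ e∈ ¬De) (proj₁ (mono u (μ⊆λ u∈)) (μ⊆λ e∈))
    south : sC u ∈Y mu → ρ u ≤ ρ (sC u)
    south s∈ with D? u a | D? (sC u) a
    ... | yes Du | _      = ≤-trans (≤es′ u∈ Du) (m⊓n≤n _ _)
    ... | no ¬Du | yes Ds = ≤-trans (≤-reflexive (sym (ext-inside ρ u∈))) (≤-trans (m≤m⊔n _ _) (nw≤′ s∈ Ds))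
    ... | no ¬Du | no ¬Ds = subst₂ _≤_ (off u u∈ ¬Du) (off _ s∈ ¬Ds) (proj₂ (mono u (μ⊆λ u∈)) (μ⊆λ s∈))

  -- Rim types and insertion paths in the two shapes

  module Sλ = Steps lam part
  module Sμ = Steps mu partμ

  -- Row `m` makes the diagonal `a + 1` vertical in λ but the diagonal `a` in μ. Every row above is
  -- longer or equal and has a smaller index, which puts its vertical step beyond `a + 1` in both
  -- shapes.
  Vλ⇒ : ∀ {u d} → u ∈Y lam → Vertical lam u → D u d → (d ≡ suc a) ⊎ (suc a < d × Vertical mu u)
  Vλ⇒ {p , q} {d} u∈@(_ , 1≤q , _) (i , 1≤i , e) Du with <-cmp i m
  ... | tri< i<m i≢ _ = inj₂ (linear (row lam i ∷ p ∷ q ∷ i ∷ m′ ∷ d ∷ a′ ∷ [])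
        (1+ (# 0 ⊕ # 1) ≃ # 2 ⊕ # 3 ∷ # 2 ⊕ 1+ # 4 ≃ # 1 ⊕ # 5 ∷ 1+ # 3 ≼ 1+ # 4 ∷ 1+ # 6 ≼ # 0 ∷ [])
        (1+ 1+ 1+ # 6 ≼ # 5) (e , Du , i<m , a≤row 1≤i (<⇒≤ i<m)) , i , 1≤i , linear
            (row lam i ∷ p ∷ q ∷ i ∷ row mu i ∷ [])
        (1+ (# 0 ⊕ # 1) ≃ # 2 ⊕ # 3 ∷ # 4 ≃ # 0 ∷ [])
        (1+ (# 4 ⊕ # 1) ≃ # 2 ⊕ # 3) (e , rowμ i i≢))
  ... | tri≈ _ refl _ = inj₁ (linear (row lam (suc m′) ∷ p ∷ q ∷ m′ ∷ d ∷ a′ ∷ [])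
        (1+ (# 0 ⊕ # 1) ≃ # 2 ⊕ 1+ # 3 ∷ # 2 ⊕ 1+ # 3 ≃ # 1 ⊕ # 4 ∷ # 0 ≃ 1+ # 5 ∷ [])
        (# 4 ≃ 1+ 1+ # 5) (e , Du , row-m))
  ... | tri> _ _ i>m  = ⊥-elim (inconsistent (row lam i ∷ p ∷ q ∷ i ∷ m′ ∷ [])
        (1+ (# 0 ⊕ # 1) ≃ # 2 ⊕ # 3 ∷ 1+ 1+ # 4 ≼ # 3 ∷ # 1 ≼ 1+ # 4 ∷ κ 1 ≼ # 2 ∷ # 0 ≃ κ 0 ∷ [])
        (e , i>m , row≤m u∈ , 1≤q , beyond i i>m))

  Vμ⇒ : ∀ {u d} → u ∈Y mu → Vertical mu u → D u d → (d ≡ a) ⊎ (suc a < d × Vertical lam u)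
  Vμ⇒ {p , q} {d} u∈@(_ , 1≤q , _) (i , 1≤i , e) Du with <-cmp i m
  ... | tri< i<m i≢ _ = inj₂ (linear (row mu i ∷ p ∷ q ∷ i ∷ m′ ∷ d ∷ a′ ∷ [])
        (1+ (# 0 ⊕ # 1) ≃ # 2 ⊕ # 3 ∷ # 2 ⊕ 1+ # 4 ≃ # 1 ⊕ # 5 ∷ 1+ # 3 ≼ 1+ # 4 ∷ 1+ # 6 ≼ # 0 ∷ [])
        (1+ 1+ 1+ # 6 ≼ # 5) (e , Du , i<m , a≤rowμ 1≤i i<m) , i , 1≤i , linear (row mu i ∷ p ∷ q ∷ i ∷ row lam i ∷ [])
        (1+ (# 0 ⊕ # 1) ≃ # 2 ⊕ # 3 ∷ # 0 ≃ # 4 ∷ [])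
        (1+ (# 4 ⊕ # 1) ≃ # 2 ⊕ # 3) (e , rowμ i i≢))
  ... | tri≈ _ refl _ = inj₁ (linear (row mu (suc m′) ∷ p ∷ q ∷ m′ ∷ d ∷ a′ ∷ [])
        (1+ (# 0 ⊕ # 1) ≃ # 2 ⊕ 1+ # 3 ∷ # 2 ⊕ 1+ # 3 ≃ # 1 ⊕ # 4 ∷ # 0 ≃ # 5 ∷ [])
        (# 4 ≃ 1+ # 5) (e , Du , rowμ-m))
  ... | tri> _ i≢ i>m  = ⊥-elim (inconsistent (row mu i ∷ p ∷ q ∷ i ∷ m′ ∷ row lam i ∷ [])
        (1+ (# 0 ⊕ # 1) ≃ # 2 ⊕ # 3 ∷ 1+ 1+ # 4 ≼ # 3 ∷ # 1 ≼ 1+ # 4 ∷ κ 1 ≼ # 2 ∷ # 5 ≃ κ 0 ∷ # 0 ≃ # 5 ∷ [])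
        (e , i>m , row≤m (μ⊆λ u∈) , 1≤q , beyond i i>m , rowμ i i≢))

  Vλ-diag : ∀ {u} → D u (suc a) → Vertical lam u
  Vλ-diag {p , q} Du = m , s≤s z≤n , linear (q ∷ m′ ∷ p ∷ a′ ∷ row lam (suc m′) ∷ [])
        (# 0 ⊕ 1+ # 1 ≃ # 2 ⊕ 1+ 1+ # 3 ∷ # 4 ≃ 1+ # 3 ∷ [])
        (1+ (# 4 ⊕ # 2) ≃ # 0 ⊕ 1+ # 1) (Du , row-m)

  Vμ-diag : ∀ {u} → D u a → Vertical mu u
  Vμ-diag {p , q} Du = m , s≤s z≤n , linear (q ∷ m′ ∷ p ∷ a′ ∷ row mu (suc m′) ∷ [])
        (# 0 ⊕ 1+ # 1 ≃ # 2 ⊕ 1+ # 3 ∷ # 4 ≃ # 3 ∷ [])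
        (1+ (# 4 ⊕ # 2) ≃ # 0 ⊕ 1+ # 1) (Du , rowμ-m)

  nextλ-low : ∀ π {u d} → u ∈Y lam → D u d → d ≤ a → next lam π u ≡ wC u
  nextλ-low π {u} u∈ Du d≤a = Sλ.next-horizontal π u∈ λ v → absurd (Vλ⇒ u∈ v Du)
    where
    absurd : _ → ⊥
    absurd (inj₁ refl)    = <-irrefl refl d≤a
    absurd (inj₂ (l , _)) = <⇒≱ (<-trans ≤-refl l) d≤a

  nextμ-low : ∀ ρ {u d} → u ∈Y mu → D u d → d < a → next mu ρ u ≡ wC u
  nextμ-low ρ {u} u∈ Du d<a = Sμ.next-horizontal ρ u∈ λ v → absurd (Vμ⇒ u∈ v Du)
    where
    absurd : _ → ⊥
    absurd (inj₁ refl)    = <-irrefl refl d<a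
    absurd (inj₂ (l , _)) = <⇒≱ (<-trans ≤-refl l) (<⇒≤ d<a)

  nextμ-diag : ∀ ρ {u} → u ∈Y mu → D u (suc a) → next mu ρ u ≡ wC u
  nextμ-diag ρ {u} u∈ Du = Sμ.next-horizontal ρ u∈ λ v → absurd (Vμ⇒ u∈ v Du)
    where
    absurd : _ → ⊥
    absurd (inj₁ ())
    absurd (inj₂ (l , _)) = <-irrefl refl l

  -- A choice on a diagonal `d > a + 1` reads entries of the diagonals `d` and `d − 1` only, both
  -- off the diagonal of x.
  next-agree : ∀ {π ρ u d} → Off π ρ → u ∈Y mu → D u d → suc a < d → next lam π u ≡ next mu ρ u
  next-agree {π} {ρ} {u} {d} off u∈ Du lt with Sλ.vertical? u (μ⊆λ u∈)
  ... | no ¬v = trans (Sλ.next-horizontal π (μ⊆λ u∈) ¬v) (sym (Sμ.next-horizontal ρ u∈ λ v → absurd (Vμ⇒ u∈ v Du)))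
    where
    absurd : _ → ⊥
    absurd (inj₁ refl)    = <-asym lt ≤-refl
    absurd (inj₂ (_ , v)) = ¬v v
  ... | yes v with Vλ⇒ (μ⊆λ u∈) v Du
  ...   | inj₁ refl = ⊥-elim (<-irrefl refl lt)
  ...   | inj₂ (_ , vμ) with π u ≟ π (sC u)
  ...     | yes e = trans (Sλ.next-south π (μ⊆λ u∈) v e)
              (sym (Sμ.next-south ρ u∈ vμ (trans (sym πu) (trans e πsu))))
    where
    πu : π u ≡ ρ u
    πu = off u u∈ λ Da → inconsistent (d ∷ a′ ∷ [])
          (# 0 ≃ 1+ # 1 ∷ 1+ 1+ 1+ # 1 ≼ # 0 ∷ [])
          (D-unique {u} Du Da , lt)
    πsu : π (sC u) ≡ ρ (sC u)
    πsu = off (sC u) (south-inside partμ u∈ vμ) λ Da → inconsistent (proj₂ u ∷ m′ ∷ proj₁ u ∷ d ∷ a′ ∷ [])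
          (# 0 ⊕ 1+ # 1 ≃ # 2 ⊕ # 3 ∷ # 0 ⊕ 1+ # 1 ≃ 1+ (# 2 ⊕ 1+ # 4) ∷ 1+ 1+ 1+ # 4 ≼ # 3 ∷ [])
          (Du , Da , lt)
  ...     | no ≢ = trans (Sλ.next-west π (μ⊆λ u∈) v ≢)
              (sym (Sμ.next-west ρ u∈ vμ λ e → ≢ (trans πu (trans e (sym πsu)))))
    where
    πu : π u ≡ ρ u
    πu = off u u∈ λ Da → inconsistent (d ∷ a′ ∷ [])
          (# 0 ≃ 1+ # 1 ∷ 1+ 1+ 1+ # 1 ≼ # 0 ∷ [])
          (D-unique {u} Du Da , lt)
    πsu : π (sC u) ≡ ρ (sC u)
    πsu = off (sC u) (south-inside partμ u∈ vμ) λ Da → inconsistent (proj₂ u ∷ m′ ∷ proj₁ u ∷ d ∷ a′ ∷ [])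
          (# 0 ⊕ 1+ # 1 ≃ # 2 ⊕ # 3 ∷ # 0 ⊕ 1+ # 1 ≃ 1+ (# 2 ⊕ 1+ # 4) ∷ 1+ 1+ 1+ # 4 ≼ # 3 ∷ [])
          (Du , Da , lt)

  conjλ-low : ∀ {j} → 1 ≤ j → j ≤ a → conj lam j ≡ m
  conjλ-low 1≤j j≤a = ≤-antisym (conj-≤ part λ i 1≤i j≤r → row≤m (1≤i , 1≤j , j≤r))
    (j≤row⇒i≤conj part (s≤s z≤n) 1≤j (≤-trans j≤a (≤-reflexive (sym row-m))))

  conjμ-low : ∀ {j} → 1 ≤ j → j < a → conj mu j ≡ m
  conjμ-low 1≤j j<a = ≤-antisym (conj-≤ partμ λ i 1≤i j≤r → row≤m (μ⊆λ (1≤i , 1≤j , j≤r)))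
    (j≤row⇒i≤conj partμ (s≤s z≤n) 1≤j (≤-trans (≤-pred j<a) (≤-reflexive (sym rowμ-m))))

  conjμ-a : conj mu a ≡ m′
  conjμ-a = ≤-antisym (conj-≤ partμ upper) (lower m′ ≤-refl)
    where
    upper : ∀ i → 1 ≤ i → a ≤ row mu i → i ≤ m′
    upper i 1≤i a≤r with m≤n⇒m<n∨m≡n (row≤m (μ⊆λ {i , a} (1≤i , s≤s z≤n , a≤r)))
    ... | inj₁ i<m  = ≤-pred i<m
    ... | inj₂ refl = ⊥-elim (x∉μ (1≤i , s≤s z≤n , a≤r))
    lower : ∀ k → k ≤ m′ → k ≤ conj mu a
    lower zero    _  = z≤n
    lower (suc k) le = j≤row⇒i≤conj partμ (s≤s z≤n) (s≤s z≤n) (a≤rowμ (s≤s z≤n) (s≤s le))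

  conj-high : ∀ {j} → a < j → conj mu j ≡ conj lam j
  conj-high {j} a<j = ≤-antisym
    (conj-≤ partμ λ i 1≤i j≤r → j≤row⇒i≤conj part 1≤i 1≤j (proj₂ (proj₂ (μ⊆λ {i , j} (1≤i , 1≤j , j≤r)))))
    (conj-≤ part below)
    where
    1≤j : 1 ≤ j
    1≤j = ≤-trans (s≤s z≤n) a<j
    below : ∀ i → 1 ≤ i → j ≤ row lam i → i ≤ conj mu j
    below i 1≤i j≤r with λ⇒μ {i , j} (1≤i , 1≤j , j≤r)
    ... | inj₁ refl = ⊥-elim (<-irrefl refl a<j)
    ... | inj₂ (_ , _ , j≤rμ) = j≤row⇒i≤conj partμ 1≤i 1≤j j≤rμ

  conj-high≤ : ∀ {j} → a < j → conj lam j ≤ m′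
  conj-high≤ {j} a<j = conj-≤ part below
    where
    below : ∀ i → 1 ≤ i → j ≤ row lam i → i ≤ m′
    below i 1≤i j≤r with m≤n⇒m<n∨m≡n (row≤m {i} {j} (1≤i , ≤-trans (s≤s z≤n) a<j , j≤r))
    ... | inj₁ i<m  = ≤-pred i<m
    ... | inj₂ refl = ⊥-elim (inconsistent (a′ ∷ j ∷ row lam (suc m′) ∷ [])
          (1+ 1+ # 0 ≼ # 1 ∷ # 1 ≼ # 2 ∷ # 2 ≃ 1+ # 0 ∷ [])
          (a<j , j≤r , row-m))

  module _ {kap : List ℕ} {π : Filling} {u : Cell} {d₀ : ℕ}
    (inside : PathInside kap u π) (D₀ : D (hookTail kap u) d₀) where

    position-D : ∀ e {d} → e ≤ suc (hookLen kap u) → e + d ≡ d₀ → D (HookPosition kap u π e) d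
    position-D e {d} e≤ eq = linear (proj₂ (HookPosition kap u π e) ∷ m′ ∷ e ∷ proj₁ (HookPosition kap u π e) ∷
        d₀ ∷ d ∷ [])
          ((# 0 ⊕ 1+ # 1) ⊕ # 2 ≃ # 3 ⊕ # 4 ∷ # 2 ⊕ # 5 ≃ # 4 ∷ [])
          (# 0 ⊕ 1+ # 1 ≃ # 3 ⊕ # 5) (position-diagonal kap π (hookTail kap u) m d₀ D₀ e
            (λ e′ lt → inside e′ (≤-pred (≤-trans lt e≤))) , eq)

    -- Contents drop by one per step, so a path meets a diagonal at most once and the diagonal
    -- dictates the step number.
    position-step : ∀ {v d} → D v d → ∀ e → e ≤ hookLen kap u → v ≡ HookPosition kap u π e → e + d ≡ d₀
    position-step {d = d} Dv e e≤ refl = linear (proj₂ (HookPosition kap u π e) ∷ m′ ∷ e ∷ proj₁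
        (HookPosition kap u π e) ∷ d₀ ∷ d ∷ [])
          ((# 0 ⊕ 1+ # 1) ⊕ # 2 ≃ # 3 ⊕ # 4 ∷ # 0 ⊕ 1+ # 1 ≃ # 3 ⊕ # 5 ∷ [])
          (# 2 ⊕ # 5 ≃ # 4) (position-diagonal kap π (hookTail kap u) m d₀ D₀ e
            (λ e′ lt → inside e′ (≤-trans (<⇒≤ lt) e≤)) , Dv)

    untouched : ∀ {v d} → D v d → (∀ e → e ≤ hookLen kap u → e + d ≡ d₀ → v ≢ HookPosition kap u π e) →
      insertHook kap u π v ≡ π v
    untouched {v} Dv h = insert-off kap u π v λ { (e , e≤ , eq) → h e e≤ (position-step Dv e e≤ eq) eq }

    touched : ∀ e → e ≤ hookLen kap u → insertHook kap u π (HookPosition kap u π e) ≡ suc (π (HookPosition kap u π e))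
    touched e e≤ = insert-on kap u π _ (e , e≤ , refl)

    untouched-at : ∀ {v d} → D v d → ∀ e → e + d ≡ d₀ → v ≢ HookPosition kap u π e → insertHook kap u π v ≡ π v
    untouched-at {v} {d} Dv e eq ≢ = untouched Dv λ e′ _ eq′ v≡ →
      ≢ (subst (λ k → v ≡ HookPosition kap u π k) (+-cancelʳ-≡ d e′ e (trans eq′ (sym eq))) v≡)

    -- A hook crossing the diagonals d and d − 1 by a step west keeps them equal.
    tie-preserved : ∀ {d e} → e + suc d ≡ d₀ → suc e ≤ hookLen kap u →
      HookPosition kap u π (suc e) ≡ wC (HookPosition kap u π e) →
      (∀ w → w ∈Y kap → D w (suc d) → π w ≡ ext π (wC w)) →
      ∀ w → w ∈Y kap → D w (suc d) → insertHook kap u π w ≡ ext (insertHook kap u π) (wC w)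
    tie-preserved {d} {e} eq e< west tie w w∈ Dw with w ≟C HookPosition kap u π e
    ... | yes refl = trans (touched e (<⇒≤ e<)) (trans (cong suc (trans (tie w w∈ Dw) (ext-inside π ww∈)))
            (trans (sym (trans (cong (insertHook kap u π) (sym west))
              (trans (touched (suc e) e<) (cong (suc ∘ π) west))))
              (sym (ext-inside (insertHook kap u π) ww∈))))
      where
      ww∈ : wC w ∈Y kap
      ww∈ = subst (_∈Y kap) west (inside (suc e) e<)
    tie-preserved {d} {e} eq e< west tie (suc p , suc zero) w∈ Dw | no w≢ =
      trans (untouched-at Dw e eq w≢) (tie _ w∈ Dw)
    tie-preserved {d} {e} eq e< west tie w@(suc p , suc (suc q)) w∈ Dw | no w≢ =
      trans (untouched-at Dw e eq w≢) (trans (tie w w∈ Dw) (sym (untouched-at {d = d} (linear (q ∷ m′ ∷ p ∷ d ∷ [])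
            (1+ 1+ (# 0 ⊕ 1+ # 1) ≃ 1+ (# 2 ⊕ 1+ # 3) ∷ [])
            (1+ (# 0 ⊕ 1+ # 1) ≃ 1+ (# 2 ⊕ # 3)) Dw) (suc e) (linear (e ∷ d ∷ d₀ ∷ [])
            (# 0 ⊕ 1+ # 1 ≃ # 2 ∷ [])
            (1+ (# 0 ⊕ # 1) ≃ # 2) eq) ≢′)))
      where
      Dpos : D (HookPosition kap u π e) (suc d)
      Dpos = position-D e (m≤n⇒m≤1+n (<⇒≤ e<)) eq
      -- A west step keeps the row: hitting the west neighbour of `w` would mean having hit `w` just
      -- before.
      ≢′ : (suc p , suc q) ≢ HookPosition kap u π (suc e)
      ≢′ eq′ = w≢ (D-row {w} {HookPosition kap u π e} Dw Dpos (trans (cong proj₁ eq′) (cong proj₁ west)))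

  D-exists : ∀ {w} → w ∈Y lam → ∃ λ d → D w d
  D-exists {p , q} w∈ = q + (m ∸ p) , linear (suc m′ ∸ p ∷ p ∷ m′ ∷ q ∷ [])
        (# 0 ⊕ # 1 ≃ 1+ # 2 ∷ [])
        (# 3 ⊕ 1+ # 2 ≃ # 1 ⊕ (# 3 ⊕ # 0)) (m∸n+n≡m (row≤m w∈))

  -- The two paths may differ in length and in their cell on the diagonal of x, so the comparison is
  -- requested for `d ≢ a` only.
  off-preserved : ∀ {π ρ u d₀} → Off π ρ → PathInside lam u π → PathInside mu u ρ →
    D (hookTail lam u) d₀ → D (hookTail mu u) d₀ →
    (∀ e d → e + d ≡ d₀ → d ≢ a → e ≤ hookLen lam u → e ≤ hookLen mu u) →
    (∀ e d → e + d ≡ d₀ → d ≢ a → e ≤ hookLen mu u → e ≤ hookLen lam u × HookPosition lam u π e ≡ HookPosition mu u ρ e) →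
    Off (insertHook lam u π) (insertHook mu u ρ)
  off-preserved {π} {ρ} {u} {d₀} off insλ insμ Dλ Dμ short agree w w∈ ¬D with D-exists (μ⊆λ w∈)
  ... | d , Dw = insert-agree {lam} {mu} {u} {u} {π} {ρ} {w} (off w w∈ ¬D) to from
    where
    d≢a : d ≢ a
    d≢a refl = ¬D Dw
    to : OnHook lam u π w → OnHook mu u ρ w
    to (e , e≤ , eq) = e , short e d eqd d≢a e≤ , trans eq (proj₂ (agree e d eqd d≢a (short e d eqd d≢a e≤)))
      where eqd = position-step insλ Dλ Dw e e≤ eq
    from : OnHook mu u ρ w → OnHook lam u π w
    from (e , e≤ , eq) = e , proj₁ (agree e d eqd d≢a e≤) , trans eq (sym (proj₂ (agree e d eqd d≢a e≤)))
      where eqd = position-step insμ Dμ Dw e e≤ eq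

  -- The coordinate `d` of the last cell of row `i`, where every hook of that row begins; for
  -- `i < m` it is the same in μ.
  start : ℕ → ℕ
  start i = row lam i + (m ∸ i)

  D-tailλ : ∀ {i} j → i ≤ m → D (hookTail lam (i , j)) (start i)
  D-tailλ {i} j i≤m = linear (suc m′ ∸ i ∷ i ∷ m′ ∷ row lam i ∷ [])
        (# 0 ⊕ # 1 ≃ 1+ # 2 ∷ [])
        (# 3 ⊕ 1+ # 2 ≃ # 1 ⊕ (# 3 ⊕ # 0)) (m∸n+n≡m i≤m)

  D-tailμ : ∀ {i} j → i < m → D (hookTail mu (i , j)) (start i)
  D-tailμ {i} j i<m = linear (suc m′ ∸ i ∷ i ∷ m′ ∷ row mu i ∷ row lam i ∷ [])
        (# 0 ⊕ # 1 ≃ 1+ # 2 ∷ # 3 ≃ # 4 ∷ [])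
        (# 3 ⊕ 1+ # 2 ≃ # 1 ⊕ (# 4 ⊕ # 0)) (m∸n+n≡m (<⇒≤ i<m) , rowμ i (<⇒≢ i<m))

  start≥ : ∀ {i} → 1 ≤ i → i < m → suc a ≤ start i
  start≥ {i} 1≤i i<m = linear (a′ ∷ row lam i ∷ suc m′ ∸ i ∷ i ∷ m′ ∷ [])
        (1+ # 0 ≼ # 1 ∷ # 2 ⊕ # 3 ≃ 1+ # 4 ∷ 1+ # 3 ≼ 1+ # 4 ∷ [])
        (1+ 1+ # 0 ≼ # 1 ⊕ # 2) (a≤row 1≤i (<⇒≤ i<m) , m∸n+n≡m (<⇒≤ i<m) , i<m)

  -- The step into the diagonal `a + 1` is still decided on `a + 2`, where `next-agree` applies;
  -- hence the weak bound on `d`.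
  agree-above : ∀ {π ρ i j} → i < m → Off π ρ → PathInside mu (i , j) ρ → ∀ e d → e ≤ hookLen mu (i , j) →
    e + d ≡ start i → suc a ≤ d → HookPosition lam (i , j) π e ≡ HookPosition mu (i , j) ρ e
  agree-above {i = i} i<m off ins zero d e≤ eq lt = cong (i ,_) (sym (rowμ i (<⇒≢ i<m)))
  agree-above {π} {ρ} {i} {j} i<m off ins (suc e) d e≤ eq lt =
    trans (cong (next lam π) (agree-above i<m off ins e (suc d) (<⇒≤ e≤) (trans (+-suc e d) eq) (m≤n⇒m≤1+n lt)))
      (next-agree {ρ = ρ} off (ins e (<⇒≤ e≤)) (position-D ins (D-tailμ j i<m) e (m≤n⇒m≤1+n (<⇒≤ e≤))
          (trans (+-suc e d) eq)) (s≤s lt))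

  -- Columns left of x

  -- The state while the hooks of the columns left of x are inserted.
  record Tied (π ρ : Filling) : Set where
    field
      off  : Off π ρ
      tieλ : ∀ w → w ∈Y lam → D w a → π w ≡ ext π (wC w)
      tieμ : ∀ w → w ∈Y mu → D w (suc a) → ρ w ≡ ext ρ (wC w)

  -- On the diagonals `a + 1` and `a`, the λ-path chooses first and then goes west, while the μ-path
  -- goes west first and then chooses. Once the choices are seen to coincide, the paths can differ
  -- only at step `suc e₁`, on the diagonal of x, and rejoin afterwards.
  module LeftUpper {π ρ : Filling} (tied : Tied π ρ) {i j : ℕ} (1≤i : 1 ≤ i) (i<m : i < m) (1≤j : 1 ≤ j) (j<a : j < a)
    (ins : PathInside mu (i , j) ρ) where
    open Tied tied

    u : Cell
    u = (i , j)

    u∈μ : u ∈Y mu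
    u∈μ = 1≤i , 1≤j , ≤-trans (<⇒≤ j<a) (a≤rowμ 1≤i i<m)

    L : ℕ
    L = hookLen mu u

    len≡ : hookLen lam u ≡ L
    len≡ = linear (conj lam j ∸ i ∷ row lam i ∸ j ∷ i ∷ j ∷ conj lam j ∷ row lam i ∷ conj mu j ∸ i ∷
        row mu i ∸ j ∷ conj mu j ∷ row mu i ∷ m′ ∷ [])
          ((# 0 ⊕ # 1) ⊕ (# 2 ⊕ # 3) ≃ # 4 ⊕ # 5 ∷ (# 6 ⊕ # 7) ⊕ (# 2 ⊕ # 3) ≃ # 8 ⊕ # 9 ∷ # 4 ≃ 1+ # 10 ∷
            # 8 ≃ 1+ # 10 ∷ # 9 ≃ # 5 ∷ [])
          (# 0 ⊕ # 1 ≃ # 6 ⊕ # 7) (hookLen-sum part (μ⊆λ u∈μ) , hookLen-sum partμ u∈μ , conjλ-low 1≤j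
            (<⇒≤ j<a) , conjμ-low 1≤j j<a , rowμ i (<⇒≢ i<m))

    e₁ : ℕ
    e₁ = start i ∸ suc a

    e₁-eq : e₁ + suc a ≡ start i
    e₁-eq = m∸n+n≡m (start≥ 1≤i i<m)

    -- The path ends on the diagonal `j < a`, at least two steps after it stood on `a + 1`.
    L≥ : suc (suc e₁) ≤ L
    L≥ = linear (start i ∸ suc a ∷ a′ ∷ row lam i ∷ m ∸ i ∷ conj mu j ∸ i ∷ row mu i ∸ j ∷ i ∷ j ∷ conj mu j ∷
        row mu i ∷ m′ ∷ [])
          (# 0 ⊕ 1+ 1+ # 1 ≃ # 2 ⊕ # 3 ∷ (# 4 ⊕ # 5) ⊕ (# 6 ⊕ # 7) ≃ # 8 ⊕ # 9 ∷ # 8 ≃ 1+ # 10 ∷ # 9 ≃ # 2 ∷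
            1+ # 7 ≼ 1+ # 1 ∷ # 3 ⊕ # 6 ≃ 1+ # 10 ∷ [])
          (1+ 1+ # 0 ≼ # 4 ⊕ # 5) (e₁-eq , hookLen-sum partμ u∈μ , conjμ-low 1≤j j<a , rowμ i (<⇒≢ i<m) , j<a ,
            m∸n+n≡m (<⇒≤ i<m))

    P Q : ℕ → Cell
    P = HookPosition lam u π
    Q = HookPosition mu u ρ

    above : ∀ e → e ≤ e₁ → P e ≡ Q e
    above e e≤ = agree-above i<m off ins e (suc a + (e₁ ∸ e)) (linear (e ∷ e₁ ∷ conj mu j ∸ i ∷ row mu i ∸ j ∷ [])
          (# 0 ≼ # 1 ∷ 1+ 1+ # 1 ≼ # 2 ⊕ # 3 ∷ [])
          (# 0 ≼ # 2 ⊕ # 3) (e≤ , L≥)) (linear (start i ∸ suc a ∸ e ∷ e ∷ e₁ ∷ a′ ∷ row lam i ∷ m ∸ i ∷ [])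
          (# 0 ⊕ # 1 ≃ # 2 ∷ # 2 ⊕ 1+ 1+ # 3 ≃ # 4 ⊕ # 5 ∷ [])
          (# 1 ⊕ 1+ 1+ (# 3 ⊕ # 0) ≃ # 4 ⊕ # 5) (m∸n+n≡m e≤ , e₁-eq)) (m≤m+n _ _)

    Q∈ : ∀ e → e ≤ L → Q e ∈Y mu
    Q∈ = ins

    DQ : ∀ e {d} → e ≤ L → e + d ≡ start i → D (Q e) d
    DQ e e≤ = position-D ins (D-tailμ j i<m) e (m≤n⇒m≤1+n e≤)

    Q₁ : Q (suc e₁) ≡ wC (Q e₁)
    Q₁ = nextμ-diag ρ (Q∈ e₁ (linear (start i ∸ suc a ∷ conj mu j ∸ i ∷ row mu i ∸ j ∷ [])
          (1+ 1+ # 0 ≼ # 1 ⊕ # 2 ∷ [])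
          (# 0 ≼ # 1 ⊕ # 2) L≥)) (DQ e₁ (linear (start i ∸ suc a ∷ conj mu j ∸ i ∷ row mu i ∸ j ∷ [])
          (1+ 1+ # 0 ≼ # 1 ⊕ # 2 ∷ [])
          (# 0 ≼ # 1 ⊕ # 2) L≥) e₁-eq)

    -- λ compares `y` with `sC y`, and μ compares `wC y` with its south neighbour. The upper entries
    -- agree by `tieμ` and the lower ones by `tieλ`.
    crossing : ∀ y → y ∈Y mu → D y (suc a) → wC y ∈Y mu → D (wC y) a →
      next lam π y ∈Y lam × D (next lam π y) a × next mu ρ (wC y) ≡ wC (next lam π y)
    crossing y@(suc p , suc (suc q)) y∈ Dy wy∈ Dwy with π y ≟ π (sC y)
    ... | yes e = subst (λ v → v ∈Y lam × D v a × next mu ρ (wC y) ≡ wC v)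
        (sym (Sλ.next-south π (μ⊆λ y∈) (Vλ-diag Dy) e))
        (sy∈ , linear (q ∷ m′ ∷ p ∷ a′ ∷ [])
              (1+ 1+ (# 0 ⊕ 1+ # 1) ≃ 1+ (# 2 ⊕ 1+ 1+ # 3) ∷ [])
              (1+ 1+ (# 0 ⊕ 1+ # 1) ≃ 1+ 1+ (# 2 ⊕ 1+ # 3)) Dy , Sμ.next-south ρ wy∈ (Vμ-diag Dwy)
                (trans (sym (tieμ y y∈ Dy)) (trans (sym πy) (trans e (trans (tieλ _ sy∈ (linear (q ∷ m′ ∷ p ∷ a′ ∷ [])
              (1+ 1+ (# 0 ⊕ 1+ # 1) ≃ 1+ (# 2 ⊕ 1+ 1+ # 3) ∷ [])
              (1+ 1+ (# 0 ⊕ 1+ # 1) ≃ 1+ 1+ (# 2 ⊕ 1+ # 3)) Dy)) πswy)))))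
      where
      sy∈ = south-inside part (μ⊆λ y∈) (Vλ-diag Dy)
      πy : π y ≡ ρ y
      πy = off y y∈ λ Da → inconsistent (q ∷ m′ ∷ p ∷ a′ ∷ [])
            (1+ 1+ (# 0 ⊕ 1+ # 1) ≃ 1+ (# 2 ⊕ 1+ 1+ # 3) ∷ 1+ 1+ (# 0 ⊕ 1+ # 1) ≃ 1+ (# 2 ⊕ 1+ # 3) ∷ [])
            (Dy , Da)
      πswy : π (sC (wC y)) ≡ ρ (sC (wC y))
      πswy = off _ (diag-south wy∈ Dwy) λ Da → inconsistent (q ∷ m′ ∷ p ∷ a′ ∷ [])
            (1+ 1+ (# 0 ⊕ 1+ # 1) ≃ 1+ (# 2 ⊕ 1+ 1+ # 3) ∷ 1+ (# 0 ⊕ 1+ # 1) ≃ 1+ 1+ (# 2 ⊕ 1+ # 3) ∷ [])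
            (Dy , Da)
    ... | no ≢ = subst (λ v → v ∈Y lam × D v a × next mu ρ (wC y) ≡ wC v) (sym (Sλ.next-west π (μ⊆λ y∈) (Vλ-diag Dy) ≢))
        (μ⊆λ wy∈ , Dwy , Sμ.next-west ρ wy∈ (Vμ-diag Dwy)
          (λ e → ≢ (trans πy (trans (tieμ y y∈ Dy) (trans e
            (trans (sym πswy) (sym (tieλ _ sy∈ (linear (q ∷ m′ ∷ p ∷ a′ ∷ [])
                (1+ 1+ (# 0 ⊕ 1+ # 1) ≃ 1+ (# 2 ⊕ 1+ 1+ # 3) ∷ [])
                (1+ 1+ (# 0 ⊕ 1+ # 1) ≃ 1+ 1+ (# 2 ⊕ 1+ # 3)) Dy)))))))))
      where
      sy∈ = south-inside part (μ⊆λ y∈) (Vλ-diag Dy)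
      πy : π y ≡ ρ y
      πy = off y y∈ λ Da → inconsistent (q ∷ m′ ∷ p ∷ a′ ∷ [])
            (1+ 1+ (# 0 ⊕ 1+ # 1) ≃ 1+ (# 2 ⊕ 1+ 1+ # 3) ∷ 1+ 1+ (# 0 ⊕ 1+ # 1) ≃ 1+ (# 2 ⊕ 1+ # 3) ∷ [])
            (Dy , Da)
      πswy : π (sC (wC y)) ≡ ρ (sC (wC y))
      πswy = off _ (diag-south wy∈ Dwy) λ Da → inconsistent (q ∷ m′ ∷ p ∷ a′ ∷ [])
            (1+ 1+ (# 0 ⊕ 1+ # 1) ≃ 1+ (# 2 ⊕ 1+ 1+ # 3) ∷ 1+ (# 0 ⊕ 1+ # 1) ≃ 1+ 1+ (# 2 ⊕ 1+ # 3) ∷ [])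
            (Dy , Da)
    crossing (suc p , suc zero) y∈ Dy (_ , () , _) Dwy

    crossed : next lam π (Q e₁) ∈Y lam × D (next lam π (Q e₁)) a × next mu ρ (wC (Q e₁)) ≡ wC (next lam π (Q e₁))
    crossed = crossing (Q e₁) (Q∈ e₁ (linear (start i ∸ suc a ∷ conj mu j ∸ i ∷ row mu i ∸ j ∷ [])
          (1+ 1+ # 0 ≼ # 1 ⊕ # 2 ∷ [])
          (# 0 ≼ # 1 ⊕ # 2) L≥)) (DQ e₁ (linear (start i ∸ suc a ∷ conj mu j ∸ i ∷ row mu i ∸ j ∷ [])
          (1+ 1+ # 0 ≼ # 1 ⊕ # 2 ∷ [])
          (# 0 ≼ # 1 ⊕ # 2) L≥) e₁-eq)
      (subst (_∈Y mu) Q₁ (Q∈ (suc e₁) (linear (start i ∸ suc a ∷ conj mu j ∸ i ∷ row mu i ∸ j ∷ [])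
            (1+ 1+ # 0 ≼ # 1 ⊕ # 2 ∷ [])
            (1+ # 0 ≼ # 1 ⊕ # 2) L≥)))
      (subst (λ y → D y a) Q₁ (DQ (suc e₁) {a} (linear (start i ∸ suc a ∷ conj mu j ∸ i ∷ row mu i ∸ j ∷ [])
            (1+ 1+ # 0 ≼ # 1 ⊕ # 2 ∷ [])
            (1+ # 0 ≼ # 1 ⊕ # 2) L≥) (linear (start i ∸ suc a ∷ a′ ∷ row lam i ∷ m ∸ i ∷ [])
            (# 0 ⊕ 1+ 1+ # 1 ≃ # 2 ⊕ # 3 ∷ [])
            (1+ (# 0 ⊕ 1+ # 1) ≃ # 2 ⊕ # 3) e₁-eq)))

    P₁ : P (suc e₁) ≡ next lam π (Q e₁)
    P₁ = cong (next lam π) (above e₁ ≤-refl)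

    P₁∈ : P (suc e₁) ∈Y lam
    P₁∈ = subst (_∈Y lam) (sym P₁) (proj₁ crossed)

    P₂ : P (2 + e₁) ≡ wC (P (suc e₁))
    P₂ = nextλ-low π P₁∈ (subst (λ y → D y a) (sym P₁) (proj₁ (proj₂ crossed))) ≤-refl

    P₂≡Q₂ : P (2 + e₁) ≡ Q (2 + e₁)
    P₂≡Q₂ = trans P₂ (trans (cong wC P₁) (trans (sym (proj₂ (proj₂ crossed))) (cong (next mu ρ) (sym Q₁))))

    below : ∀ k → k + (2 + e₁) ≤ L → P (k + (2 + e₁)) ≡ Q (k + (2 + e₁))
    below zero    _  = P₂≡Q₂
    below (suc k) le = trans (cong (next lam π) (below k (<⇒≤ le)))
      (trans (nextλ-low π (μ⊆λ Q∈′) DQ′ (<⇒≤ d<a)) (sym (nextμ-low ρ Q∈′ DQ′ d<a)))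
      where
      e = k + (2 + e₁)
      Q∈′ = Q∈ e (<⇒≤ le)
      d = start i ∸ e
      e≤start : e ≤ start i
      e≤start = linear (k ∷ start i ∸ suc a ∷ conj mu j ∸ i ∷ row mu i ∸ j ∷ i ∷ j ∷ conj mu j ∷ row mu i ∷ m′ ∷
          row lam i ∷ suc m′ ∸ i ∷ [])
            (1+ (# 0 ⊕ 1+ 1+ # 1) ≼ # 2 ⊕ # 3 ∷ (# 2 ⊕ # 3) ⊕ (# 4 ⊕ # 5) ≃ # 6 ⊕ # 7 ∷ # 6 ≃ 1+ # 8 ∷
              # 7 ≃ # 9 ∷ # 10 ⊕ # 4 ≃ 1+ # 8 ∷ [])
            (# 0 ⊕ 1+ 1+ # 1 ≼ # 9 ⊕ # 10) (le , hookLen-sum partμ u∈μ , conjμ-low 1≤j j<a , rowμ i (<⇒≢ i<m) ,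
              m∸n+n≡m (<⇒≤ i<m))
      DQ′ : D (Q e) d
      DQ′ = DQ e (<⇒≤ le) (m+[n∸m]≡n e≤start)
      d<a : d < a
      d<a = linear (k ∷ start i ∸ suc a ∷ start i ∸ e ∷ row lam i ∷ m ∸ i ∷ a′ ∷ [])
            ((# 0 ⊕ 1+ 1+ # 1) ⊕ # 2 ≃ # 3 ⊕ # 4 ∷ # 1 ⊕ 1+ 1+ # 5 ≃ # 3 ⊕ # 4 ∷ [])
            (1+ # 2 ≼ 1+ # 5) (m+[n∸m]≡n e≤start , e₁-eq)

    agree : ∀ e → e ≤ L → e ≢ suc e₁ → P e ≡ Q e
    agree e e≤ ≢ with <-cmp e (suc e₁)
    ... | tri< lt _ _ = above e (≤-pred lt)
    ... | tri≈ _ eq _ = ⊥-elim (≢ eq)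
    ... | tri> _ _ gt = subst (λ k → P k ≡ Q k) (m∸n+n≡m gt)
        (below (e ∸ (2 + e₁)) (≤-trans (≤-reflexive (m∸n+n≡m gt)) e≤))

    insideλ : PathInside lam u π
    insideλ e e≤ with e ≟ suc e₁
    ... | yes refl = P₁∈
    ... | no  ≢    = subst (_∈Y lam) (sym (agree e e≤L ≢)) (μ⊆λ (Q∈ e e≤L))
      where e≤L = ≤-trans e≤ (≤-reflexive len≡)

    tied′ : Tied (insertHook lam u π) (insertHook mu u ρ)
    tied′ = record
      { off = off-preserved off insideλ ins (D-tailλ j (<⇒≤ i<m)) (D-tailμ j i<m)
          (λ e d _ _ e≤ → ≤-trans e≤ (≤-reflexive len≡))
          (λ e d eq d≢a e≤ → ≤-trans e≤ (≤-reflexive (sym len≡)) ,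
            agree e e≤ λ { refl → d≢a (linear (start i ∸ suc a ∷ d ∷ row lam i ∷ m ∸ i ∷ a′ ∷ [])
                (1+ (# 0 ⊕ # 1) ≃ # 2 ⊕ # 3 ∷ # 0 ⊕ 1+ 1+ # 4 ≃ # 2 ⊕ # 3 ∷ [])
                (# 1 ≃ 1+ # 4) (eq , e₁-eq)) })
      -- The forced west step that keeps the tie leaves the diagonal `a` in λ and the diagonal
      -- `a + 1` in μ.
      ; tieλ = tie-preserved insideλ (D-tailλ j (<⇒≤ i<m)) {a′} {suc e₁}
          (linear (start i ∸ suc a ∷ a′ ∷ row lam i ∷ m ∸ i ∷ [])
            (# 0 ⊕ 1+ 1+ # 1 ≃ # 2 ⊕ # 3 ∷ [])
            (1+ (# 0 ⊕ 1+ # 1) ≃ # 2 ⊕ # 3) e₁-eq) (≤-trans L≥ (≤-reflexive (sym len≡))) P₂ tieλ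
      ; tieμ = tie-preserved ins (D-tailμ j i<m) {a} {e₁} e₁-eq (<⇒≤ L≥) Q₁ tieμ
      }

  -- In row `m` the hook begins at x in λ and one cell further west in μ. From there both shapes
  -- only allow west steps, so the paths agree up to a shift of the step number by one.
  module LeftBottom {π ρ : Filling} (tied : Tied π ρ) {j : ℕ} (1≤j : 1 ≤ j) (j<a : j < a)
    (ins : PathInside mu (m , j) ρ) where
    open Tied tied

    u : Cell
    u = (m , j)

    u∈μ : u ∈Y mu
    u∈μ = s≤s z≤n , 1≤j , ≤-trans (≤-pred j<a) (≤-reflexive (sym rowμ-m))

    L : ℕ
    L = hookLen mu u

    len≡ : hookLen lam u ≡ suc L
    len≡ = linear (conj lam (proj₂ u) ∸ suc m′ ∷ row lam (suc m′) ∸ proj₂ u ∷ m′ ∷ proj₂ u ∷ conj lam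
        (proj₂ u) ∷ row lam (suc m′) ∷ conj mu j ∸ suc m′ ∷ row mu (suc m′) ∸ j ∷ conj mu (proj₂ u) ∷ row mu
            (proj₁ u) ∷ a′ ∷ [])
          ((# 0 ⊕ # 1) ⊕ 1+ (# 2 ⊕ # 3) ≃ # 4 ⊕ # 5 ∷ (# 6 ⊕ # 7) ⊕ 1+ (# 2 ⊕ # 3) ≃ # 8 ⊕ # 9 ∷ # 4 ≃ 1+ # 2 ∷
            # 8 ≃ 1+ # 2 ∷ # 5 ≃ 1+ # 10 ∷ # 9 ≃ # 10 ∷ [])
          (# 0 ⊕ # 1 ≃ 1+ (# 6 ⊕ # 7)) (hookLen-sum part (μ⊆λ u∈μ) , hookLen-sum partμ u∈μ , conjλ-low 1≤j
            (<⇒≤ j<a) , conjμ-low 1≤j j<a , row-m , rowμ-m)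

    L≤ : L ≤ a′
    L≤ = linear (conj mu j ∸ suc m′ ∷ row mu (suc m′) ∸ j ∷ m′ ∷ proj₂ u ∷ conj mu (proj₂ u) ∷ row mu
        (proj₁ u) ∷ a′ ∷ [])
          ((# 0 ⊕ # 1) ⊕ 1+ (# 2 ⊕ # 3) ≃ # 4 ⊕ # 5 ∷ # 4 ≃ 1+ # 2 ∷ # 5 ≃ # 6 ∷ [])
          (# 0 ⊕ # 1 ≼ # 6) (hookLen-sum partμ u∈μ , conjμ-low 1≤j j<a , rowμ-m)

    P Q : ℕ → Cell
    P = HookPosition lam u π
    Q = HookPosition mu u ρ

    Dλ : D (hookTail lam u) a
    Dλ = linear (row lam (suc m′) ∷ a′ ∷ m′ ∷ [])
          (# 0 ≃ 1+ # 1 ∷ [])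
          (# 0 ⊕ 1+ # 2 ≃ 1+ (# 2 ⊕ 1+ # 1)) row-m

    Dμ : D (hookTail mu u) a′
    Dμ = linear (row mu (suc m′) ∷ a′ ∷ m′ ∷ [])
          (# 0 ≃ # 1 ∷ [])
          (# 0 ⊕ 1+ # 2 ≃ 1+ (# 2 ⊕ # 1)) rowμ-m

    P₀ : P 0 ≡ x
    P₀ = cong (m ,_) row-m

    P₁ : P 1 ≡ wC (P 0)
    P₁ = nextλ-low π (subst (_∈Y lam) (sym P₀) x∈λ) Dλ ≤-refl

    P₁≡Q₀ : P 1 ≡ Q 0
    P₁≡Q₀ = trans P₁ (trans (cong wC P₀) (cong (m ,_) (sym rowμ-m)))

    shifted : ∀ e → e ≤ L → P (suc e) ≡ Q e
    shifted zero    _  = P₁≡Q₀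
    shifted (suc e) le = trans (cong (next lam π) (shifted e (<⇒≤ le)))
      (trans (nextλ-low π (μ⊆λ (ins e (<⇒≤ le))) DQ (<⇒≤ d<a)) (sym (nextμ-low ρ (ins e (<⇒≤ le)) DQ d<a)))
      where
      e≤a′ : e ≤ a′
      e≤a′ = ≤-trans (<⇒≤ le) L≤
      DQ : D (Q e) (a′ ∸ e)
      DQ = position-D ins Dμ e (m≤n⇒m≤1+n (<⇒≤ le)) (m+[n∸m]≡n e≤a′)
      d<a : a′ ∸ e < a
      d<a = s≤s (m∸n≤m a′ e)

    insideλ : PathInside lam u π
    insideλ zero    _  = subst (_∈Y lam) (sym P₀) x∈λ
    insideλ (suc e) e≤ = subst (_∈Y lam) (sym (shifted e e≤L)) (μ⊆λ (ins e e≤L))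
      where e≤L = ≤-pred (≤-trans e≤ (≤-reflexive len≡))

    tied′ : Tied (insertHook lam u π) (insertHook mu u ρ)
    tied′ = record
      { off  = λ w w∈ ¬D → insert-agree {lam} {mu} {u} {u} {π} {ρ} {w} (off w w∈ ¬D) (to w ¬D) (from w)
      ; tieλ = tie-preserved insideλ Dλ {a′} {0} refl (≤-trans (s≤s z≤n) (≤-reflexive (sym len≡))) P₁ tieλ
      ; tieμ = tieμ′
      }
      where
      to : ∀ w → ¬ D w a → OnHook lam u π w → OnHook mu u ρ w
      to w ¬D (zero  , _  , refl) = ⊥-elim (¬D Dλ)
      to w ¬D (suc e , e≤ , eq)   = e , e≤L , trans eq (shifted e e≤L)
        where e≤L = ≤-pred (≤-trans e≤ (≤-reflexive len≡))
      from : ∀ w → OnHook mu u ρ w → OnHook lam u π w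
      from w (e , e≤ , eq) = suc e , ≤-trans (s≤s e≤) (≤-reflexive (sym len≡)) , trans eq (sym (shifted e e≤))
      high : ∀ {w d} → D w d → a′ < d → insertHook mu u ρ w ≡ ρ w
      high {w} {d} Dw lt = untouched ins Dμ Dw λ e _ eq _ → ⊥-elim (inconsistent (e ∷ d ∷ a′ ∷ [])
            (# 0 ⊕ # 1 ≃ # 2 ∷ 1+ # 2 ≼ # 1 ∷ [])
            (eq , lt))
      tieμ′ : ∀ w → w ∈Y mu → D w (suc a) → insertHook mu u ρ w ≡ ext (insertHook mu u ρ) (wC w)
      tieμ′ w@(suc p , suc zero)    w∈ Dw = trans (high Dw (m≤n⇒m≤1+n ≤-refl)) (tieμ w w∈ Dw)
      tieμ′ w@(suc p , suc (suc q)) w∈ Dw = trans (high Dw (m≤n⇒m≤1+n ≤-refl))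
        (trans (tieμ w w∈ Dw) (sym (high {d = a} (linear (q ∷ m′ ∷ p ∷ a′ ∷ [])
              (1+ 1+ (# 0 ⊕ 1+ # 1) ≃ 1+ (# 2 ⊕ 1+ 1+ # 3) ∷ [])
              (1+ (# 0 ⊕ 1+ # 1) ≃ 1+ (# 2 ⊕ 1+ # 3)) Dw) ≤-refl)))

  -- The ties make the toggle degenerate. The east neighbour of `v` is tied to `v`, so `es` is
  -- `ρ v`. The north neighbour is tied to its own west neighbour, which is at most the west
  -- neighbour of `v`, so `nw` is the west entry; and that is `π v` by `tieλ`.
  Tied⇒Toggle : ∀ {π ρ} → Monotone mu ρ → Tied π ρ → Toggle π ρ 0
  Tied⇒Toggle {π} {ρ} mono tied = record
    { off  = off
    ; diag = λ v v∈ Dv → cong₂ _+_ (π≡nw (μ⊆λ v∈) Dv) (trans (sym (east≡ v∈ Dv))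
        (sym (m≤n⇒m⊓n≡m (≤-trans (≤-reflexive (east≡ v∈ Dv)) (proj₂ (mono v v∈) (diag-south v∈ Dv))))))
    ; top  = π≡nw x∈λ D-x
    }
    where
    open Tied tied
    east≡ : ∀ {v} → v ∈Y mu → D v a → ρ (eC v) ≡ ρ v
    east≡ {v@(suc p , suc q)} v∈ Dv = tieμ (eC v) (diag-east v∈ Dv) (linear (q ∷ m′ ∷ p ∷ a′ ∷ [])
          (1+ (# 0 ⊕ 1+ # 1) ≃ 1+ (# 2 ⊕ 1+ # 3) ∷ [])
          (1+ 1+ (# 0 ⊕ 1+ # 1) ≃ 1+ (# 2 ⊕ 1+ 1+ # 3)) Dv)
    north≤west : ∀ {v} → v ∈Y lam → D v a → ext ρ (nC v) ≤ ext ρ (wC v)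
    north≤west {suc zero , suc q} v∈ Dv = z≤n
    north≤west {suc (suc p) , suc zero} v∈ Dv = ≤-reflexive (tieμ _ (diag-north-μ v∈ Dv) (linear (m′ ∷ p ∷ a′ ∷ [])
          (1+ 1+ # 0 ≃ 1+ 1+ (# 1 ⊕ 1+ # 2) ∷ [])
          (1+ 1+ # 0 ≃ 1+ (# 1 ⊕ 1+ 1+ # 2)) Dv))
    north≤west {suc (suc p) , suc (suc q)} v∈ Dv =
      ≤-trans (≤-reflexive (tieμ (suc p , suc (suc q)) n∈ (linear (q ∷ m′ ∷ p ∷ a′ ∷ [])
            (1+ 1+ (# 0 ⊕ 1+ # 1) ≃ 1+ 1+ (# 2 ⊕ 1+ # 3) ∷ [])
            (1+ 1+ (# 0 ⊕ 1+ # 1) ≃ 1+ (# 2 ⊕ 1+ 1+ # 3)) Dv)))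
        (proj₂ (mono (suc p , suc q) (s≤s z≤n , s≤s z≤n , <⇒≤ (proj₂ (proj₂ n∈)))) (diag-west-μ v∈ Dv))
      where n∈ = diag-north-μ v∈ Dv
    west : ∀ {v} → v ∈Y lam → D v a → ext π (wC v) ≡ ext ρ (wC v)
    west {suc p , suc zero} v∈ Dv = refl
    west {suc p , suc (suc q)} v∈ Dv = off _ (diag-west-μ v∈ Dv) λ Dw → inconsistent (q ∷ m′ ∷ p ∷ a′ ∷ [])
          (1+ 1+ (# 0 ⊕ 1+ # 1) ≃ 1+ (# 2 ⊕ 1+ # 3) ∷ 1+ (# 0 ⊕ 1+ # 1) ≃ 1+ (# 2 ⊕ 1+ # 3) ∷ [])
          (Dv , Dw)
    π≡nw : ∀ {v} → v ∈Y lam → D v a → π v ≡ nw ρ v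
    π≡nw {v} v∈ Dv = trans (tieλ v v∈ Dv) (trans (west v∈ Dv) (sym (m≤n⇒m⊔n≡n (north≤west v∈ Dv))))

  -- The column of x

  Ties : ℕ → Filling → Set
  Ties b ρ = ∀ w → w ∈Y mu → D w (suc a) → b < proj₁ w → ρ w ≡ ext ρ (wC w)

  end : ℕ → Filling → Cell
  end i ρ = HookPosition mu (i , a) ρ (hookLen mu (i , a))

  -- A hook of this column ends on the diagonal `a + 1` of μ: it raises an entry there but not the
  -- west neighbour, which may break the tie in that row. `Ties b` keeps the ties below row `b`
  -- only, so all hooks still to come, those of rows `i` and below, must end at row `b` or lower.
  Reach : ℕ → ℕ → Filling → Set
  Reach b i ρ = ∀ i′ → i ≤ i′ → i′ < m → b ≤ proj₁ (end i′ ρ)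

  column-a∈μ : ∀ {i} → 1 ≤ i → i < m → (i , a) ∈Y mu
  column-a∈μ 1≤i i<m = 1≤i , s≤s z≤n , a≤rowμ 1≤i i<m

  -- Column `a` stops at row `m′` in μ, hence the end on the diagonal `a + 1`; in λ it continues to
  -- x.
  lenμ-a : ∀ {i} → 1 ≤ i → i < m → hookLen mu (i , a) + suc a ≡ start i
  lenμ-a {i} 1≤i i<m = linear (conj mu a ∸ i ∷ row mu i ∸ a ∷ i ∷ a′ ∷ conj mu a ∷ row mu i ∷ m′ ∷ row lam i ∷
      suc m′ ∸ i ∷ [])
        ((# 0 ⊕ # 1) ⊕ (# 2 ⊕ 1+ # 3) ≃ # 4 ⊕ # 5 ∷ # 4 ≃ # 6 ∷ # 5 ≃ # 7 ∷ # 8 ⊕ # 2 ≃ 1+ # 6 ∷ [])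
        ((# 0 ⊕ # 1) ⊕ 1+ 1+ # 3 ≃ # 7 ⊕ # 8) (hookLen-sum partμ (column-a∈μ 1≤i i<m) , conjμ-a , rowμ i
            (<⇒≢ i<m) , m∸n+n≡m (<⇒≤ i<m))

  lenλ-a : ∀ {i} → 1 ≤ i → i < m → hookLen lam (i , a) ≡ suc (hookLen mu (i , a))
  lenλ-a {i} 1≤i i<m = linear (conj lam a ∸ i ∷ row lam i ∸ a ∷ i ∷ a′ ∷ conj lam a ∷ row lam i ∷
      conj mu a ∸ i ∷ row mu i ∸ a ∷ conj mu a ∷ row mu i ∷ m′ ∷ [])
        ((# 0 ⊕ # 1) ⊕ (# 2 ⊕ 1+ # 3) ≃ # 4 ⊕ # 5 ∷ (# 6 ⊕ # 7) ⊕ (# 2 ⊕ 1+ # 3) ≃ # 8 ⊕ # 9 ∷ # 8 ≃ # 10 ∷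
            # 4 ≃ 1+ # 10 ∷ # 9 ≃ # 5 ∷ [])
        (# 0 ⊕ # 1 ≃ 1+ (# 6 ⊕ # 7)) (hookLen-sum part (μ⊆λ (column-a∈μ 1≤i i<m)) , hookLen-sum partμ
            (column-a∈μ 1≤i i<m) , conjμ-a , conjλ-low {a} (s≤s z≤n) ≤-refl , rowμ i (<⇒≢ i<m))

  -- The bumping lemma: a hook of column a inserted after one starting in a weakly higher row stays weakly south of it.
  module Bump {ρ : Filling} {i i′ : ℕ} (1≤i : 1 ≤ i) (i≤i′ : i ≤ i′) (i′<m : i′ < m) (ins : PathInside mu (i , a) ρ) where

    i<m : i < m
    i<m = ≤-trans (s≤s i≤i′) i′<m

    ρ′ : Filling
    ρ′ = insertHook mu (i , a) ρ

    L : ℕ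
    L = hookLen mu (i , a)

    P P′ : ℕ → Cell
    P  = HookPosition mu (i , a) ρ
    P′ = HookPosition mu (i′ , a) ρ′

    start≤ : start i′ ≤ start i
    start≤ = linear (row lam i′ ∷ row lam i ∷ suc m′ ∸ i ∷ i ∷ m′ ∷ suc m′ ∸ i′ ∷ i′ ∷ [])
          (# 0 ≼ # 1 ∷ # 2 ⊕ # 3 ≃ 1+ # 4 ∷ # 5 ⊕ # 6 ≃ 1+ # 4 ∷ # 3 ≼ # 6 ∷ [])
          (# 0 ⊕ # 5 ≼ # 1 ⊕ # 2) (row-antitone part 1≤i i≤i′ , m∸n+n≡m (<⇒≤ i<m) , m∸n+n≡m (<⇒≤ i′<m) , i≤i′)

    s : ℕ
    s = start i ∸ start i′

    s+ : s + start i′ ≡ start i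
    s+ = m∸n+n≡m start≤

    s≤L : s ≤ L
    s≤L = linear (start i ∸ start i′ ∷ row lam i′ ∷ m ∸ i′ ∷ row lam i ∷ m ∸ i ∷ conj mu a ∸ i ∷ row mu i ∸ a ∷ a′ ∷ [])
          (# 0 ⊕ (# 1 ⊕ # 2) ≃ # 3 ⊕ # 4 ∷ (# 5 ⊕ # 6) ⊕ 1+ 1+ # 7 ≃ # 3 ⊕ # 4 ∷ 1+ 1+ # 7 ≼ # 1 ⊕ # 2 ∷ [])
          (# 0 ≼ # 5 ⊕ # 6) (s+ , lenμ-a 1≤i i<m , start≥ (≤-trans 1≤i i≤i′) i′<m)

    D-P : ∀ e {d} → e ≤ L → e + d ≡ start i → D (P e) d
    D-P e e≤ = position-D ins (D-tailμ a i<m) e (m≤n⇒m≤1+n e≤)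

    -- Row `i′` ends exactly on this diagonal, and lower rows, being no longer, do not reach it.
    first : ∀ y → y ∈Y mu → D y (start i′) → proj₁ y ≤ i′
    first (p , q) (1≤p , 1≤q , q≤r) Dy with p ≤? i′
    ... | yes le = le
    ... | no  gt = ⊥-elim (inconsistent (q ∷ m′ ∷ p ∷ row lam i′ ∷ suc m′ ∸ i′ ∷ row mu p ∷ row mu i′ ∷ i′ ∷ [])
          (# 0 ⊕ 1+ # 1 ≃ # 2 ⊕ (# 3 ⊕ # 4) ∷ # 0 ≼ # 5 ∷ # 5 ≼ # 6 ∷ # 6 ≃ # 3 ∷ 1+ # 7 ≼ # 2 ∷
            # 4 ⊕ # 7 ≃ 1+ # 1 ∷ [])
          (Dy , q≤r , row-antitone partμ (≤-trans 1≤i i≤i′) (<⇒≤ (≰⇒> gt)) , rowμ i′ (<⇒≢ i′<m) , ≰⇒> gt ,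
            m∸n+n≡m (<⇒≤ i′<m)))

    -- A path strictly further north catches up by at most one row per step, so the order is at risk
    -- only in a common cell. If the first path went south there, it did so on a tie, and having
    -- raised both entries it leaves the same tie to the second path.
    advance : ∀ y y′ d → y ∈Y mu → D y (suc d) → D y′ (suc d) → proj₁ y ≤ proj₁ y′ →
      ρ′ y ≡ suc (ρ y) → ρ′ (next mu ρ y) ≡ suc (ρ (next mu ρ y)) →
      D (next mu ρ′ y′) d × proj₁ (next mu ρ y) ≤ proj₁ (next mu ρ′ y′)
    advance y@(p , q) y′@(p′ , q′) d y∈@(_ , 1≤q , _) Dy Dy′ p≤p′ hit hit′ = D′ , le
      where
      1≤q′ : 1 ≤ q′
      1≤q′ = linear (q ∷ m′ ∷ p ∷ d ∷ q′ ∷ p′ ∷ [])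
            (# 0 ⊕ 1+ # 1 ≃ # 2 ⊕ 1+ # 3 ∷ # 4 ⊕ 1+ # 1 ≃ # 5 ⊕ 1+ # 3 ∷ # 2 ≼ # 5 ∷ κ 1 ≼ # 0 ∷ [])
            (κ 1 ≼ # 4) (Dy , Dy′ , p≤p′ , 1≤q)
      D′ : D (next mu ρ′ y′) d
      D′ with next mu ρ′ y′ | next-cases mu ρ′ y′
      ... | _ | inj₁ refl = linear (q′ ∷ m′ ∷ p′ ∷ d ∷ [])
            (# 0 ⊕ 1+ # 1 ≃ # 2 ⊕ 1+ # 3 ∷ [])
            (# 0 ⊕ 1+ # 1 ≃ 1+ (# 2 ⊕ # 3)) Dy′
      ... | _ | inj₂ refl = linear (q′ ∷ m′ ∷ p′ ∷ d ∷ q′ ∸ 1 ∷ [])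
            (# 0 ⊕ 1+ # 1 ≃ # 2 ⊕ 1+ # 3 ∷ # 4 ⊕ κ 1 ≃ # 0 ∷ [])
            (# 4 ⊕ 1+ # 1 ≃ # 2 ⊕ # 3) (Dy′ , m∸n+n≡m 1≤q′)
      row≥ : p′ ≤ proj₁ (next mu ρ′ y′)
      row≥ with next mu ρ′ y′ | next-cases mu ρ′ y′
      ... | _ | inj₁ refl = n≤1+n p′
      ... | _ | inj₂ refl = ≤-refl
      row≤ : proj₁ (next mu ρ y) ≤ suc p
      row≤ with next mu ρ y | next-cases mu ρ y
      ... | _ | inj₁ refl = ≤-refl
      ... | _ | inj₂ refl = n≤1+n p
      west-le : next mu ρ y ≡ wC y → proj₁ (next mu ρ y) ≤ proj₁ (next mu ρ′ y′)
      west-le e = ≤-trans (≤-reflexive (cong proj₁ e)) (≤-trans p≤p′ row≥)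
      le : proj₁ (next mu ρ y) ≤ proj₁ (next mu ρ′ y′)
      le with m≤n⇒m<n∨m≡n p≤p′
      ... | inj₁ p<p′ = ≤-trans row≤ (≤-trans p<p′ row≥)
      ... | inj₂ refl with Sμ.vertical? y y∈
      ...   | no ¬v = west-le (Sμ.next-horizontal ρ y∈ ¬v)
      ...   | yes v with ρ y ≟ ρ (sC y)
      ...     | no ≢ = west-le (Sμ.next-west ρ y∈ v ≢)
      ...     | yes e = ≤-trans row≤ (≤-reflexive (cong proj₁
          (sym (trans (cong (next mu ρ′) y′≡y) (Sμ.next-south ρ′ y∈ v e′)))))
        where
        y′≡y : y′ ≡ y
        y′≡y = D-row {y′} {y} Dy′ Dy refl
        south : next mu ρ y ≡ sC y
        south = Sμ.next-south ρ y∈ v e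
        e′ : ρ′ y ≡ ρ′ (sC y)
        e′ = trans hit (trans (cong suc e) (trans (cong (suc ∘ ρ) (sym south)) (trans (sym hit′) (cong ρ′ south))))

    follow : ∀ e d → e + s ≤ L → e + d ≡ start i′ → D (P′ e) d × proj₁ (P (e + s)) ≤ proj₁ (P′ e)
    follow zero    d le eq = subst (D (P′ 0)) (sym eq) (D-tailμ a i′<m) , first (P s) (ins s s≤L) (D-P s s≤L s+)
    follow (suc e) d le eq with follow e (suc d) (<⇒≤ le) (trans (+-suc e d) eq)
    ... | D′ , p≤ = advance (P (e + s)) (P′ e) d (ins (e + s) (<⇒≤ le))
        (D-P (e + s) (<⇒≤ le) (linear (e ∷ d ∷ row lam i′ ∷ m ∸ i′ ∷ start i ∸ start i′ ∷ row lam i ∷ m ∸ i ∷ [])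
          (1+ (# 0 ⊕ # 1) ≃ # 2 ⊕ # 3 ∷ # 4 ⊕ (# 2 ⊕ # 3) ≃ # 5 ⊕ # 6 ∷ [])
          ((# 0 ⊕ # 4) ⊕ 1+ # 1 ≃ # 5 ⊕ # 6) (eq , s+))) D′ p≤
      (touched ins (D-tailμ a i<m) (e + s) (<⇒≤ le)) (touched ins (D-tailμ a i<m) (suc e + s) le)

    end≤ : proj₁ (end i ρ) ≤ proj₁ (end i′ ρ′)
    end≤ = subst (λ k → proj₁ (P k) ≤ proj₁ (end i′ ρ′)) L′+s
      (proj₂ (follow (hookLen mu (i′ , a)) (suc a) (≤-reflexive L′+s) (lenμ-a (≤-trans 1≤i i≤i′) i′<m)))
      where
      L′+s : hookLen mu (i′ , a) + s ≡ L
      L′+s = linear (start i ∸ start i′ ∷ row lam i′ ∷ m ∸ i′ ∷ row lam i ∷ m ∸ i ∷ conj mu a ∸ i ∷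
          row mu i ∸ a ∷ a′ ∷ conj mu a ∸ i′ ∷ row mu i′ ∸ a ∷ [])
            (# 0 ⊕ (# 1 ⊕ # 2) ≃ # 3 ⊕ # 4 ∷ (# 5 ⊕ # 6) ⊕ 1+ 1+ # 7 ≃ # 3 ⊕ # 4 ∷
              (# 8 ⊕ # 9) ⊕ 1+ 1+ # 7 ≃ # 1 ⊕ # 2 ∷ [])
            ((# 8 ⊕ # 9) ⊕ # 0 ≃ # 5 ⊕ # 6) (s+ , lenμ-a 1≤i i<m , lenμ-a (≤-trans 1≤i i≤i′) i′<m)

  -- Fomin's local rule: the path enters the diagonal next to that of x in y and the diagonal of x
  -- in v, where v = s y if the larger shape allows it and v = w y (a bump) otherwise.
  module Local {π ρ π′ ρ′ : Filling} {b : ℕ} (R : Toggle π ρ 0) (mono : Monotone mu ρ) (ties : Ties b ρ)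
    {y v : Cell} (y∈ : y ∈Y mu) (Dy : D y (suc a)) (b≤ : b ≤ proj₁ y)
    (go-south : π y ≡ π (sC y) → v ≡ sC y) (go-west : π y ≢ π (sC y) → v ≡ wC y)
    (ρ′-y : ρ′ y ≡ suc (ρ y))
    (ρ′-low : ∀ {w d} → D w d → d ≤ a → ρ′ w ≡ ρ w)
    (ρ′-≢y : ∀ {w} → D w (suc a) → w ≢ y → ρ′ w ≡ ρ w)
    (off′ : v ∈Y lam → Off π′ ρ′)
    (π′-v : v ∈Y lam → π′ v ≡ suc (π v))
    (π′-≢v : v ∈Y lam → ∀ {w} → D w a → w ≢ v → π′ w ≡ π w) where
    open Toggle R

    Result : Set
    Result = v ∈Y lam × Toggle π′ ρ′ 0

    sy∈ : sC y ∈Y lam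
    sy∈ = south-inside part (μ⊆λ y∈) (Vλ-diag Dy)

    Dsy : D (sC y) a
    Dsy = linear (proj₂ y ∷ m′ ∷ proj₁ y ∷ a′ ∷ [])
          (# 0 ⊕ 1+ # 1 ≃ # 2 ⊕ 1+ 1+ # 3 ∷ [])
          (# 0 ⊕ 1+ # 1 ≃ 1+ (# 2 ⊕ 1+ # 3)) Dy

    πy : π y ≡ ρ y
    πy = off y y∈ λ Da → inconsistent (a′ ∷ [])
          (1+ 1+ # 0 ≃ 1+ # 0 ∷ [])
          (D-unique {y} Dy Da)

    ext-west′ : ∀ {w} → w ∈Y lam → D w a → ext ρ′ (wC w) ≡ ext ρ (wC w)
    ext-west′ {suc p , suc zero}    w∈ Dw = refl
    ext-west′ {suc p , suc (suc q)} w∈ Dw = ρ′-low {d = a′} (linear (q ∷ m′ ∷ p ∷ a′ ∷ [])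
          (1+ 1+ (# 0 ⊕ 1+ # 1) ≃ 1+ (# 2 ⊕ 1+ # 3) ∷ [])
          (1+ (# 0 ⊕ 1+ # 1) ≃ 1+ (# 2 ⊕ # 3)) Dw) (n≤1+n a′)

    south′ : ∀ {w} → D w a → ρ′ (sC w) ≡ ρ (sC w)
    south′ {p , q} Dw = ρ′-low {d = a′} (linear (q ∷ m′ ∷ p ∷ a′ ∷ [])
          (# 0 ⊕ 1+ # 1 ≃ # 2 ⊕ 1+ # 3 ∷ [])
          (# 0 ⊕ 1+ # 1 ≃ 1+ (# 2 ⊕ # 3)) Dw) (n≤1+n a′)

    ext-north′ : ∀ {w} → w ∈Y lam → D w a → w ≢ sC y → ext ρ′ (nC w) ≡ ext ρ (nC w)
    ext-north′ {suc zero , suc q}    w∈ Dw w≢ = refl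
    ext-north′ {suc (suc p) , suc q} w∈ Dw w≢ = ρ′-≢y (linear (q ∷ m′ ∷ p ∷ a′ ∷ [])
          (1+ (# 0 ⊕ 1+ # 1) ≃ 1+ 1+ (# 2 ⊕ 1+ # 3) ∷ [])
          (1+ (# 0 ⊕ 1+ # 1) ≃ 1+ (# 2 ⊕ 1+ 1+ # 3)) Dw) λ e → w≢ (cong sC e)

    ext-north-y : ext ρ′ (nC (sC y)) ≡ suc (ext ρ (nC (sC y)))
    ext-north-y = trans (ext-inside ρ′ y∈) (trans ρ′-y (cong suc (sym (ext-inside ρ y∈))))

    east′ : ∀ {w} → D w a → eC w ≢ y → ρ′ (eC w) ≡ ρ (eC w)
    east′ {p , q} Dw ≢ = ρ′-≢y {p , suc q} (linear (q ∷ m′ ∷ p ∷ a′ ∷ [])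
          (# 0 ⊕ 1+ # 1 ≃ # 2 ⊕ 1+ # 3 ∷ [])
          (1+ (# 0 ⊕ 1+ # 1) ≃ # 2 ⊕ 1+ 1+ # 3) Dw) ≢

    north-y : ext ρ (nC (sC y)) ≡ ρ y
    north-y = ext-inside ρ y∈

    y-east : ∀ {w} → w ∈Y lam → w ≡ wC y → eC w ≡ y
    y-east {p , suc q} (_ , _ , _) e = go y e
      where
      go : ∀ y → (p , suc q) ≡ wC y → (p , suc (suc q)) ≡ y
      go (p , suc (suc q)) refl = refl

    west-y : ∀ {w} → eC w ≡ y → w ≡ wC y
    west-y e = cong wC e

    -- Here the north entry decides `nw` at `sC y`. The tie below row `b` makes `es` equal to ρ
    -- there, so the toggle (or `top`, if `sC y` is x) gives `π (sC y)` the value `π y`, and the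
    -- path goes south. Raising `ρ y` raises `nw` at `sC y` by one, and leaves `es` at `wC y` alone,
    -- where the south entry is the minimum.
    stay : ext ρ (wC (sC y)) ≤ ρ y → Result
    stay le = v∈ , record { off = off′ v∈ ; diag = diag′ ; top = top′ }
      where
      nw-sy : nw ρ (sC y) ≡ ρ y
      nw-sy = trans (cong (_⊔ ext ρ (wC (sC y))) north-y) (m≥n⇒m⊔n≡m le)
      π-sy : π (sC y) ≡ ρ y
      π-sy with λ⇒μ sy∈
      ... | inj₁ e    = trans (cong π e) (trans top (trans (cong (nw ρ) (sym e)) nw-sy))
      ... | inj₂ sy∈μ = linear (π (sC y) ∷ ρ (sC y) ∷ nw ρ (sC y) ∷ es ρ (sC y) ∷ ρ y ∷ [])
            (# 0 ⊕ # 1 ≃ # 2 ⊕ # 3 ∷ # 2 ≃ # 4 ∷ # 3 ≃ # 1 ∷ [])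
            (# 0 ≃ # 4) (diag (sC y) sy∈μ Dsy , nw-sy , es-sy)
        where
        tie : ρ (eC (sC y)) ≡ ρ (sC y)
        tie = trans (ties (eC (sC y)) (diag-east sy∈μ Dsy) (linear (proj₂ y ∷ m′ ∷ proj₁ y ∷ a′ ∷ [])
              (# 0 ⊕ 1+ # 1 ≃ # 2 ⊕ 1+ 1+ # 3 ∷ [])
              (1+ (# 0 ⊕ 1+ # 1) ≃ 1+ (# 2 ⊕ 1+ 1+ # 3)) Dy) (s≤s b≤)) (ext-inside ρ {mu} sy∈μ)
        es-sy : es ρ (sC y) ≡ ρ (sC y)
        es-sy = trans (cong (_⊓ ρ (sC (sC y))) tie) (m≤n⇒m⊓n≡m (proj₂ (mono (sC y) sy∈μ) (diag-south sy∈μ Dsy)))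
      v≡ : v ≡ sC y
      v≡ = go-south (trans πy (sym π-sy))
      v∈ : v ∈Y lam
      v∈ = subst (_∈Y lam) (sym v≡) sy∈
      nw′-sy : ∀ {w} → w ≡ sC y → nw ρ′ w ≡ suc (nw ρ w)
      nw′-sy refl = trans (cong₂ _⊔_ ext-north-y (ext-west′ sy∈ Dsy))
        (trans (m≥n⇒m⊔n≡m (m≤n⇒m≤1+n le′)) (cong suc (sym (m≥n⇒m⊔n≡m le′))))
        where
        le′ : ext ρ (wC (sC y)) ≤ ext ρ (nC (sC y))
        le′ = ≤-trans le (≤-reflexive (sym north-y))
      nw′ : ∀ {w} → w ∈Y lam → D w a → w ≢ sC y → nw ρ′ w ≡ nw ρ w
      nw′ w∈ Dw w≢ = cong₂ _⊔_ (ext-north′ w∈ Dw w≢) (ext-west′ w∈ Dw)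
      es′ : ∀ {w} → w ∈Y mu → D w a → es ρ′ w ≡ es ρ w
      es′ {w} w∈ Dw with eC w ≟C y
      ... | no ≢ = cong₂ _⊓_ (east′ Dw ≢) (south′ Dw)
      ... | yes e = trans (cong₂ _⊓_ (trans (cong ρ′ e) ρ′-y) (south′ Dw))
          (trans (m≥n⇒m⊓n≡n (m≤n⇒m≤1+n le′)) (trans (sym (m≥n⇒m⊓n≡n le′)) (cong (λ z → ρ z ⊓ ρ (sC w)) (sym e))))
        where
        le′ : ρ (sC w) ≤ ρ y
        le′ = ≤-trans (≤-reflexive (trans (sym (ext-inside ρ {mu} (diag-south w∈ Dw)))
            (cong (λ z → ext ρ (wC (sC z))) e))) le
      diag′ : ∀ w → w ∈Y mu → D w a → π′ w + ρ′ w ≡ nw ρ′ w + es ρ′ w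
      diag′ w w∈ Dw with w ≟C sC y
      ... | yes e = trans (cong₂ _+_ (trans (cong π′ (trans e (sym v≡)))
          (trans (π′-v v∈) (cong (suc ∘ π) (trans v≡ (sym e))))) (ρ′-low Dw ≤-refl))
          (trans (cong suc (diag w w∈ Dw)) (sym (cong₂ _+_ (nw′-sy e) (es′ w∈ Dw))))
      ... | no ≢ = trans (cong₂ _+_ (π′-≢v v∈ Dw (λ e → ≢ (trans e v≡))) (ρ′-low Dw ≤-refl))
          (trans (diag w w∈ Dw) (sym (cong₂ _+_ (nw′ (μ⊆λ w∈) Dw ≢) (es′ w∈ Dw))))
      top′ : π′ x ≡ nw ρ′ x
      top′ with x ≟C sC y
      ... | yes e = trans (trans (cong π′ (trans e (sym v≡))) (trans (π′-v v∈) (cong (suc ∘ π) (trans v≡ (sym e)))))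
          (trans (cong suc top) (sym (nw′-sy e)))
      ... | no ≢ = trans (π′-≢v v∈ D-x (λ e → ≢ (trans e v≡))) (trans top (sym (nw′ x∈λ D-x ≢)))

    -- Now `nw` at `sC y` exceeds `ρ y`, hence so does `π (sC y)`, and the path goes west. Raising
    -- `ρ y` by one does not lift it above the west neighbour of `sC y`, so that `nw` is unchanged,
    -- whereas `es` at `wC y` grows by one.
    bump : ρ y < ext ρ (wC (sC y)) → Result
    bump lt = v∈ , record { off = off′ v∈ ; diag = diag′ ; top = top′ }
      where
      wy∈ : wC y ∈Y mu
      wy∈ = go y y∈ lt
        where
        go : ∀ y → y ∈Y mu → ρ y < ext ρ (wC (sC y)) → wC y ∈Y mu
        go (suc p , suc zero)    _               ()
        go (suc p , suc (suc q)) (1≤p , _ , q≤r) _ = 1≤p , s≤s z≤n , <⇒≤ q≤r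
      Dwy : D (wC y) a
      Dwy = go y y∈ Dy
        where
        go : ∀ y → y ∈Y mu → D y (suc a) → D (wC y) a
        go (p , suc q) _ Dy = linear (q ∷ m′ ∷ p ∷ a′ ∷ [])
              (1+ (# 0 ⊕ 1+ # 1) ≃ # 2 ⊕ 1+ 1+ # 3 ∷ [])
              (# 0 ⊕ 1+ # 1 ≃ # 2 ⊕ 1+ # 3) Dy
      v≡ : v ≡ wC y
      v≡ = go-west λ e →
        inconsistent (ρ y ∷ ext ρ (wC (sC y)) ∷ π y ∷ π (sC y) ∷ nw ρ (sC y) ∷ [])
              (1+ # 0 ≼ # 1 ∷ # 2 ≃ # 0 ∷ # 2 ≃ # 3 ∷ # 4 ≼ # 3 ∷ # 1 ≼ # 4 ∷ [])
              (lt , πy , e , Toggle-nw≤ mono R sy∈ Dsy , m≤n⊔m (ext ρ (nC (sC y))) (ext ρ (wC (sC y))))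
      v∈ : v ∈Y lam
      v∈ = subst (_∈Y lam) (sym v≡) (μ⊆λ wy∈)
      nw′ : ∀ {w} → w ∈Y lam → D w a → nw ρ′ w ≡ nw ρ w
      nw′ {w} w∈ Dw with w ≟C sC y
      ... | no  ≢    = cong₂ _⊔_ (ext-north′ w∈ Dw ≢) (ext-west′ w∈ Dw)
      ... | yes refl = trans (cong₂ _⊔_ (trans ext-north-y (cong suc north-y)) (ext-west′ sy∈ Dsy))
          (trans (m≤n⇒m⊔n≡n lt) (trans (sym (m≤n⇒m⊔n≡n (<⇒≤ lt))) (cong (_⊔ ext ρ (wC (sC y))) (sym north-y))))
      es′ : ∀ {w} → D w a → eC w ≢ y → es ρ′ w ≡ es ρ w
      es′ Dw ≢ = cong₂ _⊓_ (east′ Dw ≢) (south′ Dw)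
      es′-wy : ∀ {w} → w ∈Y mu → D w a → eC w ≡ y → es ρ′ w ≡ suc (es ρ w)
      es′-wy {w} w∈ Dw e = trans (cong₂ _⊓_ (trans (cong ρ′ e) ρ′-y) (south′ Dw))
          (trans (m≤n⇒m⊓n≡m lt′) (cong suc (trans (sym (m≤n⇒m⊓n≡m (<⇒≤ lt′))) (cong (λ z → ρ z ⊓ ρ (sC w)) (sym e)))))
        where
        lt′ : ρ y < ρ (sC w)
        lt′ = ≤-trans lt (≤-reflexive (sym (trans (sym (ext-inside ρ {mu} (diag-south w∈ Dw)))
            (cong (λ z → ext ρ (wC (sC z))) e))))
      diag′ : ∀ w → w ∈Y mu → D w a → π′ w + ρ′ w ≡ nw ρ′ w + es ρ′ w
      diag′ w w∈ Dw with eC w ≟C y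
      ... | yes e = trans (cong₂ _+_ (trans (cong π′ w≡v) (trans (π′-v v∈) (cong (suc ∘ π) (sym w≡v))))
          (ρ′-low Dw ≤-refl))
          (trans (cong suc (diag w w∈ Dw)) (trans (sym (+-suc _ _))
            (sym (cong₂ _+_ (nw′ (μ⊆λ w∈) Dw) (es′-wy w∈ Dw e)))))
        where
        w≡v : w ≡ v
        w≡v = trans (west-y e) (sym v≡)
      ... | no ≢ = trans (cong₂ _+_ (π′-≢v v∈ Dw (λ e → ≢ (y-east (μ⊆λ w∈) (trans e v≡)))) (ρ′-low Dw ≤-refl))
          (trans (diag w w∈ Dw) (sym (cong₂ _+_ (nw′ (μ⊆λ w∈) Dw) (es′ Dw ≢))))
      top′ : π′ x ≡ nw ρ′ x
      top′ = trans (π′-≢v v∈ D-x λ e → x∉μ (subst (_∈Y mu) (sym (trans e v≡)) wy∈)) (trans top (sym (nw′ x∈λ D-x)))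

    result : Result
    result with ext ρ (wC (sC y)) ≤? ρ y
    ... | yes le = stay le
    ... | no  gt = bump (≰⇒> gt)

  module ColumnUpper {π ρ : Filling} (R : Toggle π ρ 0) (mono : Monotone mu ρ) {i b : ℕ} (1≤i : 1 ≤ i) (i<m : i < m)
    (ins : PathInside mu (i , a) ρ) (ties : Ties b ρ) (b≤ : b ≤ proj₁ (end i ρ)) where
    open Toggle R

    u : Cell
    u = (i , a)

    L : ℕ
    L = hookLen mu u

    L-eq : L + suc a ≡ start i
    L-eq = lenμ-a 1≤i i<m

    π′ ρ′ : Filling
    π′ = insertHook lam u π
    ρ′ = insertHook mu u ρ

    Dμ : D (hookTail mu u) (start i)
    Dμ = D-tailμ a i<m

    Dλ : D (hookTail lam u) (start i)
    Dλ = D-tailλ a (<⇒≤ i<m)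

    y : Cell
    y = end i ρ

    y∈ : y ∈Y mu
    y∈ = ins L ≤-refl

    Dy : D y (suc a)
    Dy = position-D ins Dμ L (n≤1+n L) L-eq

    above : ∀ e → e ≤ L → HookPosition lam u π e ≡ HookPosition mu u ρ e
    above e e≤ = agree-above i<m off ins e (suc a + (L ∸ e)) e≤
        (linear (conj mu a ∸ i + (row mu i ∸ a) ∸ e ∷ e ∷ conj mu a ∸ i ∷ row mu i ∸ a ∷ a′ ∷ row lam i ∷ m ∸ i ∷ [])
          (# 0 ⊕ # 1 ≃ # 2 ⊕ # 3 ∷ (# 2 ⊕ # 3) ⊕ 1+ 1+ # 4 ≃ # 5 ⊕ # 6 ∷ [])
          (# 1 ⊕ 1+ 1+ (# 4 ⊕ # 0) ≃ # 5 ⊕ # 6) (m∸n+n≡m e≤ , L-eq)) (m≤m+n _ _)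

    v : Cell
    v = next lam π y

    P-last : HookPosition lam u π (suc L) ≡ v
    P-last = cong (next lam π) (above L ≤-refl)

    ρ′-y : ρ′ y ≡ suc (ρ y)
    ρ′-y = touched ins Dμ L ≤-refl

    ρ′-low : ∀ {w d} → D w d → d ≤ a → ρ′ w ≡ ρ w
    ρ′-low {w} {d} Dw d≤a = untouched ins Dμ Dw λ e e≤ eq _ → ⊥-elim
        (inconsistent (e ∷ conj mu a ∸ i ∷ row mu i ∸ a ∷ d ∷ row lam i ∷ m ∸ i ∷ a′ ∷ [])
          (# 0 ≼ # 1 ⊕ # 2 ∷ # 0 ⊕ # 3 ≃ # 4 ⊕ # 5 ∷ (# 1 ⊕ # 2) ⊕ 1+ 1+ # 6 ≃ # 4 ⊕ # 5 ∷ # 3 ≼ 1+ # 6 ∷ [])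
          (e≤ , eq , L-eq , d≤a))

    ρ′-≢y : ∀ {w} → D w (suc a) → w ≢ y → ρ′ w ≡ ρ w
    ρ′-≢y Dw w≢ = untouched-at ins Dμ Dw L L-eq w≢

    -- That `v` lies in λ is itself a conclusion of the local rule, so the facts about the λ-path
    -- are supplied conditionally on it.
    insideλ : v ∈Y lam → PathInside lam u π
    insideλ v∈ e e≤ = split (m≤n⇒m<n∨m≡n (≤-trans e≤ (≤-reflexive (lenλ-a 1≤i i<m))))
      where
      split : e < suc L ⊎ e ≡ suc L → HookPosition lam u π e ∈Y lam
      split (inj₁ lt) = subst (_∈Y lam) (sym (above e (≤-pred lt))) (μ⊆λ (ins e (≤-pred lt)))
      split (inj₂ eq) = subst (λ k → HookPosition lam u π k ∈Y lam) (sym eq) (subst (_∈Y lam) (sym P-last) v∈)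

    off′ : v ∈Y lam → Off π′ ρ′
    off′ v∈ = off-preserved off (insideλ v∈) ins Dλ Dμ
      (λ e d eq d≢a e≤ → short e d eq d≢a (≤-trans e≤ (≤-reflexive (lenλ-a 1≤i i<m))))
      (λ e d eq d≢a e≤ → ≤-trans (m≤n⇒m≤1+n e≤) (≤-reflexive (sym (lenλ-a 1≤i i<m))) , above e e≤)
      where
      short : ∀ e d → e + d ≡ start i → d ≢ a → e ≤ suc L → e ≤ L
      short e d eq d≢a e≤ with m≤n⇒m<n∨m≡n e≤
      ... | inj₁ (s≤s e≤L) = e≤L
      ... | inj₂ refl      = ⊥-elim (d≢a (linear (conj mu a ∸ i ∷ row mu i ∸ suc a′ ∷ d ∷ row lam i ∷
          suc m′ ∸ i ∷ a′ ∷ [])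
            (1+ ((# 0 ⊕ # 1) ⊕ # 2) ≃ # 3 ⊕ # 4 ∷ (# 0 ⊕ # 1) ⊕ 1+ 1+ # 5 ≃ # 3 ⊕ # 4 ∷ [])
            (# 2 ≃ 1+ # 5) (eq , L-eq)))

    π′-v : v ∈Y lam → π′ v ≡ suc (π v)
    π′-v v∈ = insert-on lam u π v (suc L , ≤-reflexive (sym (lenλ-a 1≤i i<m)) , sym P-last)

    π′-≢v : v ∈Y lam → ∀ {w} → D w a → w ≢ v → π′ w ≡ π w
    π′-≢v v∈ Dw w≢ = untouched-at (insideλ v∈) Dλ Dw (suc L)
        (linear (conj mu a ∸ i ∷ row mu i ∸ a ∷ a′ ∷ row lam i ∷ m ∸ i ∷ [])
          ((# 0 ⊕ # 1) ⊕ 1+ 1+ # 2 ≃ # 3 ⊕ # 4 ∷ [])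
          (1+ ((# 0 ⊕ # 1) ⊕ 1+ # 2) ≃ # 3 ⊕ # 4) L-eq) λ e → w≢ (trans e P-last)

    open Local R mono ties {y} {v} y∈ Dy b≤
      (Sλ.next-south π (μ⊆λ y∈) (Vλ-diag Dy)) (Sλ.next-west π (μ⊆λ y∈) (Vλ-diag Dy))
      ρ′-y ρ′-low ρ′-≢y off′ π′-v π′-≢v public using (result)

    insideλ′ : PathInside lam u π
    insideλ′ = insideλ (proj₁ result)

    toggle′ : Toggle π′ ρ′ 0
    toggle′ = proj₂ result

    ties′ : Ties (proj₁ y) ρ′
    ties′ w@(suc p , suc zero) w∈ Dw lt =
      trans (ρ′-≢y Dw λ { e → <-irrefl (sym (cong proj₁ e)) lt }) (ties w w∈ Dw (≤-trans (s≤s b≤) lt))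
    ties′ w@(suc p , suc (suc q)) w∈ Dw lt =
      trans (ρ′-≢y Dw λ { e → <-irrefl (sym (cong proj₁ e)) lt })
        (trans (ties w w∈ Dw (≤-trans (s≤s b≤) lt)) (sym (ρ′-low {d = a} (linear (q ∷ m′ ∷ p ∷ a′ ∷ [])
              (1+ 1+ (# 0 ⊕ 1+ # 1) ≃ 1+ (# 2 ⊕ 1+ 1+ # 3) ∷ [])
              (1+ (# 0 ⊕ 1+ # 1) ≃ 1+ (# 2 ⊕ 1+ # 3)) Dw) ≤-refl)))

    reach′ : Reach (proj₁ y) i ρ′
    reach′ i′ i≤i′ i′<m = Bump.end≤ 1≤i i≤i′ i′<m ins

  -- Copies of the hook of x

  module Corner {π ρ : Filling} {n : ℕ} (R : Toggle π ρ n) where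
    open Toggle R

    len≡ : hookLen lam x ≡ 0
    len≡ = cong₂ _+_ (trans (cong (_∸ m) (conjλ-low (s≤s z≤n) ≤-refl)) (n∸n≡0 m)) (trans (cong (_∸ a) row-m) (n∸n≡0 a))

    tail≡ : hookTail lam x ≡ x
    tail≡ = cong (m ,_) row-m

    insideλ : PathInside lam x π
    insideλ e e≤ with e | ≤-trans e≤ (≤-reflexive len≡)
    ... | zero | _ = subst (_∈Y lam) (sym tail≡) x∈λ

    only : ∀ w → w ≢ x → insertHook lam x π w ≡ π w
    only w w≢ = insert-off lam x π w λ { (e , e≤ , eq) → away e (≤-trans e≤ (≤-reflexive len≡)) eq }
      where
      away : ∀ e → e ≤ 0 → ¬ (w ≡ HookPosition lam x π e)
      away zero _ eq = w≢ (trans eq tail≡)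

    toggle′ : Toggle (insertHook lam x π) ρ (suc n)
    toggle′ = record
      { off  = λ w w∈ ¬D → trans (only w λ { refl → x∉μ w∈ }) (off w w∈ ¬D)
      ; diag = λ w w∈ Dw → trans (cong (_+ ρ w) (only w λ { refl → x∉μ w∈ })) (diag w w∈ Dw)
      ; top  = trans (insert-on lam x π x (0 , z≤n , sym tail≡)) (cong suc top)
      }

  -- Columns right of x

  module Right {π ρ : Filling} {n : ℕ} (R : Toggle π ρ n) {i j : ℕ} (u∈ : (i , j) ∈Y lam) (a<j : a < j)
    (ins : PathInside mu (i , j) ρ) where
    open Toggle R

    u : Cell
    u = (i , j)

    1≤i : 1 ≤ i
    1≤i = proj₁ u∈

    i<m : i < m
    i<m = s≤s (≤-trans (j≤row⇒i≤conj part 1≤i (proj₁ (proj₂ u∈)) (proj₂ (proj₂ u∈))) (conj-high≤ a<j))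

    u∈μ : u ∈Y mu
    u∈μ = 1≤i , proj₁ (proj₂ u∈) , ≤-trans (proj₂ (proj₂ u∈)) (≤-reflexive (sym (rowμ i (<⇒≢ i<m))))

    len≡ : hookLen lam u ≡ hookLen mu u
    len≡ = linear (conj lam j ∸ i ∷ row lam i ∸ j ∷ i ∷ j ∷ conj lam j ∷ row lam i ∷ conj mu j ∸ i ∷
        row mu i ∸ j ∷ conj mu j ∷ row mu i ∷ [])
          ((# 0 ⊕ # 1) ⊕ (# 2 ⊕ # 3) ≃ # 4 ⊕ # 5 ∷ (# 6 ⊕ # 7) ⊕ (# 2 ⊕ # 3) ≃ # 8 ⊕ # 9 ∷ # 8 ≃ # 4 ∷ # 9 ≃ # 5 ∷ [])
          (# 0 ⊕ # 1 ≃ # 6 ⊕ # 7) (hookLen-sum part u∈ , hookLen-sum partμ u∈μ , conj-high a<j , rowμ i (<⇒≢ i<m))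

    -- The hook ends in a column beyond `a` and in a row above `m`, hence on a diagonal of at least
    -- `a + 2`.
    deep : ∀ e d → e ≤ hookLen mu u → e + d ≡ start i → suc a < d
    deep e d e≤ eq = linear (e ∷ conj mu j ∸ i ∷ row mu i ∸ j ∷ d ∷ row lam i ∷ m ∸ i ∷ i ∷ j ∷ conj mu j ∷
        row mu i ∷ conj lam j ∷ m′ ∷ a′ ∷ [])
          (# 0 ≼ # 1 ⊕ # 2 ∷ # 0 ⊕ # 3 ≃ # 4 ⊕ # 5 ∷ (# 1 ⊕ # 2) ⊕ (# 6 ⊕ # 7) ≃ # 8 ⊕ # 9 ∷ # 8 ≃ # 10 ∷
            # 10 ≼ # 11 ∷ # 9 ≃ # 4 ∷ # 5 ⊕ # 6 ≃ 1+ # 11 ∷ 1+ 1+ # 12 ≼ # 7 ∷ [])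
          (1+ 1+ 1+ # 12 ≼ # 3) (e≤ , eq , hookLen-sum partμ u∈μ , conj-high a<j , conj-high≤ a<j , rowμ i
            (<⇒≢ i<m) , m∸n+n≡m (<⇒≤ i<m) , a<j)

    agree : ∀ e → e ≤ hookLen mu u → HookPosition lam u π e ≡ HookPosition mu u ρ e
    agree e e≤ = agree-above i<m off ins e (start i ∸ e) e≤ eq (<⇒≤ (deep e _ e≤ eq))
      where
      eq : e + (start i ∸ e) ≡ start i
      eq = m+[n∸m]≡n {e} (linear (e ∷ conj mu j ∸ i ∷ row mu i ∸ j ∷ i ∷ j ∷ conj mu j ∷ row mu i ∷ conj lam j ∷
          m′ ∷ row lam i ∷ suc m′ ∸ i ∷ [])
            (# 0 ≼ # 1 ⊕ # 2 ∷ (# 1 ⊕ # 2) ⊕ (# 3 ⊕ # 4) ≃ # 5 ⊕ # 6 ∷ # 5 ≃ # 7 ∷ # 7 ≼ # 8 ∷ # 6 ≃ # 9 ∷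
              # 10 ⊕ # 3 ≃ 1+ # 8 ∷ [])
            (# 0 ≼ # 9 ⊕ # 10) (e≤ , hookLen-sum partμ u∈μ , conj-high a<j , conj-high≤ a<j , rowμ i (<⇒≢ i<m) ,
              m∸n+n≡m (<⇒≤ i<m)))

    insideλ : PathInside lam u π
    insideλ e e≤ = subst (_∈Y lam) (sym (agree e e≤′)) (μ⊆λ (ins e e≤′))
      where e≤′ = ≤-trans e≤ (≤-reflexive len≡)

    π-low : ∀ {w d} → D w d → d ≤ suc a → insertHook lam u π w ≡ π w
    π-low {w} {d} Dw d≤ = untouched insideλ (D-tailλ j (<⇒≤ i<m)) Dw
      λ e e≤ eq _ → <⇒≱ (deep e d (≤-trans e≤ (≤-reflexive len≡)) eq) d≤

    ρ-low : ∀ {w d} → D w d → d ≤ suc a → insertHook mu u ρ w ≡ ρ w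
    ρ-low {w} {d} Dw d≤ = untouched ins (D-tailμ j i<m) Dw λ e e≤ eq _ → <⇒≱ (deep e d e≤ eq) d≤

    nw′ : ∀ {w} → w ∈Y lam → D w a → nw (insertHook mu u ρ) w ≡ nw ρ w
    nw′ w∈ Dw = cong₂ _⊔_ (north w∈ Dw) (west w∈ Dw)
      where
      north : ∀ {w} → w ∈Y lam → D w a → ext (insertHook mu u ρ) (nC w) ≡ ext ρ (nC w)
      north {suc zero , suc q}    w∈ Dw = refl
      north {suc (suc p) , suc q} w∈ Dw = ρ-low {d = suc a} (linear (q ∷ m′ ∷ p ∷ a′ ∷ [])
            (1+ (# 0 ⊕ 1+ # 1) ≃ 1+ 1+ (# 2 ⊕ 1+ # 3) ∷ [])
            (1+ (# 0 ⊕ 1+ # 1) ≃ 1+ (# 2 ⊕ 1+ 1+ # 3)) Dw) ≤-refl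
      west : ∀ {w} → w ∈Y lam → D w a → ext (insertHook mu u ρ) (wC w) ≡ ext ρ (wC w)
      west {suc p , suc zero}    w∈ Dw = refl
      west {suc p , suc (suc q)} w∈ Dw = ρ-low {d = a′} (linear (q ∷ m′ ∷ p ∷ a′ ∷ [])
            (1+ 1+ (# 0 ⊕ 1+ # 1) ≃ 1+ (# 2 ⊕ 1+ # 3) ∷ [])
            (1+ (# 0 ⊕ 1+ # 1) ≃ 1+ (# 2 ⊕ # 3)) Dw) (m≤n⇒m≤1+n (n≤1+n a′))

    es′ : ∀ {w} → D w a → es (insertHook mu u ρ) w ≡ es ρ w
    es′ {p , q} Dw = cong₂ _⊓_ (ρ-low {p , suc q} {suc a} (linear (q ∷ m′ ∷ p ∷ a′ ∷ [])
          (# 0 ⊕ 1+ # 1 ≃ # 2 ⊕ 1+ # 3 ∷ [])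
          (1+ (# 0 ⊕ 1+ # 1) ≃ # 2 ⊕ 1+ 1+ # 3) Dw) ≤-refl) (ρ-low {suc p , q} {a′} (linear (q ∷ m′ ∷ p ∷ a′ ∷ [])
          (# 0 ⊕ 1+ # 1 ≃ # 2 ⊕ 1+ # 3 ∷ [])
          (# 0 ⊕ 1+ # 1 ≃ 1+ (# 2 ⊕ # 3)) Dw) (m≤n⇒m≤1+n (n≤1+n a′)))

    toggle′ : Toggle (insertHook lam u π) (insertHook mu u ρ) n
    toggle′ = record
      { off  = off-preserved off insideλ ins (D-tailλ j (<⇒≤ i<m)) (D-tailμ j i<m)
          (λ e d _ _ e≤ → ≤-trans e≤ (≤-reflexive len≡))
          (λ e d _ _ e≤ → ≤-trans e≤ (≤-reflexive (sym len≡)) , agree e e≤)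
      ; diag = λ w w∈ Dw → trans (cong₂ _+_ (π-low Dw (n≤1+n a)) (ρ-low Dw (n≤1+n a)))
          (trans (diag w w∈ Dw) (sym (cong₂ _+_ (nw′ (μ⊆λ w∈) Dw) (es′ Dw))))
      ; top  = trans (π-low D-x (n≤1+n a)) (trans top (cong (n +_) (sym (nw′ x∈λ D-x))))
      }

  -- The simulation of μ by λ, column by column

  LeftSim : List Cell → List Cell → Set
  LeftSim k l = Good mu l → Good lam k × Tied (insertAll lam k) (insertAll mu l)

  -- Goodness on μ, the induction hypothesis, is peeled off one hook at a time together with the
  -- list. Each layer supplies the μ-path and the monotone μ-filling from which the data for λ are
  -- built.
  left-step : ∀ i j → 1 ≤ i → i ≤ m → 1 ≤ j → j < a → ∀ {k l} → LeftSim k l → LeftSim ((i , j) ∷ k) ((i , j) ∷ l)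
  left-step i j 1≤i i≤m 1≤j j<a {k} {l} sim (goodμ , ins , mono) = extend (m≤n⇒m<n∨m≡n i≤m)
    where
    good = proj₁ (sim goodμ)
    tied = proj₂ (sim goodμ)
    pack : PathInside lam (i , j) (insertAll lam k) → Tied (insertAll lam ((i , j) ∷ k)) (insertAll mu ((i , j) ∷ l)) →
      Good lam ((i , j) ∷ k) × Tied (insertAll lam ((i , j) ∷ k)) (insertAll mu ((i , j) ∷ l))
    pack insλ tied′ = (good , insλ , Toggle⇒Monotone mono (Tied⇒Toggle mono tied′)) , tied′
    bottom : i ≡ m → PathInside mu (i , j) (insertAll mu l) →
      Good lam ((i , j) ∷ k) × Tied (insertAll lam ((i , j) ∷ k)) (insertAll mu ((i , j) ∷ l))
    bottom refl ins′ = pack LB.insideλ LB.tied′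
      where module LB = LeftBottom tied 1≤j j<a ins′
    extend : i < m ⊎ i ≡ m → Good lam ((i , j) ∷ k) × Tied (insertAll lam ((i , j) ∷ k)) (insertAll mu ((i , j) ∷ l))
    extend (inj₁ i<m) = pack U.insideλ U.tied′
      where module U = LeftUpper tied 1≤i i<m 1≤j j<a ins
    extend (inj₂ eq) = bottom eq ins

  left : ∀ t n → n < a → LeftSim (hooks (conj lam) t n) (hooks (conj mu) t n)
  left t zero    n<a _ = tt , record
    { off = λ _ _ _ → refl ; tieλ = λ w _ _ → zero≡ (wC w) ; tieμ = λ w _ _ → zero≡ (wC w) }
    where
    zero≡ : ∀ w → 0 ≡ ext zeroFilling w
    zero≡ (zero  , _)     = refl
    zero≡ (suc _ , zero)  = refl
    zero≡ (suc _ , suc _) = refl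
  left t (suc n) n<a = subst₂ (λ c c′ → LeftSim (columnOnto t (suc n) c (hooks (conj lam) t n))
      (columnOnto t (suc n) c′ (hooks (conj mu) t n)))
    (sym (conjλ-low (s≤s z≤n) (<⇒≤ n<a))) (sym (conjμ-low (s≤s z≤n) n<a))
    (lift-column LeftSim t (suc n) m (λ i 1≤i i≤m → left-step i (suc n) 1≤i i≤m (s≤s z≤n) n<a) (left t n (<⇒≤ n<a)))

  Sim : ℕ → List Cell → List Cell → Set
  Sim n k l = Good lam k × Toggle (insertAll lam k) (insertAll mu l) n

  ColumnSim : ℕ → List Cell → List Cell → Set
  ColumnSim i k l = Good mu l → Sim 0 k l × ∃ λ b → Ties b (insertAll mu l) × Reach b i (insertAll mu l)

  column-step : ∀ i → 1 ≤ i → i < m → ∀ {k l} → ColumnSim i k l → ColumnSim i ((i , a) ∷ k) ((i , a) ∷ l)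
  column-step i 1≤i i<m {k} {l} sim (goodμ , ins , mono) with sim goodμ
  ... | (good , toggle) , b , ties , reach =
      ((good , CU.insideλ′ , Toggle⇒Monotone mono CU.toggle′) , CU.toggle′) , _ , CU.ties′ , CU.reach′
    where module CU = ColumnUpper toggle (Good⇒Monotone l goodμ) 1≤i i<m ins ties (reach i ≤-refl i<m)

  column : ∀ t n → n < m → ∀ {k l} → LeftSim k l → ColumnSim n (columnOnto t a n k) (columnOnto t a n l)
  column t zero n<m {k} {l} sim goodμ with sim goodμ
  -- Before the column of x all ties are intact, which is the bound `b = 0`.
  ... | good , tied = (good , Tied⇒Toggle (Good⇒Monotone l goodμ) tied) , 0 ,
      (λ w w∈ Dw _ → Tied.tieμ tied w w∈ Dw) , λ _ _ _ → z≤n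
  column t (suc n) n<m sim = lift-replicate (ColumnSim (suc n)) (column-step (suc n) (s≤s z≤n) n<m) (t (suc n , a))
    λ goodμ → let (s , b , ties , reach) = column t n (<⇒≤ n<m) sim goodμ in
      s , b , ties , λ i′ le → reach i′ (<⇒≤ le)

  corner-copies : ∀ c n k l → Monotone mu (insertAll mu l) → Sim n k l → Sim (c + n) (replicate c x ++ k) l
  corner-copies zero    n k l mono s = s
  corner-copies (suc c) n k l mono s with corner-copies c n k l mono s
  ... | good , toggle = (good , CU.insideλ , Toggle⇒Monotone mono CU.toggle′) , CU.toggle′
    where module CU = Corner toggle

  RightSim : ℕ → List Cell → List Cell → Set
  RightSim n k l = Good mu l → Sim n k l

  right-step : ∀ n i j → (i , j) ∈Y lam → a < j → ∀ {k l} → RightSim n k l → RightSim n ((i , j) ∷ k) ((i , j) ∷ l)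
  right-step n i j u∈ a<j sim (goodμ , ins , mono) with sim goodμ
  ... | good , toggle = (good , R.insideλ , Toggle⇒Monotone mono R.toggle′) , R.toggle′
    where module R = Right toggle u∈ a<j ins

  right : ∀ t n → RightSim (t x) (hooks (conj lam) t (n + a)) (hooks (conj mu) t (n + a))
  right t zero goodμ = subst (λ c → RightSim (t x) (columnOnto t a c (hooks (conj lam) t a′)) (hooks (conj mu) t a))
      (sym (conjλ-low {a} (s≤s z≤n) ≤-refl)) top goodμ
    where
    lower : ColumnSim m′ (columnOnto t a m′ (hooks (conj lam) t a′)) (hooks (conj mu) t a)
    lower = subst (λ c → ColumnSim m′ (columnOnto t a m′ (hooks (conj lam) t a′))
        (columnOnto t a c (hooks (conj mu) t a′)))
      (sym conjμ-a) (column t m′ ≤-refl (left t a′ ≤-refl))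
    top : RightSim (t x) (columnOnto t a m (hooks (conj lam) t a′)) (hooks (conj mu) t a)
    top goodμ = subst (λ n → Sim n (columnOnto t a m (hooks (conj lam) t a′)) (hooks (conj mu) t a)) (+-identityʳ (t x))
      (corner-copies (t x) 0 (columnOnto t a m′ (hooks (conj lam) t a′)) (hooks (conj mu) t a)
          (Good⇒Monotone (hooks (conj mu) t a) goodμ) (proj₁ (lower goodμ)))
  right t (suc n) = subst (λ c → RightSim (t x) (hooks (conj lam) t (suc n + a))
      (columnOnto t (suc (n + a)) c (hooks (conj mu) t (n + a))))
    (sym (conj-high a<)) (lift-column (RightSim (t x)) t (suc (n + a)) (conj lam (suc (n + a)))
      (λ i 1≤i i≤c → right-step (t x) i (suc (n + a)) (1≤i , s≤s z≤n , i≤conj⇒j≤row part 1≤i i≤c) a<) (right t n))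
    where
    a< : a < suc (n + a)
    a< = s≤s (m≤n+m a n)

  -- If λ has a single row, then μ has one column fewer. That column has height 0 in μ and
  -- contributes no hooks, so both lists can run over the columns of λ.
  hooksμ≡ : ∀ t → hooks (conj mu) t (row mu 1) ≡ hooks (conj mu) t (row lam 1)
  hooksμ≡ t with m′ ≟ 0
  ... | no  ≢    = cong (hooks (conj mu) t) (rowμ 1 (λ e → ≢ (sym (suc-injective e))))
  ... | yes m′≡0 = trans (cong (hooks (conj mu) t) (trans (cong (row mu) (cong suc (sym m′≡0))) rowμ-m))
      (trans (cong (λ c → columnOnto t a c (hooks (conj mu) t a′)) (sym (trans conjμ-a m′≡0)))
        (cong (hooks (conj mu) t) (trans (sym row-m) (cong (row lam) (cong suc m′≡0)))))

  simulation : ∀ t → RightSim (t x) (hooks (conj lam) t (row lam 1)) (hooks (conj mu) t (row mu 1))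
  simulation t = subst₂ (λ n l → RightSim (t x) (hooks (conj lam) t n) l)
    (m∸n+n≡m a≤) (trans (cong (hooks (conj mu) t) (m∸n+n≡m a≤)) (sym (hooksμ≡ t))) (right t (row lam 1 ∸ a))
    where
    a≤ : a ≤ row lam 1
    a≤ = a≤row ≤-refl (s≤s z≤n)

  -- One step of the recursion for ξ

  ζ-cong : ∀ {π ρ} → (∀ u → u ∈Y lam → π u ≡ ρ u) → ∀ u → u ∈Y mu → ζ lam x π u ≡ ζ lam x ρ u
  ζ-cong {π} {ρ} eq u u∈ = decide (D? u a)
    where
    off : Off π ρ
    off v v∈ _ = eq v (μ⊆λ v∈)
    decide : Dec (D u a) → ζ lam x π u ≡ ζ lam x ρ u
    decide (no ¬D)  = trans (ζ-off π u ¬D) (trans (eq u (μ⊆λ u∈)) (sym (ζ-off ρ u ¬D)))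
    decide (yes Du) = trans (ζ-diag π u u∈ Du)
      (trans (cong₂ _∸_ (cong₂ _+_ (nw-cong off (μ⊆λ u∈) Du) (es-cong off u∈ Du)) (eq u (μ⊆λ u∈)))
          (sym (ζ-diag ρ u u∈ Du)))

  -- `corner` uses `lastPart`, while `x` has its column written as a successor; the equations bridge
  -- the two forms.
  module Recursion (corner≡ : corner lam ≡ x) (shrink≡ : shrink lam ≡ mu) where

    unfold : ∀ k π u → ξ' (suc k) lam π u ≡
      (if cellEq u x then π x ∸ toℕ (val lam π (nC x) ⊔∞ val lam π (wC x)) else ξ' k mu (ζ lam x π) u)
    unfold k π u = cong₂ (λ c kap → if cellEq u c then π c ∸ toℕ (val lam π (nC c) ⊔∞ val lam π (wC c))
      else ξ' k kap (ζ lam c π) u) corner≡ shrink≡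

    ξ′-corner : ∀ k π → ξ' (suc k) lam π x ≡ π x ∸ nw π x
    ξ′-corner k π = trans (unfold k π x) (trans
      (cong (λ b → if b then π x ∸ toℕ (val lam π (nC x) ⊔∞ val lam π (wC x)) else ξ' k mu (ζ lam x π) x)
          (cellEq-refl x))
      (cong (π x ∸_) (nw-val π x∈λ)))

    ξ′-rest : ∀ k π u → u ∈Y mu → ξ' (suc k) lam π u ≡ ξ' k mu (ζ lam x π) u
    ξ′-rest k π u u∈ = trans (unfold k π u)
      (cong (λ b → if b then π x ∸ toℕ (val lam π (nC x) ⊔∞ val lam π (wC x)) else ξ' k mu (ζ lam x π) u)
        (cellEq-≢ {u} {x} λ { refl → x∉μ u∈ }))

    ξ′-cong-step : ∀ k → (∀ {π ρ} → (∀ u → u ∈Y mu → π u ≡ ρ u) → ∀ u → u ∈Y mu → ξ' k mu π u ≡ ξ' k mu ρ u) →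
      ∀ {π ρ} → (∀ u → u ∈Y lam → π u ≡ ρ u) → ∀ u → u ∈Y lam → ξ' (suc k) lam π u ≡ ξ' (suc k) lam ρ u
    ξ′-cong-step k ih {π} {ρ} eq u u∈ with λ⇒μ u∈
    ... | inj₁ refl = trans (ξ′-corner k π) (trans (cong₂ _∸_ (eq x u∈)
        (nw-cong (λ v v∈ _ → eq v (μ⊆λ v∈)) x∈λ D-x)) (sym (ξ′-corner k ρ)))
    ... | inj₂ u∈μ  = trans (ξ′-rest k π u u∈μ) (trans (ih (ζ-cong eq) u u∈μ) (sym (ξ′-rest k ρ u u∈μ)))

    ξ′-inverse-step : ∀ k → (∀ {π ρ} → (∀ u → u ∈Y mu → π u ≡ ρ u) → ∀ u → u ∈Y mu → ξ' k mu π u ≡ ξ' k mu ρ u) →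
      ∀ {π ρ} (t : Filling) → Toggle π ρ (t x) → (∀ u → u ∈Y mu → ξ' k mu ρ u ≡ t u) →
      ∀ u → u ∈Y lam → ξ' (suc k) lam π u ≡ t u
    ξ′-inverse-step k cong′ {π} {ρ} t R ih u u∈ with λ⇒μ u∈
    ... | inj₁ refl = trans (ξ′-corner k π) (trans (cong₂ _∸_ (Toggle.top R) (nw-cong (Toggle.off R) x∈λ D-x))
        (m+n∸n≡m (t x) (nw ρ x)))
    ... | inj₂ u∈μ  = trans (ξ′-rest k π u u∈μ) (trans (cong′ (Toggle⇒ζ R) u u∈μ) (ih u u∈μ))

    ξ′-injective-step : ∀ k →
      (∀ {π ρ} → Monotone mu π → Monotone mu ρ → (∀ u → u ∈Y mu → ξ' k mu π u ≡ ξ' k mu ρ u) → ∀ u → u ∈Y mu →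
          π u ≡ ρ u) →
      ∀ {π ρ} → Monotone lam π → Monotone lam ρ → (∀ u → u ∈Y lam → ξ' (suc k) lam π u ≡ ξ' (suc k) lam ρ u) →
      ∀ u → u ∈Y lam → π u ≡ ρ u
    ξ′-injective-step k ih {π} {ρ} mπ mρ eq = Toggle-injective (ζ-Toggle mπ)
      -- Equal values of ξ at the corner give both toggles the same `n`.
      (subst (Toggle ρ (ζ lam x ρ)) (trans (sym (ξ′-corner k ρ)) (trans (sym (eq x x∈λ)) (ξ′-corner k π)))
          (ζ-Toggle mρ))
      (ih (ζ-Monotone mπ) (ζ-Monotone mρ) λ u u∈ →
        trans (sym (ξ′-rest k π u u∈)) (trans (eq u (μ⊆λ u∈)) (ξ′-rest k ρ u u∈)))

module Peel (b : ℕ) (bs : List ℕ) (part : IsPartition (b ∷ bs)) where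

  private
    lastPart≡ : lastPart (b ∷ bs) ≡ suc (pred (lastPart (b ∷ bs)))
    lastPart≡ = sym (suc-pred _ {{>-nonZero (lastPart-positive b bs part)}})

  open Removal (b ∷ bs) (shrink (b ∷ bs)) (length bs) (pred (lastPart (b ∷ bs))) part (shrink-isPartition b bs part)
    (trans (row-length b bs) lastPart≡) (row-shrink-length b bs) (row-shrink b bs)
        (λ i lt → row-beyond (b ∷ bs) lt) public
  open Recursion (cong (length (b ∷ bs) ,_) lastPart≡) refl public

-- Induction on the size of the partition

Φ′ : List ℕ → Filling → Filling
Φ′ lam t = insertAll lam (hooks (conj lam) t (row lam 1))

Φ≡Φ′ : ∀ lam t → Φ lam t ≡ Φ′ lam t
Φ≡Φ′ lam t = cong (insertAll lam) (hookMultiset≡hooks lam t)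

sum-shrink≡ : ∀ {k} b bs → IsPartition (b ∷ bs) → sum (b ∷ bs) ≡ suc k → sum (shrink (b ∷ bs)) ≡ k
sum-shrink≡ b bs part eq = suc-injective (trans (sym (sum-shrink b bs part)) eq)

empty : ∀ {u} → ¬ (u ∈Y [])
empty {zero  , _} (() , _ , _)
empty {suc _ , _} (_ , 1≤j , j≤0) = <⇒≱ 1≤j j≤0

-- The size `k` is also the fuel of `ξ'`. In the step the same filling `t` is used for λ and μ: the
-- simulation accounts for the extra copies of h^x.
hooks-good : ∀ k lam → IsPartition lam → sum lam ≡ k → ∀ t → Good lam (hooks (conj lam) t (row lam 1))
hooks-good k       []       part eq t = tt
hooks-good zero    (b ∷ bs) part eq t = ⊥-elim (1+n≢0 (trans (sym (sum-shrink b bs part)) eq))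
hooks-good (suc k) (b ∷ bs) part eq t = proj₁ (Peel.simulation b bs part t
  (hooks-good k (shrink (b ∷ bs)) (shrink-isPartition b bs part) (sum-shrink≡ b bs part eq) t))

ξ′-cong : ∀ k lam → IsPartition lam → sum lam ≡ k → ∀ {π ρ} → (∀ u → u ∈Y lam → π u ≡ ρ u) →
  ∀ u → u ∈Y lam → ξ' k lam π u ≡ ξ' k lam ρ u
ξ′-cong k       []       part eq _ u u∈ = ⊥-elim (empty u∈)
ξ′-cong zero    (b ∷ bs) part eq _ u u∈ = refl
ξ′-cong (suc k) (b ∷ bs) part eq = Peel.ξ′-cong-step b bs part k
  (ξ′-cong k (shrink (b ∷ bs)) (shrink-isPartition b bs part) (sum-shrink≡ b bs part eq))

ξ′-Φ′ : ∀ k lam → IsPartition lam → sum lam ≡ k → ∀ t u → u ∈Y lam → ξ' k lam (Φ′ lam t) u ≡ t u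
ξ′-Φ′ k       []       part eq t u u∈ = ⊥-elim (empty u∈)
ξ′-Φ′ zero    (b ∷ bs) part eq t u u∈ = ⊥-elim (1+n≢0 (trans (sym (sum-shrink b bs part)) eq))
ξ′-Φ′ (suc k) (b ∷ bs) part eq t = Peel.ξ′-inverse-step b bs part k (ξ′-cong k mu partμ eqμ) t
  (proj₂ (Peel.simulation b bs part t (hooks-good k mu partμ eqμ t))) (ξ′-Φ′ k mu partμ eqμ t)
  where
  mu = shrink (b ∷ bs)
  partμ = shrink-isPartition b bs part
  eqμ = sum-shrink≡ b bs part eq

ξ′-injective : ∀ k lam → IsPartition lam → sum lam ≡ k → ∀ {π ρ} → Monotone lam π → Monotone lam ρ →
  (∀ u → u ∈Y lam → ξ' k lam π u ≡ ξ' k lam ρ u) → ∀ u → u ∈Y lam → π u ≡ ρ u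
ξ′-injective k       []       part eq _ _ _ u u∈ = ⊥-elim (empty u∈)
ξ′-injective zero    (b ∷ bs) part eq _ _ _ u u∈ = ⊥-elim (1+n≢0 (trans (sym (sum-shrink b bs part)) eq))
ξ′-injective (suc k) (b ∷ bs) part eq = Peel.ξ′-injective-step b bs part k
  (ξ′-injective k (shrink (b ∷ bs)) (shrink-isPartition b bs part) (sum-shrink≡ b bs part eq))

mainTheorem19 : (lam : List ℕ) → IsPartition lam →
    ((t : Filling) → IsRPP lam (Φ lam t)) ×
    ((t : Filling) → ∀ u → u ∈Y lam → ξ lam (Φ lam t) u ≡ t u) ×
    ((π : Filling) → IsRPP lam π → ∀ u → u ∈Y lam → Φ lam (ξ lam π) u ≡ π u)
mainTheorem19 lam part = (λ t → Monotone⇒IsRPP (Φ-monotone t)) , ξ-Φ , λ π rpp →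
    ξ′-injective (sum lam) lam part refl (Φ-monotone (ξ lam π)) (IsRPP⇒Monotone rpp) (ξ-Φ (ξ lam π))
  where
  Φ-monotone : ∀ t → Monotone lam (Φ lam t)
  Φ-monotone t = subst (Monotone lam) (sym (Φ≡Φ′ lam t))
    (Good⇒Monotone (hooks (conj lam) t (row lam 1)) (hooks-good (sum lam) lam part refl t))
  ξ-Φ : ∀ t u → u ∈Y lam → ξ lam (Φ lam t) u ≡ t u
  ξ-Φ t u u∈ = trans (cong (λ π → ξ lam π u) (Φ≡Φ′ lam t)) (ξ′-Φ′ (sum lam) lam part refl t u u∈)
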